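{- Let $s$ be odd, let $k\ge 5$, and let $n\ge n_0(s,k)$, where $n_0(s,k)$ is some function depending only on $s$ and $k$. Let $\mathcal F\subset\binom{[n]}{k}$ be an extremal family (i.e. one of maximum possible cardinality) that does not contain a sunflower with $s$ petals and the core of size $1$. Then there exists a graph $G=K_1\sqcup K_2$ consisting of two disjoint cliques $K_1,K_2$ of size $s$ (with $V(G)\subset[n]$) such that $$\mathcal F=\Big\{F\in\binom{[n]}{k} : |F\cap V(G)|\ge 2 \text{ and for all } i\in\{1,2\} \text{ we have } |F\cap V(K_i)|\ne 1\Big\}.$$
   Context: $[n]=\{1,\dots,n\}$, and $\binom{X}{k}$ is the family of all $k$-element subsets of $X$. A family of $s$ sets $\{F_1,\dots,F_s\}$ is a sunflower with $s$ petals if $F_i\cap F_j=\bigcap_{u=1}^s F_u$ for all distinct $i,j\in\{1,\dots,s\}$; the set $\bigcap_{u=1}^s F_u$ is called its core. $V(H)$ denotes the vertex set of a graph $H$; a clique of size $s$ is a complete graph on $s$ vertices. -}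

module Defs where

open import Data.Fin using (Fin)
open import Data.Fin.Subset using (Subset; _∈_; _∩_; _∪_; ⋂; ∣_∣; Empty)
open import Data.Fin.Subset.Properties using (x∈p∪q⁺)
open import Data.List using (List; length; tabulate)
open import Data.List.Membership.Propositional using () renaming (_∈_ to _∈ₗ_)
open import Data.List.Relation.Unary.All using (All)
open import Data.List.Relation.Unary.Unique.Propositional using (Unique)
open import Data.Nat using (ℕ; _≤_)
open import Data.Product using (Σ-syntax; _×_)
open import Data.Sum using (_⊎_; inj₁; inj₂) renaming (map to map-⊎)
open import Function.Definitions using (Injective)
open import Relation.Binary.PropositionalEquality using (_≡_; _≢_)
open import Relation.Nullary using (¬_)

-- The ground set [n] is Fin n.  A finite family of subsets of [n] is a list
-- of subsets; Uniform requires the list to be duplicate-free, so that its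
-- length is the cardinality of the family.  Families are only ever compared
-- through membership, never as lists.
Family : ℕ → Set
Family n = List (Subset n)

Uniform : ∀ {n} → ℕ → Family n → Set
Uniform k 𝓕 = Unique 𝓕 × All (λ F → ∣ F ∣ ≡ k) 𝓕

core : ∀ {n s} → (Fin s → Subset n) → Subset n
core S = ⋂ (tabulate S)

-- Injectivity expresses that the petals form a set of s sets.
IsSunflower : ∀ {n s} → (Fin s → Subset n) → Set
IsSunflower S =
  Injective _≡_ _≡_ S × (∀ i j → i ≢ j → S i ∩ S j ≡ core S)

ContainsSunflower : ∀ {n} → (s c : ℕ) → Family n → Set
ContainsSunflower {n} s c 𝓕 =
  Σ[ S ∈ (Fin s → Subset n) ]
    (∀ i → S i ∈ₗ 𝓕) × IsSunflower S × ∣ core S ∣ ≡ c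

Admissible : ∀ {n} → (s k : ℕ) → Family n → Set
Admissible s k 𝓕 = Uniform k 𝓕 × ¬ ContainsSunflower s 1 𝓕

Extremal : ∀ {n} → (s k : ℕ) → Family n → Set
Extremal {n} s k 𝓕 =
  Admissible s k 𝓕 × (∀ (𝓖 : Family n) → Admissible s k 𝓖 → length 𝓖 ≤ length 𝓕)

-- Simple graphs whose vertex set is a subset of [n].
record Graph (n : ℕ) : Set₁ where
  field
    V           : Subset n
    Adj         : Fin n → Fin n → Set
    Adj-sym     : ∀ {x y} → Adj x y → Adj y x
    Adj-irrefl  : ∀ {x} → ¬ Adj x x
    Adj⇒∈V      : ∀ {x y} → Adj x y → x ∈ V

open Graph public

IsClique : ∀ {n} → ℕ → Graph n → Set
IsClique s K =
  ∣ V K ∣ ≡ s × (∀ {x y} → x ∈ V K → y ∈ V K → x ≢ y → Adj K x y)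

Disjoint : ∀ {n} → Graph n → Graph n → Set
Disjoint G H = Empty (V G ∩ V H)

-- The union of two graphs; it is their disjoint union when Disjoint G H.
infixr 6 _⊔_

_⊔_ : ∀ {n} → Graph n → Graph n → Graph n
G ⊔ H = record
  { V          = V G ∪ V H
  ; Adj        = λ x y → Adj G x y ⊎ Adj H x y
  ; Adj-sym    = map-⊎ (Adj-sym G) (Adj-sym H)
  ; Adj-irrefl = λ { (inj₁ e) → Adj-irrefl G e ; (inj₂ e) → Adj-irrefl H e }
  ; Adj⇒∈V     = λ e → x∈p∪q⁺ (map-⊎ (Adj⇒∈V G) (Adj⇒∈V H) e)
  }

{-# OPTIONS --safe #-}

-- Call a set a kernel if members of 𝓕 enlarge it while avoiding any s k prescribed further points.
-- Kernels K₁, …, Kₛ through x that pairwise meet only in x extend greedily to a forbidden sunflower.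
-- The delta-system method, applied to words enumerating the members of 𝓕, shows that all but
-- O(n^(k-3)) members F contain a pair {a, b} such that {a, b} and all {a, b, x} with x ∈ F are kernels
-- (here k ≥ 5 enters).  For a point x, the pairs {a, b} with {a, b} and {a, b, x} kernels form a graph
-- with maximum degree and matching number less than s; by Gallai's lemma it has at most s (s - 1)
-- edges, with equality only for two disjoint s-cliques.  Comparing |𝓕| with the two-clique family,
-- which is admissible because s is odd, all but O(n^(k-3)) of the (k-2)-sets E are joined to s (s - 1)
-- pairs, and then all x ∈ E have the same graph.  Hence all but O(1) points x share one graph, a
-- union of two cliques.  Members of 𝓕 meet no clique in exactly one point.  The members missing both
-- cliques live on O(1) points, so they are O(1) in number, but the presence of one of them keeps
-- about n sets of the two-clique family out of 𝓕; so maximality of 𝓕 rules them out.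

module Submission where

open import Defs
open import Data.Bool using (true; false)
import Data.Bool as Bool
open import Data.Empty using (⊥; ⊥-elim)
open import Data.Fin using (Fin; zero; suc; toℕ; inject≤)
import Data.Fin as Fin
import Data.Fin.Properties as Fin
open import Data.Fin.Subset using (Subset; _∩_; _∪_; ∣_∣; ⁅_⁆; inside; outside; ⋃) renaming (_∈_ to _∈ₛ_; _∉_ to _∉ₛ_; _⊆_ to _⊆ₛ_)
import Data.Fin.Subset as Subset
import Data.Fin.Subset.Properties as Sub
open import Data.List using (List; []; _∷_; _++_; length; map; filter; concatMap; allFin; cartesianProductWith; cartesianProduct)
import Data.List as List
open import Data.List.Membership.Propositional using (_∈_; _∉_; find; lose)
open import Data.List.Membership.Propositional.Properties
open import Data.List.Properties using (length-++; length-map; length-tabulate; length-filter)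
open import Data.List.Relation.Unary.All using (All; []; _∷_)
import Data.List.Relation.Unary.All as All
open import Data.List.Relation.Unary.All.Properties using (All¬⇒¬Any; ¬Any⇒All¬; ¬All⇒Any¬)
open import Data.List.Relation.Unary.AllPairs using ([]; _∷_)
open import Data.List.Relation.Unary.Any using (Any; here; there)
import Data.List.Relation.Unary.Any as Any
open import Data.List.Relation.Unary.Unique.Propositional using (Unique)
import Data.List.Relation.Unary.Unique.Propositional.Properties as Unique
open import Data.Nat using (ℕ; zero; suc; _+_; _*_; _∸_; _^_; _≤_; _<_; z≤n; s≤s; _%_)
import Data.Nat as ℕ
open import Data.Nat.DivMod using (m*n%n≡0)
open import Data.Nat.Properties
open import Data.Product using (Σ-syntax; ∃-syntax; _×_; _,_; proj₁; proj₂; swap)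
open import Data.Product.Properties using (,-injective; ≡-dec)
open import Data.Sum using (_⊎_; inj₁; inj₂; [_,_]′)
open import Data.Vec using (Vec; []; _∷_; lookup; tabulate; insertAt; removeAt)
import Data.Vec as Vec
import Data.Vec.Properties as Vec
open import Function using (_∘_; id; _⇔_; mk⇔)
open import Relation.Binary.Definitions using (DecidableEquality; tri<; tri≈; tri>)
open import Relation.Binary.PropositionalEquality
open import Relation.Nullary using (¬_; Dec; yes; no; does; contradiction; ¬?; _×-dec_; _⊎-dec_; _→-dec_)
open import Relation.Nullary.Decidable using (map′; dec-true; decidable-stable)

-- Finite sums over lists and injections between lists

-- The delta-system step may lose only `O(n^(k-3))` members, with a constant independent of `n`. The
-- words are split into boundedly many pieces on which each set of coordinates is either a kernel
-- for every word or sparse. If some `k - 3` coordinates lie in no proper kernel pattern, the piece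
-- itself has `O(n^(k-3))` words. Otherwise the complements of the kernel patterns form a
-- union-closed family in which any three coordinates contain a nonempty member and no member misses
-- exactly one coordinate, as a one-point kernel repeated `s` times is already a star. For `k ≥ 5`
-- such a family contains all sets that avoid two suitable coordinates, and these carry `a` and `b`.
-- The equality case of the edge bound comes from `(a + 1) min(a, d) ≤ a (d + 1)` with `d = s - 1`,
-- applied to the degree sum of a Gallai class of `a + 1` vertices: the values of `a` add up to at
-- most `2 d`, and equality needs `a = 0` or `a = d`. Parity enters only through the two-clique
-- family: for a center outside both cliques, each clique serves fewer than `s / 2` petals.

∉⇒All≢ : {A : Set} {x : A} {xs : List A} → x ∉ xs → All (x ≢_) xs
∉⇒All≢ = ¬Any⇒All¬ _

unique-⊆-length : {A : Set} {xs ys : List A} → Unique xs →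
                  (∀ {x} → x ∈ xs → x ∈ ys) → length xs ≤ length ys
unique-⊆-length {xs = []} _ _ = z≤n
unique-⊆-length {xs = x ∷ xs} (x∉ ∷ u) sub with ∈-∃++ (sub (here refl))
... | as , bs , refl = begin
  suc (length xs)           ≤⟨ s≤s (unique-⊆-length u sub′) ⟩
  suc (length (as ++ bs))   ≡⟨ cong suc (length-++ as) ⟩
  suc (length as + length bs) ≡⟨ sym (+-suc (length as) _) ⟩
  length as + suc (length bs) ≡⟨ sym (length-++ as) ⟩
  length (as ++ x ∷ bs) ∎
  where
  open ≤-Reasoning
  sub′ : ∀ {y} → y ∈ xs → y ∈ as ++ bs
  sub′ y∈ with ∈-++⁻ as (sub (there y∈))
  ... | inj₁ p = ∈-++⁺ˡ p
  ... | inj₂ (here refl) = contradiction y∈ (All¬⇒¬Any x∉)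
  ... | inj₂ (there p) = ∈-++⁺ʳ as p

-- A point of `ys` missing from `xs` could be put in front of `xs`, giving a duplicate-free list
-- inside `ys` that is too long. This turns tight counts into equalities of sets.
⊆-reverse : {A : Set} → DecidableEquality A → {xs ys : List A} → Unique xs →
            (∀ {x} → x ∈ xs → x ∈ ys) → length ys ≤ length xs → ∀ {y} → y ∈ ys → y ∈ xs
⊆-reverse _≟_ {xs} {ys} u sub le {y} y∈ with Any.any? (y ≟_) xs
... | yes p = p
... | no ¬p = contradiction
  (unique-⊆-length (∉⇒All≢ ¬p ∷ u) λ { (here refl) → y∈ ; (there q) → sub q }) (≤⇒≯ le)

∑ : {A : Set} → List A → (A → ℕ) → ℕ
∑ [] f = 0
∑ (x ∷ xs) f = f x + ∑ xs f

length-concatMap : {A B : Set} (g : A → List B) (xs : List A) →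
                   length (concatMap g xs) ≡ ∑ xs (length ∘ g)
length-concatMap g [] = refl
length-concatMap g (x ∷ xs) =
  trans (length-++ (g x)) (cong (length (g x) +_) (length-concatMap g xs))

∑-mono : {A : Set} (xs : List A) {f g : A → ℕ} → (∀ {x} → x ∈ xs → f x ≤ g x) →
         ∑ xs f ≤ ∑ xs g
∑-mono [] _ = z≤n
∑-mono (x ∷ xs) h = +-mono-≤ (h (here refl)) (∑-mono xs (h ∘ there))

∑-cong : {A : Set} (xs : List A) {f g : A → ℕ} → (∀ x → f x ≡ g x) → ∑ xs f ≡ ∑ xs g
∑-cong [] _ = refl
∑-cong (x ∷ xs) h = cong₂ _+_ (h x) (∑-cong xs h)

∑-const : {A : Set} (xs : List A) (c : ℕ) → ∑ xs (λ _ → c) ≡ length xs * c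
∑-const [] c = refl
∑-const (x ∷ xs) c = cong (c +_) (∑-const xs c)

∑-*ʳ : {A : Set} (xs : List A) (f : A → ℕ) (c : ℕ) → ∑ xs (λ x → f x * c) ≡ ∑ xs f * c
∑-*ʳ [] f c = refl
∑-*ʳ (x ∷ xs) f c = trans (cong (f x * c +_) (∑-*ʳ xs f c)) (sym (*-distribʳ-+ c (f x) _))

∑-≤-const : {A : Set} (xs : List A) {f : A → ℕ} {c : ℕ} → (∀ {x} → x ∈ xs → f x ≤ c) →
            ∑ xs f ≤ length xs * c
∑-≤-const xs {c = c} h = ≤-trans (∑-mono xs h) (≤-reflexive (∑-const xs c))

-- No single term can have slack once the totals leave none. This carries the equality case of the
-- edge bound down to single classes and vertices.
∑-tight : {A : Set} (xs : List A) {f g : A → ℕ} → (∀ {x} → x ∈ xs → f x ≤ g x) →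
          ∑ xs g ≤ ∑ xs f → ∀ {x} → x ∈ xs → g x ≤ f x
∑-tight (x ∷ xs) {f} {g} h le (here refl) =
  +-cancelʳ-≤ (∑ xs g) (g x) (f x) (≤-trans le (+-monoʳ-≤ (f x) (∑-mono xs (h ∘ there))))
∑-tight (x ∷ xs) {f} {g} h le (there p) =
  ∑-tight xs (h ∘ there)
    (+-cancelˡ-≤ (f x) _ _ (≤-trans (+-monoˡ-≤ (∑ xs g) (h (here refl))) le)) p

∑-++ : {A : Set} (xs ys : List A) (f : A → ℕ) → ∑ (xs ++ ys) f ≡ ∑ xs f + ∑ ys f
∑-++ [] ys f = refl
∑-++ (x ∷ xs) ys f = trans (cong (f x +_) (∑-++ xs ys f)) (sym (+-assoc (f x) _ _))

∑-concatMap : {A B : Set} (g : A → List B) (xs : List A) (f : B → ℕ) →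
              ∑ (concatMap g xs) f ≡ ∑ xs (λ x → ∑ (g x) f)
∑-concatMap g [] f = refl
∑-concatMap g (x ∷ xs) f = trans (∑-++ (g x) _ f) (cong (∑ (g x) f +_) (∑-concatMap g xs f))

∈-concatMap-intro : {A B : Set} (g : A → List B) {xs : List A} {x : A} {y : B} →
                    x ∈ xs → y ∈ g x → y ∈ concatMap g xs
∈-concatMap-intro g x∈ y∈ = ∈-concatMap⁺ g (lose x∈ y∈)

∈-concatMap-elim : {A B : Set} (g : A → List B) (xs : List A) {y : B} →
                   y ∈ concatMap g xs → ∃[ x ] x ∈ xs × y ∈ g x
∈-concatMap-elim g xs y∈ = find (∈-concatMap⁻ g {xs = xs} y∈)

unique-concatMap : {A B : Set} {g : A → List B} {xs : List A} → Unique xs →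
  (∀ {x} → x ∈ xs → Unique (g x)) →
  (∀ {x y z} → x ∈ xs → y ∈ xs → z ∈ g x → z ∈ g y → x ≡ y) → Unique (concatMap g xs)
unique-concatMap {xs = []} _ _ _ = []
unique-concatMap {g = g} {xs = x ∷ xs} (x∉ ∷ u) ug disj =
  Unique.++⁺ (ug (here refl)) (unique-concatMap u (ug ∘ there) (λ p q → disj (there p) (there q)))
    λ { (p , q) → let y , y∈ , z∈ = ∈-concatMap-elim g xs q in
        All¬⇒¬Any x∉ (subst (_∈ xs) (sym (disj (here refl) (there y∈) p z∈)) y∈) }

length-cover : {A B : Set} {xs : List A} {ys : List B} (g : B → List A) {c : ℕ} → Unique xs →
  (∀ {x} → x ∈ xs → ∃[ y ] y ∈ ys × x ∈ g y) →
  (∀ {y} → y ∈ ys → length (g y) ≤ c) → length xs ≤ length ys * c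
length-cover {xs = xs} {ys} g {c} u cov le = begin
  length xs ≤⟨ unique-⊆-length u (λ p → let _ , q , r = cov p in ∈-concatMap-intro g q r) ⟩
  length (concatMap g ys) ≡⟨ length-concatMap g ys ⟩
  ∑ ys (length ∘ g) ≤⟨ ∑-≤-const ys le ⟩
  length ys * c ∎
  where open ≤-Reasoning

unique-map : {A B : Set} {f : A → B} {xs : List A} → Unique xs →
  (∀ {x y} → x ∈ xs → y ∈ xs → f x ≡ f y → x ≡ y) → Unique (map f xs)
unique-map {xs = []} _ _ = []
unique-map {f = f} {xs = x ∷ xs} (x∉ ∷ u) inj =
  ∉⇒All≢ (λ p → let y , y∈ , e = ∈-map⁻ f p in
    All¬⇒¬Any x∉ (subst (_∈ xs) (sym (inj (here refl) (there y∈) e)) y∈))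
  ∷ unique-map u (λ p q → inj (there p) (there q))

injection-length : {A B : Set} {xs : List A} {ys : List B} (f : A → B) → Unique xs →
  (∀ {x y} → x ∈ xs → y ∈ xs → f x ≡ f y → x ≡ y) → (∀ {x} → x ∈ xs → f x ∈ ys) →
  length xs ≤ length ys
injection-length {xs = xs} {ys} f u inj into =
  subst (_≤ length ys) (length-map f xs)
    (unique-⊆-length (unique-map u inj) λ p → let x , x∈ , e = ∈-map⁻ f p in
      subst (_∈ ys) (sym e) (into x∈))

unique-lookup-injective : {A : Set} {xs : List A} → Unique xs → ∀ {i j} →
  List.lookup xs i ≡ List.lookup xs j → i ≡ j
unique-lookup-injective (x∉ ∷ u) {zero} {zero} e = refl
unique-lookup-injective {xs = x ∷ xs} (x∉ ∷ u) {zero} {suc j} e =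
  contradiction (subst (_∈ xs) (sym e) (∈-lookup j)) (All¬⇒¬Any x∉)
unique-lookup-injective {xs = x ∷ xs} (x∉ ∷ u) {suc i} {zero} e =
  contradiction (subst (_∈ xs) e (∈-lookup i)) (All¬⇒¬Any x∉)
unique-lookup-injective (x∉ ∷ u) {suc i} {suc j} e = cong suc (unique-lookup-injective u e)

select : {A : Set} {xs : List A} {m : ℕ} → Unique xs → m ≤ length xs →
  Σ[ f ∈ (Fin m → A) ] (∀ i → f i ∈ xs) × (∀ {i j} → f i ≡ f j → i ≡ j)
select {xs = xs} u le = (λ i → List.lookup xs (inject≤ i le)) , (λ i → ∈-lookup _) ,
  λ e → Fin.inject≤-injective le le _ _ (unique-lookup-injective u e)

filter-length-< : {A : Set} {P : A → Set} (P? : ∀ x → Dec (P x)) {xs : List A} {x : A} →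
  x ∈ xs → ¬ P x → length (filter P? xs) < length xs
filter-length-< P? {y ∷ xs} p ¬Px with P? y
filter-length-< P? {y ∷ xs} (here refl) ¬Px | yes Py = contradiction Py ¬Px
filter-length-< P? {y ∷ xs} (there p) ¬Px | yes Py = s≤s (filter-length-< P? p ¬Px)
filter-length-< P? {y ∷ xs} p ¬Px | no _ = s≤s (length-filter P? xs)

words : {A : Set} → List A → (m : ℕ) → List (Vec A m)
words xs zero = [] ∷ []
words xs (suc m) = cartesianProductWith _∷_ xs (words xs m)

length-cartesianProductWith : {A B C : Set} (f : A → B → C) (xs : List A) (ys : List B) →
  length (cartesianProductWith f xs ys) ≡ length xs * length ys
length-cartesianProductWith f [] ys = refl
length-cartesianProductWith f (x ∷ xs) ys = trans (length-++ (map (f x) ys))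
  (cong₂ _+_ (length-map (f x) ys) (length-cartesianProductWith f xs ys))

length-words : {A : Set} (xs : List A) (m : ℕ) → length (words xs m) ≡ length xs ^ m
length-words xs zero = refl
length-words xs (suc m) = trans (length-cartesianProductWith _∷_ xs _) (cong (length xs *_) (length-words xs m))

∈-words : {A : Set} {xs : List A} {m : ℕ} (v : Vec A m) → (∀ i → lookup v i ∈ xs) → v ∈ words xs m
∈-words [] h = here refl
∈-words (x ∷ v) h = ∈-cartesianProductWith⁺ _∷_ (h zero) (∈-words v (h ∘ suc))

unique-words : {A : Set} {xs : List A} → Unique xs → (m : ℕ) → Unique (words xs m)
unique-words u zero = [] ∷ []
unique-words u (suc m) = Unique.cartesianProductWith⁺ _∷_ (λ { refl → refl , refl }) u (unique-words u m)

length-allFin : (n : ℕ) → length (allFin n) ≡ n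
length-allFin n = length-tabulate id

allWords : (n m : ℕ) → List (Vec (Fin n) m)
allWords n m = words (allFin n) m

∈-allWords : {n m : ℕ} (v : Vec (Fin n) m) → v ∈ allWords n m
∈-allWords v = ∈-words v (λ _ → ∈-allFin _)

unique-allWords : (n m : ℕ) → Unique (allWords n m)
unique-allWords n m = unique-words (Unique.allFin⁺ n) m

length-allWords : (n m : ℕ) → length (allWords n m) ≡ n ^ m
length-allWords n m = trans (length-words (allFin n) m) (cong (_^ m) (length-allFin n))

allSubsets : (n : ℕ) → List (Subset n)
allSubsets n = words (outside ∷ inside ∷ []) n

∈-allSubsets : {n : ℕ} (p : Subset n) → p ∈ allSubsets n
∈-allSubsets p = ∈-words p λ i → side (lookup p i)
  where
  side : ∀ b → b ∈ outside ∷ inside ∷ []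
  side false = here refl
  side true = there (here refl)

unique-allSubsets : (n : ℕ) → Unique (allSubsets n)
unique-allSubsets n = unique-words (((λ ()) ∷ []) ∷ [] ∷ []) n

infix 4 _≟ₛ_
_≟ₛ_ : {n : ℕ} → DecidableEquality (Subset n)
_≟ₛ_ = Vec.≡-dec Bool._≟_

_≟ᵥ_ : {n m : ℕ} → DecidableEquality (Vec (Fin n) m)
_≟ᵥ_ = Vec.≡-dec Fin._≟_

-- Finite sets given by enumerations

toList : {n : ℕ} → Subset n → List (Fin n)
toList [] = []
toList (true ∷ p) = zero ∷ map suc (toList p)
toList (false ∷ p) = map suc (toList p)

length-toList : {n : ℕ} (p : Subset n) → length (toList p) ≡ ∣ p ∣
length-toList [] = refl
length-toList (true ∷ p) = cong suc (trans (length-map Fin.suc (toList p)) (length-toList p))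
length-toList (false ∷ p) = trans (length-map Fin.suc (toList p)) (length-toList p)

∈-toList⁺ : {n : ℕ} {p : Subset n} {x : Fin n} → x ∈ₛ p → x ∈ toList p
∈-toList⁺ Vec.here = here refl
∈-toList⁺ {p = true ∷ p} (Vec.there q) = there (∈-map⁺ suc (∈-toList⁺ q))
∈-toList⁺ {p = false ∷ p} (Vec.there q) = ∈-map⁺ suc (∈-toList⁺ q)

∈-toList⁻ : {n : ℕ} (p : Subset n) {x : Fin n} → x ∈ toList p → x ∈ₛ p
∈-toList⁻ (true ∷ p) (here refl) = Vec.here
∈-toList⁻ (true ∷ p) (there q) with y , y∈ , refl ← ∈-map⁻ suc q = Vec.there (∈-toList⁻ p y∈)
∈-toList⁻ (false ∷ p) q with y , y∈ , refl ← ∈-map⁻ suc q = Vec.there (∈-toList⁻ p y∈)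

unique-toList : {n : ℕ} (p : Subset n) → Unique (toList p)
unique-toList [] = []
unique-toList (true ∷ p) =
  ∉⇒All≢ (λ q → Fin.0≢1+n (proj₂ (proj₂ (∈-map⁻ suc q)))) ∷ Unique.map⁺ Fin.suc-injective (unique-toList p)
unique-toList (false ∷ p) = Unique.map⁺ Fin.suc-injective (unique-toList p)

∣∣≤length : {n : ℕ} {p : Subset n} {xs : List (Fin n)} → (∀ {x} → x ∈ₛ p → x ∈ xs) → ∣ p ∣ ≤ length xs
∣∣≤length {p = p} h = subst (_≤ _) (length-toList p) (unique-⊆-length (unique-toList p) (h ∘ ∈-toList⁻ p))

length≤∣∣ : {n : ℕ} {p : Subset n} {xs : List (Fin n)} → Unique xs → (∀ {x} → x ∈ xs → x ∈ₛ p) →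
            length xs ≤ ∣ p ∣
length≤∣∣ {p = p} u h = subst (_ ≤_) (length-toList p) (unique-⊆-length u (∈-toList⁺ ∘ h))

comp : {n : ℕ} {P : Fin n → Set} → (∀ x → Dec (P x)) → Subset n
comp P? = tabulate (does ∘ P?)

∈-comp⁺ : {n : ℕ} {P : Fin n → Set} (P? : ∀ x → Dec (P x)) {x : Fin n} → P x → x ∈ₛ comp P?
∈-comp⁺ P? {x} Px = Vec.lookup⇒[]= x _ (trans (Vec.lookup∘tabulate (does ∘ P?) x) (dec-true (P? x) Px))

∈-comp⁻ : {n : ℕ} {P : Fin n → Set} (P? : ∀ x → Dec (P x)) {x : Fin n} → x ∈ₛ comp P? → P x
∈-comp⁻ P? {x} x∈ = witness (P? x) (trans (sym (Vec.lookup∘tabulate (does ∘ P?) x)) (Vec.[]=⇒lookup x∈))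
  where
  witness : {Q : Set} (d : Dec Q) → does d ≡ true → Q
  witness (yes q) _ = q

_∈ₗ?_ : {n : ℕ} (x : Fin n) (xs : List (Fin n)) → Dec (x ∈ xs)
x ∈ₗ? xs = Any.any? (x Fin.≟_) xs

abstract
  set : {n : ℕ} → List (Fin n) → Subset n
  set xs = comp (_∈ₗ? xs)

  ∈-set⁺ : {n : ℕ} {xs : List (Fin n)} {x : Fin n} → x ∈ xs → x ∈ₛ set xs
  ∈-set⁺ {xs = xs} = ∈-comp⁺ (_∈ₗ? xs)

  ∈-set⁻ : {n : ℕ} (xs : List (Fin n)) {x : Fin n} → x ∈ₛ set xs → x ∈ xs
  ∈-set⁻ xs = ∈-comp⁻ (_∈ₗ? xs)

∣set∣ : {n : ℕ} {xs : List (Fin n)} → Unique xs → ∣ set xs ∣ ≡ length xs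
∣set∣ {xs = xs} u = ≤-antisym (∣∣≤length (∈-set⁻ xs)) (length≤∣∣ u ∈-set⁺)

set-cong : {n : ℕ} {xs : List (Fin n)} {p : Subset n} → (∀ {x} → x ∈ xs → x ∈ₛ p) →
           (∀ {x} → x ∈ₛ p → x ∈ xs) → set xs ≡ p
set-cong {xs = xs} f g = Sub.⊆-antisym (f ∘ ∈-set⁻ xs) (∈-set⁺ ∘ g)

range : {n m : ℕ} → Vec (Fin n) m → Subset n
range v = set (Vec.toList v)

∈-vtoList⁺ : {A : Set} {m : ℕ} (v : Vec A m) (i : Fin m) → lookup v i ∈ Vec.toList v
∈-vtoList⁺ (x ∷ v) zero = here refl
∈-vtoList⁺ (x ∷ v) (suc i) = there (∈-vtoList⁺ v i)

∈-vtoList⁻ : {A : Set} {m : ℕ} (v : Vec A m) {x : A} → x ∈ Vec.toList v → ∃[ i ] lookup v i ≡ x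
∈-vtoList⁻ (x ∷ v) (here refl) = zero , refl
∈-vtoList⁻ (x ∷ v) (there p) = let i , e = ∈-vtoList⁻ v p in suc i , e

∈-range⁺ : {n m : ℕ} (v : Vec (Fin n) m) (i : Fin m) → lookup v i ∈ₛ range v
∈-range⁺ v i = ∈-set⁺ (∈-vtoList⁺ v i)

∈-range⁻ : {n m : ℕ} (v : Vec (Fin n) m) {x : Fin n} → x ∈ₛ range v → ∃[ i ] lookup v i ≡ x
∈-range⁻ v x∈ = ∈-vtoList⁻ v (∈-set⁻ (Vec.toList v) x∈)

Inj : {n m : ℕ} → Vec (Fin n) m → Set
Inj v = ∀ i j → lookup v i ≡ lookup v j → i ≡ j

unique-vtoList : {n m : ℕ} (v : Vec (Fin n) m) → Inj v → Unique (Vec.toList v)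
unique-vtoList [] _ = []
unique-vtoList (x ∷ v) inj =
  ∉⇒All≢ (λ p → let i , e = ∈-vtoList⁻ v p in Fin.0≢1+n (inj zero (suc i) (sym e)))
  ∷ unique-vtoList v (λ i j e → Fin.suc-injective (inj (suc i) (suc j) e))

∣range∣ : {n m : ℕ} (v : Vec (Fin n) m) → Inj v → ∣ range v ∣ ≡ m
∣range∣ v inj = trans (∣set∣ (unique-vtoList v inj)) (Vec.length-toList v)

enumerate : {n m : ℕ} (p : Subset n) → ∣ p ∣ ≡ m → Σ[ v ∈ Vec (Fin n) m ] Inj v × range v ≡ p
enumerate {n} p refl = v , inj , rng
  where
  e : length (toList p) ≡ ∣ p ∣
  e = length-toList p
  f : Fin ∣ p ∣ → Fin n
  f i = List.lookup (toList p) (Fin.cast (sym e) i)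
  v : Vec (Fin n) ∣ p ∣
  v = tabulate f
  inj : Inj v
  inj i j q = Fin.toℕ-injective (trans (sym (Fin.toℕ-cast (sym e) i)) (trans
    (cong toℕ (unique-lookup-injective (unique-toList p)
      (trans (sym (Vec.lookup∘tabulate f i)) (trans q (Vec.lookup∘tabulate f j)))))
    (Fin.toℕ-cast (sym e) j)))
  sub : range v ⊆ₛ p
  sub x∈ with i , refl ← ∈-range⁻ v x∈ =
    ∈-toList⁻ p (subst (_∈ toList p) (sym (Vec.lookup∘tabulate f i)) (∈-lookup _))
  rng : range v ≡ p
  rng = Sub.⊆-antisym sub λ {x} x∈ →
    ∈-toList⁻ (range v) (⊆-reverse Fin._≟_ {toList (range v)} {toList p} (unique-toList (range v))
      (λ q → ∈-toList⁺ (sub (∈-toList⁻ (range v) q)))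
      (≤-reflexive (trans e (sym (trans (length-toList (range v)) (∣range∣ v inj)))))
      (∈-toList⁺ x∈))

-- Being a kernel quantifies over every small set `Z`. Deciding such statements by exhaustion allows
-- case distinctions on them, and their failure yields an explicit blocking set.
all-subsets? : {n : ℕ} {P : Subset n → Set} → (∀ p → Dec (P p)) → Dec (∀ p → P p)
all-subsets? P? with Sub.anySubset? (¬? ∘ P?)
... | yes (p , ¬P) = no λ h → ¬P (h p)
... | no ¬∃ = yes λ p → decidable-stable (P? p) λ ¬P → ¬∃ (p , ¬P)

¬∀⇒∃¬-subset : {n : ℕ} {P : Subset n → Set} → (∀ p → Dec (P p)) → ¬ (∀ p → P p) → ∃[ p ] ¬ P p
¬∀⇒∃¬-subset P? ¬∀ with Sub.anySubset? (¬? ∘ P?)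
... | yes w = w
... | no ¬∃ = contradiction (λ p → decidable-stable (P? p) λ ¬P → ¬∃ (p , ¬P)) ¬∀

word-ext : {A : Set} {m : ℕ} {u v : Vec A m} → (∀ i → lookup u i ≡ lookup v i) → u ≡ v
word-ext {u = u} {v} h = trans (sym (Vec.tabulate∘lookup u)) (trans (Vec.tabulate-cong h) (Vec.tabulate∘lookup v))

-- Matchings and Gallai's lemma

∑-⊆ : {A : Set} {xs ys : List A} (f : A → ℕ) → Unique xs → (∀ {x} → x ∈ xs → x ∈ ys) → ∑ xs f ≤ ∑ ys f
∑-⊆ {xs = []} f _ _ = z≤n
∑-⊆ {xs = x ∷ xs} f (x∉ ∷ u) sub with ∈-∃++ (sub (here refl))
... | as , bs , refl = begin
  f x + ∑ xs f ≤⟨ +-monoʳ-≤ (f x) (∑-⊆ f u sub′) ⟩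
  f x + ∑ (as ++ bs) f ≡⟨ cong (f x +_) (∑-++ as bs f) ⟩
  f x + (∑ as f + ∑ bs f) ≡⟨ sym (+-assoc (f x) _ _) ⟩
  f x + ∑ as f + ∑ bs f ≡⟨ cong (_+ ∑ bs f) (+-comm (f x) _) ⟩
  ∑ as f + f x + ∑ bs f ≡⟨ +-assoc (∑ as f) _ _ ⟩
  ∑ as f + (f x + ∑ bs f) ≡⟨ sym (∑-++ as _ f) ⟩
  ∑ (as ++ x ∷ bs) f ∎
  where
  open ≤-Reasoning
  sub′ : ∀ {y} → y ∈ xs → y ∈ as ++ bs
  sub′ y∈ with ∈-++⁻ as (sub (there y∈))
  ... | inj₁ p = ∈-++⁺ˡ p
  ... | inj₂ (here refl) = contradiction y∈ (All¬⇒¬Any x∉)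
  ... | inj₂ (there p) = ∈-++⁺ʳ as p

delete : {n : ℕ} → Fin n → List (Fin n) → List (Fin n)
delete x = filter (λ y → ¬? (y Fin.≟ x))

∈-delete⁺ : {n : ℕ} {x y : Fin n} {xs : List (Fin n)} → y ∈ xs → y ≢ x → y ∈ delete x xs
∈-delete⁺ {x = x} = ∈-filter⁺ (λ y → ¬? (y Fin.≟ x))

∈-delete⁻ : {n : ℕ} (x : Fin n) (xs : List (Fin n)) {y : Fin n} → y ∈ delete x xs → y ∈ xs × y ≢ x
∈-delete⁻ x xs = ∈-filter⁻ (λ y → ¬? (y Fin.≟ x)) {xs = xs}

unique-delete : {n : ℕ} (x : Fin n) {xs : List (Fin n)} → Unique xs → Unique (delete x xs)
unique-delete x = Unique.filter⁺ _

length-delete-≥ : {n : ℕ} (x : Fin n) {xs : List (Fin n)} → Unique xs → length xs ≤ suc (length (delete x xs))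
length-delete-≥ x {xs} u = unique-⊆-length {ys = x ∷ delete x xs} u λ {y} y∈ → case y y∈ (y Fin.≟ x)
  where
  case : ∀ y → y ∈ xs → Dec (y ≡ x) → y ∈ x ∷ delete x xs
  case y y∈ (yes refl) = here refl
  case y y∈ (no ≢) = there (∈-delete⁺ y∈ ≢)

length-delete-< : {n : ℕ} {x : Fin n} {xs : List (Fin n)} → x ∈ xs → length (delete x xs) < length xs
length-delete-< x∈ = filter-length-< _ x∈ (λ h → h refl)

record DecGraph (n : ℕ) : Set₁ where
  field
    Edge   : Fin n → Fin n → Set
    edge?  : ∀ x y → Dec (Edge x y)
    symm   : ∀ {x y} → Edge x y → Edge y x
    irrefl : ∀ {x} → ¬ Edge x x

  neighbours : Fin n → List (Fin n)
  neighbours x = filter (edge? x) (allFin n)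

  degree : Fin n → ℕ
  degree x = length (neighbours x)

  ∈-neighbours⁺ : ∀ {x y} → Edge x y → y ∈ neighbours x
  ∈-neighbours⁺ {x} = ∈-filter⁺ (edge? x) (∈-allFin _)

  ∈-neighbours⁻ : ∀ {x y} → y ∈ neighbours x → Edge x y
  ∈-neighbours⁻ {x} y∈ = proj₂ (∈-filter⁻ (edge? x) {xs = allFin n} y∈)

  unique-neighbours : ∀ x → Unique (neighbours x)
  unique-neighbours x = Unique.filter⁺ (edge? x) (Unique.allFin⁺ n)

  -- Each edge is listed in both directions, so the length is the degree sum and the bound of
  -- `s (s - 1)` edges takes the form `(2 * d) * suc d`.
  arcs : List (Fin n × Fin n)
  arcs = concatMap (λ x → map (x ,_) (neighbours x)) (allFin n)

  ∈-arcs⁺ : ∀ {x y} → Edge x y → (x , y) ∈ arcs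
  ∈-arcs⁺ {x} e = ∈-concatMap-intro (λ x → map (x ,_) (neighbours x)) (∈-allFin x) (∈-map⁺ (x ,_) (∈-neighbours⁺ e))

  ∈-arcs⁻ : ∀ {x y} → (x , y) ∈ arcs → Edge x y
  ∈-arcs⁻ xy∈ with ∈-concatMap-elim (λ x → map (x ,_) (neighbours x)) (allFin n) xy∈
  ... | x , _ , xy∈′ with ∈-map⁻ (x ,_) xy∈′
  ... | y , y∈ , refl = ∈-neighbours⁻ y∈

  unique-arcs : Unique arcs
  unique-arcs = unique-concatMap (Unique.allFin⁺ n)
    (λ {x} _ → Unique.map⁺ (proj₂ ∘ ,-injective) (unique-neighbours x))
    λ {x} {y} _ _ z∈ z∈′ → let _ , _ , e = ∈-map⁻ (x ,_) z∈ ; _ , _ , e′ = ∈-map⁻ (y ,_) z∈′ in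
      proj₁ (,-injective (trans (sym e) e′))

  length-arcs : length arcs ≡ ∑ (allFin n) degree
  length-arcs = trans (length-concatMap _ (allFin n)) (∑-cong (allFin n) λ x → length-map (x ,_) (neighbours x))

  -- A matching is encoded as an involution moving every covered vertex along an edge.
  IsMatching : Vec (Fin n) n → Set
  IsMatching M = (∀ x → lookup M (lookup M x) ≡ x) × (∀ x → lookup M x ≢ x → Edge x (lookup M x))

  isMatching? : ∀ M → Dec (IsMatching M)
  isMatching? M = Fin.all? (λ x → lookup M (lookup M x) Fin.≟ x)
    ×-dec Fin.all? (λ x → ¬? (lookup M x Fin.≟ x) →-dec edge? x (lookup M x))

  ∃matching? : {P : Vec (Fin n) n → Set} → (∀ M → Dec (P M)) → Dec (∃[ M ] IsMatching M × P M)
  ∃matching? P? = map′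
    (λ a → let M , _ , h = find a in M , h) (λ (M , h) → lose (∈-allWords M) h)
    (Any.any? (λ M → isMatching? M ×-dec P? M) (allWords n n))

moved? : {n : ℕ} (M : Vec (Fin n) n) → ∀ x → Dec (lookup M x ≢ x)
moved? M x = ¬? (lookup M x Fin.≟ x)

covered : {n : ℕ} → Vec (Fin n) n → List (Fin n)
covered {n} M = filter (moved? M) (allFin n)

∈-covered⁺ : {n : ℕ} (M : Vec (Fin n) n) {x : Fin n} → lookup M x ≢ x → x ∈ covered M
∈-covered⁺ M = ∈-filter⁺ (moved? M) (∈-allFin _)

∈-covered⁻ : {n : ℕ} (M : Vec (Fin n) n) {x : Fin n} → x ∈ covered M → lookup M x ≢ x
∈-covered⁻ {n} M x∈ = proj₂ (∈-filter⁻ (moved? M) {xs = allFin n} x∈)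

unique-covered : {n : ℕ} (M : Vec (Fin n) n) → Unique (covered M)
unique-covered M = Unique.filter⁺ (moved? M) (Unique.allFin⁺ _)

-- For a matching, this is twice the number of its edges.
cov : {n : ℕ} → Vec (Fin n) n → ℕ
cov M = length (covered M)

lower? : {n : ℕ} (M : Vec (Fin n) n) → ∀ x → Dec (x Fin.< lookup M x)
lower? M x = x Fin.<? lookup M x

lower : {n : ℕ} → Vec (Fin n) n → List (Fin n)
lower {n} M = filter (lower? M) (allFin n)

∈-lower⁻ : {n : ℕ} (M : Vec (Fin n) n) {x : Fin n} → x ∈ lower M → x Fin.< lookup M x
∈-lower⁻ {n} M x∈ = proj₂ (∈-filter⁻ (lower? M) {xs = allFin n} x∈)

unique-lower : {n : ℕ} (M : Vec (Fin n) n) → Unique (lower M)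
unique-lower M = Unique.filter⁺ (lower? M) (Unique.allFin⁺ _)

-- `lower` picks one end of each matching edge, and the involution maps these ends bijectively onto
-- the other covered vertices.
cov-even : {n : ℕ} (M : Vec (Fin n) n) → (∀ x → lookup M (lookup M x) ≡ x) → cov M ≡ 2 * length (lower M)
cov-even {n} M inv = trans (≤-antisym (unique-⊆-length (unique-covered M) to)
    (unique-⊆-length (Unique.++⁺ (unique-lower M) (unique-map (unique-lower M) λ _ _ e →
        trans (sym (inv _)) (trans (cong (lookup M) e) (inv _))) disjoint) from))
  (trans (length-++ (lower M)) (trans (cong (length (lower M) +_) (length-map (lookup M) (lower M)))
    (cong (length (lower M) +_) (sym (+-identityʳ _)))))
  where
  to : ∀ {x} → x ∈ covered M → x ∈ lower M ++ map (lookup M) (lower M)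
  to {x} x∈ with Fin.<-cmp x (lookup M x)
  ... | tri< lt _ _ = ∈-++⁺ˡ (∈-filter⁺ (lower? M) (∈-allFin x) lt)
  ... | tri≈ _ e _ = contradiction (sym e) (∈-covered⁻ M x∈)
  ... | tri> _ _ gt = ∈-++⁺ʳ (lower M) (subst (_∈ map (lookup M) (lower M)) (inv x)
    (∈-map⁺ (lookup M) (∈-filter⁺ (lower? M) (∈-allFin (lookup M x)) (subst (lookup M x Fin.<_) (sym (inv x)) gt))))
  high : ∀ {x} → x ∈ map (lookup M) (lower M) → lookup M x Fin.< x
  high x∈ with y , y∈ , refl ← ∈-map⁻ (lookup M) x∈ = subst (Fin._< lookup M y) (sym (inv y)) (∈-lower⁻ M y∈)
  disjoint : ∀ {x} → ¬ (x ∈ lower M × x ∈ map (lookup M) (lower M))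
  disjoint (p , q) = <-asym (∈-lower⁻ M p) (high q)
  from : ∀ {x} → x ∈ lower M ++ map (lookup M) (lower M) → x ∈ covered M
  from {x} x∈ with ∈-++⁻ (lower M) x∈
  ... | inj₁ p = ∈-covered⁺ M λ e → Fin.<-irrefl (sym e) (∈-lower⁻ M p)
  ... | inj₂ p = ∈-covered⁺ M λ e → Fin.<-irrefl e (high p)

agreement : {n : ℕ} → Vec (Fin n) n → Vec (Fin n) n → List (Fin n)
agreement {n} M N = filter (λ t → lookup M t Fin.≟ lookup N t) (allFin n)

-- The edge `x y` is put into `N` and the old partner `z` of `y` is released. If `N` misses `y` too,
-- then `z ≡ y` and an edge is gained; otherwise `x` replaces `z` among the covered vertices.
module Rewire {n : ℕ} (G : DecGraph n) (N : Vec (Fin n) n) (isN : DecGraph.IsMatching G N)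
  {x y : Fin n} (Nx : lookup N x ≡ x) (xy : DecGraph.Edge G x y) where

  open DecGraph G

  z : Fin n
  z = lookup N y

  x≢y : x ≢ y
  x≢y refl = irrefl xy

  Nz : lookup N z ≡ y
  Nz = proj₁ isN y

  z≢x : z ≢ x
  z≢x e = x≢y (trans (sym Nx) (trans (cong (lookup N) (sym e)) Nz))

  f : Fin n → Fin n
  -- The test for `y` precedes the one for `z`: when `N` misses `y` the two coincide, and `y` has to
  -- go to `x`.
  f t with t Fin.≟ x | t Fin.≟ y | t Fin.≟ z
  ... | yes _ | _ | _ = y
  ... | no _ | yes _ | _ = x
  ... | no _ | no _ | yes _ = z
  ... | no _ | no _ | no _ = lookup N t

  fx : f x ≡ y
  fx with x Fin.≟ x
  ... | yes _ = refl
  ... | no ≢ = contradiction refl ≢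

  fy : f y ≡ x
  fy with y Fin.≟ x | y Fin.≟ y
  ... | yes e | _ = contradiction (sym e) x≢y
  ... | no _ | yes _ = refl
  ... | no _ | no ≢ = contradiction refl ≢

  fz : z ≢ y → f z ≡ z
  fz z≢y with z Fin.≟ x | z Fin.≟ y | z Fin.≟ z
  ... | yes e | _ | _ = contradiction e z≢x
  ... | no _ | yes e | _ = contradiction e z≢y
  ... | no _ | no _ | yes _ = refl
  ... | no _ | no _ | no ≢ = contradiction refl ≢

  ft : ∀ {t} → t ≢ x → t ≢ y → t ≢ z → f t ≡ lookup N t
  ft {t} t≢x t≢y t≢z with t Fin.≟ x | t Fin.≟ y | t Fin.≟ z
  ... | yes e | _ | _ = contradiction e t≢x
  ... | no _ | yes e | _ = contradiction e t≢y
  ... | no _ | no _ | yes e = contradiction e t≢z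
  ... | no _ | no _ | no _ = refl

  result : Vec (Fin n) n
  result = tabulate f

  lookup-result : ∀ t → lookup result t ≡ f t
  lookup-result = Vec.lookup∘tabulate f

  N-injective : ∀ {s t} → lookup N s ≡ lookup N t → s ≡ t
  N-injective {s} {t} e = trans (sym (proj₁ isN s)) (trans (cong (lookup N) e) (proj₁ isN t))

  isMatching-f : ∀ t → f (f t) ≡ t × (f t ≢ t → Edge t (f t))
  isMatching-f t = cases (t Fin.≟ x) (t Fin.≟ y) (t Fin.≟ z)
    where
    cases : Dec (t ≡ x) → Dec (t ≡ y) → Dec (t ≡ z) → f (f t) ≡ t × (f t ≢ t → Edge t (f t))
    cases (yes refl) _ _ = trans (cong f fx) fy , λ _ → subst (Edge x) (sym fx) xy
    cases (no _) (yes refl) _ = trans (cong f fy) fx , λ _ → subst (Edge y) (sym fy) (symm xy)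
    cases (no _) (no ≢y) (yes refl) = trans (cong f (fz ≢y)) (fz ≢y) , λ ≢ → contradiction (fz ≢y) ≢
    cases (no ≢x) (no ≢y) (no ≢z) = trans (cong f ft′) (trans (ft ≢x′ ≢y′ ≢z′) (proj₁ isN t)) ,
      λ ≢ → subst (Edge t) (sym ft′) (proj₂ isN t λ e → ≢ (trans ft′ e))
      where
      ft′ : f t ≡ lookup N t
      ft′ = ft ≢x ≢y ≢z
      ≢x′ : lookup N t ≢ x
      ≢x′ e = ≢x (N-injective (trans e (sym Nx)))
      ≢y′ : lookup N t ≢ y
      ≢y′ e = ≢z (N-injective (trans e (sym Nz)))
      ≢z′ : lookup N t ≢ z
      ≢z′ e = ≢y (N-injective e)

  isMatching-result : IsMatching result
  isMatching-result =
    (λ t → trans (lookup-result _) (trans (cong f (lookup-result t)) (proj₁ (isMatching-f t)))) ,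
    λ t ≢ → subst (Edge t) (sym (lookup-result t)) (proj₂ (isMatching-f t) (λ e → ≢ (trans (lookup-result t) e)))

  x-covered : x ∈ covered result
  x-covered = ∈-covered⁺ result λ e → x≢y (trans (sym e) (trans (lookup-result x) fx))

  y-covered : y ∈ covered result
  y-covered = ∈-covered⁺ result λ e → x≢y (trans (sym fy) (trans (sym (lookup-result y)) e))

  stays-covered : ∀ {t} → t ∈ covered N → t ≢ z → t ∈ covered result
  stays-covered {t} t∈ t≢z with t Fin.≟ x | t Fin.≟ y
  ... | yes refl | _ = x-covered
  ... | no _ | yes refl = y-covered
  ... | no ≢x | no ≢y = ∈-covered⁺ result λ e → ∈-covered⁻ N t∈ (trans (sym (ft ≢x ≢y t≢z)) (trans (sym (lookup-result t)) e))

  cov-≤ : cov N ≤ cov result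
  cov-≤ = ≤-trans (length-delete-≥ z (unique-covered N))
    (unique-⊆-length {xs = x ∷ delete z (covered N)}
      (∉⇒All≢ (λ x∈ → ∈-covered⁻ N (proj₁ (∈-delete⁻ z (covered N) x∈)) Nx) ∷ unique-delete z (unique-covered N))
      λ { (here refl) → x-covered
        ; (there t∈) → let t∈N , t≢z = ∈-delete⁻ z (covered N) t∈ in stays-covered t∈N t≢z })

  cov-< : lookup N y ≡ y → cov N < cov result
  cov-< Ny = unique-⊆-length {xs = x ∷ covered N} (∉⇒All≢ (λ x∈ → ∈-covered⁻ N x∈ Nx) ∷ unique-covered N)
    λ { (here refl) → x-covered
      ; (there t∈) → stays-covered t∈ λ { refl → ∈-covered⁻ N t∈ (cong (lookup N) Ny) } }

  still-misses : ∀ {w} → lookup N w ≡ w → w ≢ x → w ≢ y → lookup result w ≡ w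
  still-misses {w} Nw w≢x w≢y with w Fin.≟ z
  ... | yes refl = trans (lookup-result z) (fz w≢y)
  ... | no w≢z = trans (lookup-result w) (trans (ft w≢x w≢y w≢z) Nw)

  -- Only the values at `x`, `y` and `z` change, and at these points the two matchings disagreed,
  -- since `M` pairs `x` with `y` and `N` does not. Afterwards they agree at `x`. This is the
  -- progress measure for Gallai's lemma.
  more-agreement : ∀ M → (∀ t → lookup M (lookup M t) ≡ t) → lookup M x ≡ y →
    length (agreement M N) < length (agreement M result)
  more-agreement M inv Mx = unique-⊆-length {xs = x ∷ agreement M N}
    (∉⇒All≢ (λ x∈ → x≢y (trans (sym Nx) (trans (sym (ag x∈)) Mx))) ∷ Unique.filter⁺ _ (Unique.allFin⁺ n))
    λ { (here refl) → ∈-filter⁺ (ag? result) (∈-allFin x) (trans Mx (sym (trans (lookup-result x) fx)))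
      ; {t} (there t∈) → ∈-filter⁺ (ag? result) (∈-allFin t) (trans (ag t∈) (sym (trans (lookup-result t)
          (ft (λ { refl → x≢y (trans (sym Nx) (trans (sym (ag t∈)) Mx)) })
              (λ { refl → z≢x (trans (sym (ag t∈)) My) })
              (λ { refl → z≢x (trans (sym (inv z)) (trans (cong (lookup M) (trans (ag t∈) Nz)) My)) }))))) }
    where
    My : lookup M y ≡ x
    My = trans (cong (lookup M) (sym Mx)) (inv x)
    ag? : ∀ N t → Dec (lookup M t ≡ lookup N t)
    ag? N t = lookup M t Fin.≟ lookup N t
    ag : ∀ {t} → t ∈ agreement M N → lookup M t ≡ lookup N t
    ag t∈ = proj₂ (∈-filter⁻ (ag? N) {xs = allFin n} t∈)

-- Gallai's lemma: a maximum matching N missing w is rewired towards a maximum matching M missing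
-- u and v, until N would have to cover more vertices than M.
module Gallai {n : ℕ} (G : DecGraph n) (c : ℕ)
  (cov≤c : ∀ M → DecGraph.IsMatching G M → cov M ≤ c)
  (critical : ∀ w → ∃[ M ] DecGraph.IsMatching G M × cov M ≡ c × lookup M w ≡ w) where

  open DecGraph G

  Apart : Fin n → Fin n → Set
  Apart u v = ∃[ M ] IsMatching M × cov M ≡ c × lookup M u ≡ u × lookup M v ≡ v

  apart? : ∀ u v → Dec (Apart u v)
  apart? u v = ∃matching? λ M → (cov M ℕ.≟ c) ×-dec (lookup M u Fin.≟ u) ×-dec (lookup M v Fin.≟ v)

  apart-sym : ∀ {u v} → Apart u v → Apart v u
  apart-sym (M , isM , e , p , q) = M , isM , e , q , p

  -- An edge between two missed vertices would enlarge a maximum matching.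
  edge⇒¬apart : ∀ {x y} → Edge x y → ¬ Apart x y
  edge⇒¬apart xy (M , isM , e , Mx , My) =
    <⇒≱ (subst (_< cov result) e (cov-< My)) (cov≤c result isMatching-result)
    where open Rewire G M isM Mx xy

  -- Since `N` misses `w`, it covers both `u` and `v`, which `M` misses. If `N` also covered every
  -- vertex other than `w` that `M` covers, it would be larger than `M`. So `M` covers some `x ≢ w`
  -- that `N` misses, and `N` can be rewired along the edge of `M` at `x`.
  ¬apart-trans : ∀ {u w v} → u ≢ v → u ≢ w → v ≢ w → ¬ Apart u w → ¬ Apart w v → ¬ Apart u v
  ¬apart-trans {u} {w} {v} u≢v u≢w v≢w ¬uw ¬wv (M , isM , eM , Mu , Mv) =
    let N , isN , eN , Nw = critical w in improve n N isN eN Nw (m≤n+m n _)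
    where
    -- The agreement with `M` never exceeds `n` and grows with each rewiring, so `fuel` bounds the
    -- rewirings still possible.
    improve : ∀ fuel N → IsMatching N → cov N ≡ c → lookup N w ≡ w → n ≤ length (agreement M N) + fuel → ⊥
    improve fuel N isN eN Nw le
      with Fin.any? (λ x → ¬? (lookup M x Fin.≟ x) ×-dec (lookup N x Fin.≟ x) ×-dec ¬? (x Fin.≟ w))
    ... | no ¬∃ = <⇒≱ too-many (≤-reflexive (trans eN (sym eM)))
      where
      Nu : lookup N u ≢ u
      Nu e = ¬uw (N , isN , eN , e , Nw)
      Nv : lookup N v ≢ v
      Nv e = ¬wv (N , isN , eN , Nw , e)
      rest : List (Fin n)
      rest = delete w (covered M)
      rest⁻ : ∀ {t} → t ∈ rest → lookup M t ≢ t × t ≢ w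
      rest⁻ t∈ = let p , q = ∈-delete⁻ w (covered M) t∈ in ∈-covered⁻ M p , q
      into : ∀ {t} → t ∈ u ∷ v ∷ rest → t ∈ covered N
      into (here refl) = ∈-covered⁺ N Nu
      into (there (here refl)) = ∈-covered⁺ N Nv
      into {t} (there (there t∈)) = let p , q = rest⁻ t∈ in ∈-covered⁺ N λ e → ¬∃ (t , p , e , q)
      too-many : cov M < cov N
      too-many = ≤-trans (s≤s (length-delete-≥ w (unique-covered M)))
        (unique-⊆-length {xs = u ∷ v ∷ rest}
          (∉⇒All≢ (λ { (here e) → u≢v e ; (there u∈) → proj₁ (rest⁻ u∈) Mu })
            ∷ ∉⇒All≢ (λ v∈ → proj₁ (rest⁻ v∈) Mv) ∷ unique-delete w (unique-covered M)) into)
    ... | yes (x , Mx , Nx , x≢w) = next fuel le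
      where
      open Rewire G N isN Nx (proj₂ isM x Mx)
      covers : cov result ≡ c
      covers = ≤-antisym (cov≤c result isMatching-result) (subst (_≤ cov result) eN cov-≤)
      -- If `M` paired `x` with `w`, then `N` would miss both ends of an edge and could be enlarged.
      -- Hence the rewired matching still misses `w`.
      w≢y : w ≢ lookup M x
      w≢y e = <⇒≱ (subst (_< cov result) eN (cov-< (subst (λ t → lookup N t ≡ t) e Nw))) (cov≤c result isMatching-result)
      more : length (agreement M N) < length (agreement M result)
      more = more-agreement M (proj₁ isM) refl
      next : ∀ fuel → n ≤ length (agreement M N) + fuel → ⊥
      next zero le = <⇒≱ more (≤-trans
        (subst (length (agreement M result) ≤_) (length-allFin n) (length-filter _ (allFin n)))
        (subst (n ≤_) (+-identityʳ _) le))
      next (suc fuel) le = improve fuel result isMatching-result covers (still-misses Nw (x≢w ∘ sym) w≢y)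
        (≤-trans le (≤-trans (≤-reflexive (+-suc _ fuel)) (+-monoˡ-≤ fuel more)))

  infix 4 _≈_
  -- Edges never leave a class, and a maximum matching misses at most one vertex of a class; the
  -- classes play the part of factor-critical components.
  _≈_ : Fin n → Fin n → Set
  u ≈ v = u ≡ v ⊎ ¬ Apart u v

  _≈?_ : ∀ u v → Dec (u ≈ v)
  u ≈? v = (u Fin.≟ v) ⊎-dec ¬? (apart? u v)

  ≈-sym : ∀ {u v} → u ≈ v → v ≈ u
  ≈-sym (inj₁ e) = inj₁ (sym e)
  ≈-sym (inj₂ h) = inj₂ (h ∘ apart-sym)

  ≈-trans : ∀ {u w v} → u ≈ w → w ≈ v → u ≈ v
  ≈-trans (inj₁ refl) q = q
  ≈-trans (inj₂ p) (inj₁ refl) = inj₂ p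
  ≈-trans {u} {w} {v} (inj₂ p) (inj₂ q) with u Fin.≟ v | u Fin.≟ w | v Fin.≟ w
  ... | yes e | _ | _ = inj₁ e
  ... | no _ | yes refl | _ = inj₂ q
  ... | no _ | no _ | yes refl = inj₂ p
  ... | no u≢v | no u≢w | no v≢w = inj₂ (¬apart-trans u≢v u≢w v≢w p q)

-- Graphs with bounded degree and matching number

-- A class of `a + 1` vertices has degree sum at most the left side. The right side is linear in
-- `a`, so it can be summed over the classes.
min-product : ∀ a d → suc a * (a ℕ.⊓ d) ≤ a * suc d
min-product a d with ≤-total a d
... | inj₁ a≤d = begin
  suc a * (a ℕ.⊓ d) ≡⟨ cong (suc a *_) (m≤n⇒m⊓n≡m a≤d) ⟩
  suc a * a ≡⟨ *-comm (suc a) a ⟩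
  a * suc a ≤⟨ *-monoʳ-≤ a (s≤s a≤d) ⟩
  a * suc d ∎
  where open ≤-Reasoning
... | inj₂ d≤a = begin
  suc a * (a ℕ.⊓ d) ≡⟨ cong (suc a *_) (m≥n⇒m⊓n≡n d≤a) ⟩
  d + a * d ≤⟨ +-monoˡ-≤ (a * d) d≤a ⟩
  a + a * d ≡⟨ sym (*-suc a d) ⟩
  a * suc d ∎
  where open ≤-Reasoning

-- The condition `1 ≤ a` excludes one-vertex classes, for which both sides vanish.
min-product-tight : ∀ a d → 1 ≤ a → a * suc d ≤ suc a * (a ℕ.⊓ d) → a ≡ d
min-product-tight (suc a) d _ le = ≤-antisym
  (+-cancelʳ-≤ (suc a * d) (suc a) d (≤-trans (≤-reflexive (sym (*-suc (suc a) d)))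
    (≤-trans le (*-monoʳ-≤ (suc (suc a)) (m⊓n≤n (suc a) d)))))
  (ℕ.s≤s⁻¹ (*-cancelˡ-≤ (suc a) (≤-trans le (≤-trans (*-monoʳ-≤ (suc (suc a)) (m⊓n≤m (suc a) d))
    (≤-reflexive (*-comm (suc (suc a)) (suc a)))))))

∑-filter-const : {A : Set} {P : A → Set} (P? : ∀ x → Dec (P x)) (xs : List A) {f : A → ℕ} {d : ℕ} →
  (∀ {x} → x ∈ xs → P x → f x ≡ d) → (∀ {x} → x ∈ xs → ¬ P x → f x ≡ 0) →
  ∑ (filter P? xs) (λ _ → d) ≡ ∑ xs f
∑-filter-const P? [] _ _ = refl
∑-filter-const P? (x ∷ xs) {f} yes≡ no≡ with P? x
... | yes Px = cong₂ _+_ (sym (yes≡ (here refl) Px)) (∑-filter-const P? xs (yes≡ ∘ there) (no≡ ∘ there))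
... | no ¬Px = trans (∑-filter-const P? xs (yes≡ ∘ there) (no≡ ∘ there)) (cong (_+ ∑ xs f) (sym (no≡ (here refl) ¬Px)))

-- Classes are counted through their vertex missed by `M₀`. Vertices of classes without such a
-- vertex go into `leftover`, which spares the proof that every class has one: they cost degree at
-- most `d`, less than the `d + 1` available per covered vertex.
module CriticalBound {n : ℕ} (G : DecGraph n) (c d : ℕ)
  (cov≤c : ∀ M → DecGraph.IsMatching G M → cov M ≤ c)
  (critical : ∀ w → ∃[ M ] DecGraph.IsMatching G M × cov M ≡ c × lookup M w ≡ w)
  (degree≤d : ∀ x → DecGraph.degree G x ≤ d)
  (M₀ : Vec (Fin n) n) (isM₀ : DecGraph.IsMatching G M₀) (cov-M₀ : cov M₀ ≡ c) where

  open DecGraph G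
  open Gallai G c cov≤c critical

  missed : List (Fin n)
  missed = filter (λ u → lookup M₀ u Fin.≟ u) (allFin n)

  ∈-missed⁻ : ∀ {u} → u ∈ missed → lookup M₀ u ≡ u
  ∈-missed⁻ u∈ = proj₂ (∈-filter⁻ (λ u → lookup M₀ u Fin.≟ u) {xs = allFin n} u∈)

  unique-missed : Unique missed
  unique-missed = Unique.filter⁺ (λ u → lookup M₀ u Fin.≟ u) (Unique.allFin⁺ n)

  missed-≈ : ∀ {u v} → lookup M₀ u ≡ u → lookup M₀ v ≡ v → u ≈ v → u ≡ v
  missed-≈ p q (inj₁ e) = e
  missed-≈ p q (inj₂ ¬apart) = contradiction (M₀ , isM₀ , cov-M₀ , p , q) ¬apart

  class : Fin n → List (Fin n)
  class u = filter (u ≈?_) (allFin n)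

  ∈-class⁺ : ∀ {u x} → u ≈ x → x ∈ class u
  ∈-class⁺ {u} = ∈-filter⁺ (u ≈?_) (∈-allFin _)

  ∈-class⁻ : ∀ {u x} → x ∈ class u → u ≈ x
  ∈-class⁻ {u} x∈ = proj₂ (∈-filter⁻ (u ≈?_) {xs = allFin n} x∈)

  unique-class : ∀ u → Unique (class u)
  unique-class u = Unique.filter⁺ (u ≈?_) (Unique.allFin⁺ n)

  others : Fin n → List (Fin n)
  others u = delete u (class u)

  size : Fin n → ℕ
  size u = length (others u)

  in-class? : ∀ x → Dec (Any (_≈ x) missed)
  in-class? x = Any.any? (_≈? x) missed

  leftover : List (Fin n)
  leftover = filter (¬? ∘ in-class?) (allFin n)

  ∈-leftover⁻ : ∀ {x} → x ∈ leftover → ¬ Any (_≈ x) missed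
  ∈-leftover⁻ x∈ = proj₂ (∈-filter⁻ (¬? ∘ in-class?) {xs = allFin n} x∈)

  not-leftover : ∀ x → x ∈ leftover ⊎ (∃[ u ] u ∈ missed × u ≈ x)
  not-leftover x with in-class? x
  ... | yes a = inj₂ (find a)
  ... | no ¬a = inj₁ (∈-filter⁺ (¬? ∘ in-class?) (∈-allFin x) ¬a)

  same-class : ∀ {u v x} → u ∈ missed → v ∈ missed → x ∈ class u → x ∈ class v → u ≡ v
  same-class u∈ v∈ x∈ x∈′ =
    missed-≈ (∈-missed⁻ u∈) (∈-missed⁻ v∈) (≈-trans (∈-class⁻ x∈) (≈-sym (∈-class⁻ x∈′)))

  count : ∑ missed size + length leftover ≤ c
  count = subst (∑ missed size + length leftover ≤_) cov-M₀ (subst (_≤ cov M₀)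
    (trans (length-++ (concatMap others missed)) (cong (_+ length leftover) (length-concatMap others missed)))
    (unique-⊆-length (Unique.++⁺
      (unique-concatMap unique-missed (λ {u} _ → unique-delete u (unique-class u))
        λ {u} {v} u∈ v∈ p q → same-class u∈ v∈ (proj₁ (∈-delete⁻ u (class u) p)) (proj₁ (∈-delete⁻ v (class v) q)))
      (Unique.filter⁺ (¬? ∘ in-class?) (Unique.allFin⁺ n))
      (λ (p , q) → let u , u∈ , x∈ = ∈-concatMap-elim others missed p in
        ∈-leftover⁻ q (lose u∈ (∈-class⁻ (proj₁ (∈-delete⁻ u (class u) x∈))))))
      into))
    where
    missed⁺ : ∀ {x} → lookup M₀ x ≡ x → x ∈ missed
    missed⁺ = ∈-filter⁺ (λ u → lookup M₀ u Fin.≟ u) (∈-allFin _)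
    into : ∀ {x} → x ∈ concatMap others missed ++ leftover → x ∈ covered M₀
    into x∈ with ∈-++⁻ (concatMap others missed) x∈
    ... | inj₁ p = let u , u∈ , q = ∈-concatMap-elim others missed p
                       x∈u , x≢u = ∈-delete⁻ u (class u) q
                   in ∈-covered⁺ M₀ λ e → x≢u (sym (missed-≈ (∈-missed⁻ u∈) e (∈-class⁻ x∈u)))
    ... | inj₂ p = ∈-covered⁺ M₀ λ e → ∈-leftover⁻ p (lose (missed⁺ e) (inj₁ refl))

  neighbours⊆ : ∀ {u x} → x ∈ class u → ∀ {y} → y ∈ neighbours x → y ∈ delete x (class u)
  neighbours⊆ x∈ y∈ = ∈-delete⁺ (∈-class⁺ (≈-trans (∈-class⁻ x∈) (inj₂ (edge⇒¬apart (∈-neighbours⁻ y∈)))))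
    λ { refl → irrefl (∈-neighbours⁻ y∈) }

  class≤ : ∀ u → length (class u) ≤ suc (size u)
  class≤ u = length-delete-≥ u (unique-class u)

  delete≤ : ∀ {u x} → x ∈ class u → length (delete x (class u)) ≤ size u
  delete≤ {u} x∈ = ℕ.s≤s⁻¹ (≤-trans (length-delete-< x∈) (class≤ u))

  degree≤⊓ : ∀ {u x} → x ∈ class u → degree x ≤ size u ℕ.⊓ d
  degree≤⊓ x∈ = ⊓-glb (≤-trans (unique-⊆-length (unique-neighbours _) (neighbours⊆ x∈)) (delete≤ x∈)) (degree≤d _)

  class-bound₁ : ∀ u → ∑ (class u) degree ≤ suc (size u) * (size u ℕ.⊓ d)
  class-bound₁ u = ≤-trans (∑-≤-const (class u) degree≤⊓) (*-monoˡ-≤ (size u ℕ.⊓ d) (class≤ u))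

  class-bound : ∀ u → ∑ (class u) degree ≤ size u * suc d
  class-bound u = ≤-trans (class-bound₁ u) (min-product (size u) d)

  total : ∑ (allFin n) degree ≤ ∑ missed (λ u → ∑ (class u) degree) + length leftover * d
  total = begin
    ∑ (allFin n) degree ≤⟨ ∑-⊆ degree (Unique.allFin⁺ n) (λ {x} _ → into (not-leftover x)) ⟩
    ∑ (concatMap class missed ++ leftover) degree ≡⟨ ∑-++ (concatMap class missed) leftover degree ⟩
    ∑ (concatMap class missed) degree + ∑ leftover degree
      ≤⟨ +-mono-≤ (≤-reflexive (∑-concatMap class missed degree)) (∑-≤-const leftover (λ _ → degree≤d _)) ⟩
    ∑ missed (λ u → ∑ (class u) degree) + length leftover * d ∎
    where
    open ≤-Reasoning
    into : ∀ {x} → x ∈ leftover ⊎ (∃[ u ] u ∈ missed × u ≈ x) → x ∈ concatMap class missed ++ leftover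
    into (inj₁ p) = ∈-++⁺ʳ (concatMap class missed) p
    into (inj₂ (u , u∈ , e)) = ∈-++⁺ˡ (∈-concatMap-intro class u∈ (∈-class⁺ e))

  classes-bound : ∑ missed (λ u → ∑ (class u) degree) ≤ ∑ missed size * suc d
  classes-bound = ≤-trans (∑-mono missed (λ {u} _ → class-bound u)) (≤-reflexive (∑-*ʳ missed size (suc d)))

  bound : ∑ (allFin n) degree + length leftover ≤ c * suc d
  bound = begin
    ∑ (allFin n) degree + l ≤⟨ +-monoˡ-≤ l (≤-trans total (+-monoˡ-≤ (l * d) classes-bound)) ⟩
    ∑ missed size * suc d + l * d + l ≡⟨ +-assoc (∑ missed size * suc d) (l * d) l ⟩
    ∑ missed size * suc d + (l * d + l) ≡⟨ cong (∑ missed size * suc d +_) (trans (+-comm (l * d) l) (sym (*-suc l d))) ⟩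
    ∑ missed size * suc d + l * suc d ≡⟨ sym (*-distribʳ-+ (suc d) (∑ missed size) l) ⟩
    (∑ missed size + l) * suc d ≤⟨ *-monoˡ-≤ (suc d) count ⟩
    c * suc d ∎
    where
    open ≤-Reasoning
    l : ℕ
    l = length leftover

  module Tight (tight : c * suc d ≤ ∑ (allFin n) degree) where

    no-leftover : length leftover ≡ 0
    no-leftover = n≤0⇒n≡0 (+-cancelˡ-≤ (∑ (allFin n) degree) (length leftover) 0
      (≤-trans bound (≤-trans tight (≤-reflexive (sym (+-identityʳ _))))))

    in-some-class : ∀ x → ∃[ u ] u ∈ missed × u ≈ x
    in-some-class x with not-leftover x
    ... | inj₂ w = w
    ... | inj₁ x∈ = contradiction (subst (0 <_) no-leftover (∈-length x∈)) λ ()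

    tight′ : c * suc d ≤ ∑ missed (λ u → ∑ (class u) degree)
    tight′ = ≤-trans tight (≤-trans total (≤-reflexive
      (trans (cong (λ l → ∑ missed (λ u → ∑ (class u) degree) + l * d) no-leftover) (+-identityʳ _))))

    ∑size≤c : ∑ missed size ≤ c
    ∑size≤c = ≤-trans (m≤m+n _ _) count

    ∑size≡c : ∑ missed size ≡ c
    ∑size≡c = ≤-antisym ∑size≤c (*-cancelʳ-≤ c (∑ missed size) (suc d) (≤-trans tight′ classes-bound))

    class-tight : ∀ {u} → u ∈ missed → size u * suc d ≤ ∑ (class u) degree
    class-tight = ∑-tight missed {λ u → ∑ (class u) degree} {λ u → size u * suc d} (λ {u} _ → class-bound u)
      (≤-trans (≤-reflexive (trans (∑-*ʳ missed size (suc d)) (cong (_* suc d) ∑size≡c))) tight′)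

    size≡d : ∀ {u} → u ∈ missed → 1 ≤ size u → size u ≡ d
    size≡d {u} u∈ 1≤ = min-product-tight (size u) d 1≤ (≤-trans (class-tight u∈) (class-bound₁ u))

    complete : ∀ {u x y} → u ∈ missed → 1 ≤ size u → u ≈ x → u ≈ y → x ≢ y → Edge x y
    complete {u} {x} {y} u∈ 1≤ ux uy x≢y = ∈-neighbours⁻
      (⊆-reverse Fin._≟_ (unique-neighbours x) (neighbours⊆ x∈)
        (≤-trans (delete≤ x∈) (≤-trans (≤-reflexive e) full)) (∈-delete⁺ (∈-class⁺ uy) (x≢y ∘ sym)))
      where
      e : size u ≡ d
      e = size≡d u∈ 1≤
      x∈ : x ∈ class u
      x∈ = ∈-class⁺ ux
      -- The degree sum of the class is at least `d` per vertex while no degree exceeds `d`, so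
      -- every vertex has degree `d` and is joined to the whole rest of its class.
      full : d ≤ degree x
      full = ∑-tight (class u) {degree} {λ _ → d} (λ _ → degree≤d _) (begin
        ∑ (class u) (λ _ → d) ≡⟨ ∑-const (class u) d ⟩
        length (class u) * d ≤⟨ *-monoˡ-≤ d (subst (λ a → length (class u) ≤ suc a) e (class≤ u)) ⟩
        suc d * d ≡⟨ *-comm (suc d) d ⟩
        d * suc d ≡⟨ cong (_* suc d) (sym e) ⟩
        size u * suc d ≤⟨ class-tight u∈ ⟩
        ∑ (class u) degree ∎) x∈
        where open ≤-Reasoning

    nontrivial? : ∀ u → Dec (1 ≤ size u)
    nontrivial? u = 1 ≤? size u

    nontrivial : List (Fin n)
    nontrivial = filter nontrivial? missed

    ∈-nontrivial⁻ : ∀ {u} → u ∈ nontrivial → u ∈ missed × 1 ≤ size u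
    ∈-nontrivial⁻ = ∈-filter⁻ nontrivial? {xs = missed}

    -- Every class with more than one vertex accounts for exactly `d` of the `c` covered vertices.
    length-nontrivial : length nontrivial * d ≡ c
    length-nontrivial = trans (sym (∑-const nontrivial d)) (trans
      (∑-filter-const nontrivial? missed size≡d (λ _ ≰ → n<1⇒n≡0 (≰⇒> ≰))) ∑size≡c)

    K : Fin n → Subset n
    K u = set (class u)

    ∣K∣ : ∀ {u} → u ∈ nontrivial → ∣ K u ∣ ≡ suc d
    ∣K∣ {u} u∈ = let u∈m , 1≤ = ∈-nontrivial⁻ u∈ in trans (∣set∣ (unique-class u))
      (trans (≤-antisym (class≤ u) (length-delete-< (∈-class⁺ (inj₁ refl)))) (cong suc (size≡d u∈m 1≤)))

    K⇒edge : ∀ {u x y} → u ∈ nontrivial → x ∈ₛ K u → y ∈ₛ K u → x ≢ y → Edge x y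
    K⇒edge {u} u∈ x∈ y∈ = let u∈m , 1≤ = ∈-nontrivial⁻ u∈ in
      complete u∈m 1≤ (∈-class⁻ (∈-set⁻ (class u) x∈)) (∈-class⁻ (∈-set⁻ (class u) y∈))

    edge⇒K : ∀ {x y} → Edge x y → ∃[ u ] u ∈ nontrivial × x ∈ₛ K u × y ∈ₛ K u
    edge⇒K {x} {y} xy = let u , u∈ , ux = in-some-class x
                            uy = ≈-trans ux (inj₂ (edge⇒¬apart xy))
      in u , ∈-filter⁺ nontrivial? u∈ (big u ux uy) , ∈-set⁺ (∈-class⁺ ux) , ∈-set⁺ (∈-class⁺ uy)
      where
      big : ∀ u → u ≈ x → u ≈ y → 1 ≤ size u
      big u ux uy with x Fin.≟ u
      ... | no x≢u = ∈-length (∈-delete⁺ (∈-class⁺ ux) x≢u)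
      ... | yes refl = ∈-length (∈-delete⁺ (∈-class⁺ uy) λ { refl → irrefl xy })

    K-disjoint : ∀ {u v x} → u ∈ nontrivial → v ∈ nontrivial → x ∈ₛ K u → x ∈ₛ K v → u ≡ v
    K-disjoint {u} {v} u∈ v∈ x∈ x∈′ =
      same-class (proj₁ (∈-nontrivial⁻ u∈)) (proj₁ (∈-nontrivial⁻ v∈)) (∈-set⁻ (class u) x∈) (∈-set⁻ (class v) x∈′)

-- A matching of `s - 1` edges is kept along with the cliques: its edges, each enlarged by the same
-- point, become all but one of the sets of a star.
record TwoCliques {n : ℕ} (G : DecGraph n) (s : ℕ) : Set where
  open DecGraph G
  field
    K₁ K₂ : Subset n
    ∣K₁∣  : ∣ K₁ ∣ ≡ s
    ∣K₂∣  : ∣ K₂ ∣ ≡ s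
    disj  : ∀ {x} → x ∈ₛ K₁ → x ∉ₛ K₂
    edge⁺₁ : ∀ {x y} → x ∈ₛ K₁ → y ∈ₛ K₁ → x ≢ y → Edge x y
    edge⁺₂ : ∀ {x y} → x ∈ₛ K₂ → y ∈ₛ K₂ → x ≢ y → Edge x y
    edge⁻ : ∀ {x y} → Edge x y → (x ∈ₛ K₁ × y ∈ₛ K₁) ⊎ (x ∈ₛ K₂ × y ∈ₛ K₂)
    matching : ∃[ M ] IsMatching M × cov M ≡ 2 * ℕ.pred s

isolate : {n : ℕ} → DecGraph n → Fin n → DecGraph n
isolate G v = record
  { Edge = λ x y → Edge x y × x ≢ v × y ≢ v
  ; edge? = λ x y → edge? x y ×-dec ¬? (x Fin.≟ v) ×-dec ¬? (y Fin.≟ v)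
  ; symm = λ (e , p , q) → symm e , q , p
  ; irrefl = irrefl ∘ proj₁ }
  where open DecGraph G

arcs-isolate : {n : ℕ} (G : DecGraph n) (v : Fin n) →
  length (DecGraph.arcs G) ≤ length (DecGraph.arcs (isolate G v)) + 2 * DecGraph.degree G v
arcs-isolate G v = begin
  length arcs ≤⟨ unique-⊆-length unique-arcs (λ {e} e∈ → into e e∈) ⟩
  length (H.arcs ++ out ++ back) ≡⟨ length-++ H.arcs ⟩
  length H.arcs + length (out ++ back) ≡⟨ cong (length H.arcs +_) (trans (length-++ out)
    (cong₂ _+_ (length-map (v ,_) (neighbours v)) (trans (length-map (_, v) (neighbours v)) (sym (+-identityʳ _))))) ⟩
  length H.arcs + 2 * degree v ∎
  where
  open ≤-Reasoning
  open DecGraph G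
  module H = DecGraph (isolate G v)
  out back : List _
  out = map (v ,_) (neighbours v)
  back = map (_, v) (neighbours v)
  into : ∀ e → e ∈ arcs → e ∈ H.arcs ++ out ++ back
  into (x , y) e∈ with x Fin.≟ v | y Fin.≟ v
  ... | yes refl | _ = ∈-++⁺ʳ H.arcs (∈-++⁺ˡ (∈-map⁺ (v ,_) (∈-neighbours⁺ (∈-arcs⁻ e∈))))
  ... | no _ | yes refl = ∈-++⁺ʳ H.arcs (∈-++⁺ʳ out (∈-map⁺ (_, v) (∈-neighbours⁺ (symm (∈-arcs⁻ e∈)))))
  ... | no x≢v | no y≢v = ∈-++⁺ˡ (H.∈-arcs⁺ (∈-arcs⁻ e∈ , x≢v , y≢v))

isMatching-isolate : {n : ℕ} (G : DecGraph n) (v : Fin n) (M : Vec (Fin n) n) →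
  DecGraph.IsMatching (isolate G v) M → DecGraph.IsMatching G M × lookup M v ≡ v
isMatching-isolate G v M (inv , e) = (inv , λ x ≢ → proj₁ (e x ≢)) ,
  decidable-stable (lookup M v Fin.≟ v) λ ≢ → proj₁ (proj₂ (e v ≢)) refl

-- The number of covered vertices is even, so missing the maximum means losing two.
even-drop : ∀ {m c} (e : ∃[ l ] c ≡ 2 * l) → c ≤ 2 * suc m → c ≢ 2 * suc m → c ≤ 2 * m
even-drop {m} (l , refl) le ≢ = *-monoʳ-≤ 2 (ℕ.s≤s⁻¹ (≤∧≢⇒< (*-cancelˡ-≤ {l} {suc m} 2 le) λ { refl → ≢ refl }))

module _ {n : ℕ} (d : ℕ) where

  Extremal-or-small : DecGraph n → ℕ → Set
  Extremal-or-small G m = length arcs < (2 * m) * suc d ⊎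
    ((∃[ M ] IsMatching M × cov M ≡ 2 * m) × (∀ w → ∃[ M ] IsMatching M × cov M ≡ 2 * m × lookup M w ≡ w))
    where open DecGraph G

  arcs-≤ : (G : DecGraph n) (m : ℕ) → (∀ x → DecGraph.degree G x ≤ d) →
    (∀ M → DecGraph.IsMatching G M → cov M ≤ 2 * m) → Extremal-or-small G m →
    length (DecGraph.arcs G) ≤ (2 * m) * suc d
  arcs-≤ G m deg≤ cov≤ (inj₁ lt) = <⇒≤ lt
  arcs-≤ G m deg≤ cov≤ (inj₂ ((M , isM , e) , crit)) =
    ≤-trans (≤-reflexive (DecGraph.length-arcs G)) (≤-trans (m≤m+n _ _) bound)
    where open CriticalBound G (2 * m) d cov≤ crit deg≤ M isM e

  identity-matching : (G : DecGraph n) → ∃[ M ] DecGraph.IsMatching G M × (∀ w → lookup M w ≡ w)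
  identity-matching G = Vec.allFin n , ((λ x → trans (fix _) (fix x)) , λ x ≢ → contradiction (fix x) ≢) , fix
    where
    fix : ∀ w → lookup (Vec.allFin n) w ≡ w
    fix = Vec.lookup-allFin

  -- Induction on `m`. Without a matching of `m + 1` edges, the bound for `m` applies. If some `v`
  -- lies in every maximum matching, isolating `v` costs at most `2 * d` arcs and lowers the
  -- matching number, and `2 * d < 2 * suc d` makes the bound strict. In the remaining case every
  -- vertex is missed by some maximum matching, which is the hypothesis of Gallai's lemma.
  extremal-or-small : ∀ m (G : DecGraph n) → (∀ x → DecGraph.degree G x ≤ d) →
    (∀ M → DecGraph.IsMatching G M → cov M ≤ 2 * m) → Extremal-or-small G m
  extremal-or-small zero G deg≤ cov≤ = let M , isM , fix = identity-matching G
                                           e = n≤0⇒n≡0 (cov≤ M isM)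
    in inj₂ ((M , isM , e) , λ w → M , isM , e , fix w)
  extremal-or-small (suc m) G deg≤ cov≤
    with DecGraph.∃matching? G (λ M → cov M ℕ.≟ 2 * suc m)
  ... | no ¬∃ = inj₁ (<-≤-trans (s≤s (arcs-≤ G m deg≤ cov≤′ (extremal-or-small m G deg≤ cov≤′)))
    (*-monoˡ-< (suc d) (*-monoʳ-< 2 (n<1+n m))))
    where
    cov≤′ : ∀ M → DecGraph.IsMatching G M → cov M ≤ 2 * m
    cov≤′ M isM = even-drop (length (lower M) , cov-even M (proj₁ isM)) (cov≤ M isM) λ e → ¬∃ (M , isM , e)
  ... | yes w₀ with Fin.all? (λ w → DecGraph.∃matching? G (λ M → (cov M ℕ.≟ 2 * suc m) ×-dec (lookup M w Fin.≟ w)))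
  ... | yes crit = inj₂ (w₀ , crit)
  ... | no ¬crit with Fin.¬∀⟶∃¬ n _ (λ w → DecGraph.∃matching? G (λ M → (cov M ℕ.≟ 2 * suc m) ×-dec (lookup M w Fin.≟ w))) ¬crit
  ... | v , ¬missed = inj₁ (begin-strict
    length (DecGraph.arcs G) ≤⟨ arcs-isolate G v ⟩
    length (DecGraph.arcs H) + 2 * DecGraph.degree G v
      ≤⟨ +-mono-≤ (arcs-≤ H m degH covH (extremal-or-small m H degH covH)) (*-monoʳ-≤ 2 (deg≤ v)) ⟩
    (2 * m) * suc d + 2 * d <⟨ +-monoʳ-< ((2 * m) * suc d) (*-monoʳ-< 2 (n<1+n d)) ⟩
    (2 * m) * suc d + 2 * suc d ≡⟨ sym (*-distribʳ-+ (suc d) (2 * m) 2) ⟩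
    (2 * m + 2) * suc d ≡⟨ cong (_* suc d) (trans (+-comm (2 * m) 2) (sym (*-suc 2 m))) ⟩
    (2 * suc m) * suc d ∎)
    where
    open ≤-Reasoning
    H : DecGraph n
    H = isolate G v
    degH : ∀ x → DecGraph.degree H x ≤ d
    degH x = ≤-trans (unique-⊆-length (DecGraph.unique-neighbours H x)
      (DecGraph.∈-neighbours⁺ G ∘ proj₁ ∘ DecGraph.∈-neighbours⁻ H)) (deg≤ x)
    covH : ∀ M → DecGraph.IsMatching H M → cov M ≤ 2 * m
    covH M isM = let isM′ , Mv = isMatching-isolate G v M isM in
      even-drop (length (lower M) , cov-even M (proj₁ isM)) (cov≤ M isM′) λ e → ¬missed (M , isM′ , e , Mv)

  -- With matching number at most `d`, equality gives `length nontrivial * d ≡ 2 * d`, so there are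
  -- exactly two nontrivial classes, each a clique on `d + 1` vertices.
  two-cliques : (G : DecGraph n) → 1 ≤ d → (∀ x → DecGraph.degree G x ≤ d) →
    (∀ M → DecGraph.IsMatching G M → cov M ≤ 2 * d) →
    length (DecGraph.arcs G) ≤ (2 * d) * suc d ×
    ((2 * d) * suc d ≤ length (DecGraph.arcs G) → TwoCliques G (suc d))
  two-cliques G 1≤d deg≤ cov≤ = arcs-≤ G d deg≤ cov≤ ext , structure ext
    where
    ext : Extremal-or-small G d
    ext = extremal-or-small d G deg≤ cov≤
    structure : Extremal-or-small G d → (2 * d) * suc d ≤ length (DecGraph.arcs G) → TwoCliques G (suc d)
    structure (inj₁ lt) le = contradiction lt (≤⇒≯ le)
    structure (inj₂ ((M , isM , e) , crit)) le = build nontrivial refl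
      (*-cancelʳ-≡ (length nontrivial) 2 d {{ℕ.>-nonZero 1≤d}} length-nontrivial)
      where
      open CriticalBound G (2 * d) d cov≤ crit deg≤ M isM e
      open Tight (subst ((2 * d) * suc d ≤_) (DecGraph.length-arcs G) le)
      build : ∀ us → us ≡ nontrivial → length us ≡ 2 → TwoCliques G (suc d)
      build (u ∷ v ∷ []) eq _ = record
        { K₁ = K u ; K₂ = K v ; ∣K₁∣ = ∣K∣ u∈ ; ∣K₂∣ = ∣K∣ v∈
        ; disj = λ p q → u≢v (K-disjoint u∈ v∈ p q)
        ; edge⁺₁ = K⇒edge u∈ ; edge⁺₂ = K⇒edge v∈ ; edge⁻ = edge⁻ ; matching = M , isM , e }
        where
        u∈ : u ∈ nontrivial
        u∈ = subst (u ∈_) eq (here refl)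
        v∈ : v ∈ nontrivial
        v∈ = subst (v ∈_) eq (there (here refl))
        u≢v : u ≢ v
        u≢v refl with subst Unique (sym eq) (Unique.filter⁺ nontrivial? unique-missed)
        ... | (≢ ∷ _) ∷ _ = ≢ refl
        edge⁻ : ∀ {x y} → DecGraph.Edge G x y → (x ∈ₛ K u × y ∈ₛ K u) ⊎ (x ∈ₛ K v × y ∈ₛ K v)
        edge⁻ xy with edge⇒K xy
        ... | w , w∈ , p , q with subst (w ∈_) (sym eq) w∈
        ... | here refl = inj₁ (p , q)
        ... | there (here refl) = inj₂ (p , q)

-- Union-closed families

fresh : {k : ℕ} (xs : List (Fin k)) → length xs < k → ∃[ v ] v ∉ xs
fresh {k} xs lt with Fin.any? (λ v → ¬? (v ∈ₗ? xs))
... | yes w = w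
... | no ¬∃ = contradiction
  (subst (_≤ length xs) (length-allFin k)
    (unique-⊆-length (Unique.allFin⁺ k) λ {v} _ → decidable-stable (v ∈ₗ? xs) λ v∉ → ¬∃ (v , v∉)))
  (<⇒≱ lt)

-- J will hold of the complements of the kernel patterns of a homogeneous family.
module UnionClosed {k : ℕ} (5≤k : 5 ≤ k) (J : Subset k → Set) (J? : ∀ p → Dec (J p))
  (J-⊥ : J Subset.⊥)
  (J-∪ : ∀ p q → J p → J q → J (p ∪ q))
  (no-co-singleton : ∀ x p → J p → x ∉ₛ p → ¬ (∀ y → y ≢ x → y ∈ₛ p))
  (triple : ∀ a b c → a ≢ b → a ≢ c → b ≢ c →
            ∃[ p ] J p × (∃[ x ] x ∈ₛ p) × (∀ x → x ∈ₛ p → x ≡ a ⊎ x ≡ b ⊎ x ≡ c))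
  where

  infix 4 _⟶_
  _⟶_ : Fin k → Fin k → Set
  q ⟶ p = ∀ m → J m × q ∈ₛ m → p ∈ₛ m

  _⟶?_ : ∀ q p → Dec (q ⟶ p)
  q ⟶? p = all-subsets? λ m → (J? m ×-dec (q Sub.∈? m)) →-dec (p Sub.∈? m)

  J-⋃ : (ms : List (Subset k)) → (∀ {m} → m ∈ ms → J m) → J (⋃ ms)
  J-⋃ [] _ = J-⊥
  J-⋃ (m ∷ ms) h = J-∪ m (⋃ ms) (h (here refl)) (J-⋃ ms (h ∘ there))

  ∈-⋃⁺ : {ms : List (Subset k)} {m : Subset k} {x : Fin k} → m ∈ ms → x ∈ₛ m → x ∈ₛ ⋃ ms
  ∈-⋃⁺ (here refl) x∈ = Sub.x∈p∪q⁺ (inj₁ x∈)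
  ∈-⋃⁺ (there q) x∈ = Sub.x∈p∪q⁺ (inj₂ (∈-⋃⁺ q x∈))

  ∈-⋃⁻ : (ms : List (Subset k)) {x : Fin k} → x ∈ₛ ⋃ ms → ∃[ m ] m ∈ ms × x ∈ₛ m
  ∈-⋃⁻ [] x∈ = contradiction x∈ Sub.∉⊥
  ∈-⋃⁻ (m ∷ ms) x∈ with Sub.x∈p∪q⁻ m (⋃ ms) x∈
  ... | inj₁ p = m , here refl , p
  ... | inj₂ p = let m′ , q , r = ∈-⋃⁻ ms p in m′ , there q , r

  avoiding? : ∀ p m → Dec (J m × p ∉ₛ m)
  avoiding? p m = J? m ×-dec ¬? (p Sub.∈? m)

  avoiding : Fin k → List (Subset k)
  avoiding p = filter (avoiding? p) (allSubsets k)

  -- The union of all members avoiding `p` is a member avoiding `p`, so it misses a second point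
  -- `q`. No member contains `q` without `p`.
  dominating : ∀ p → ∃[ q ] q ≢ p × q ⟶ p
  dominating p with Fin.any? (λ q → ¬? (q Fin.≟ p) ×-dec (q ⟶? p))
  ... | yes w = w
  ... | no ¬∃ = contradiction cover (no-co-singleton p U (J-⋃ (avoiding p) (proj₁ ∘ prop)) p∉)
    where
    U : Subset k
    U = ⋃ (avoiding p)
    prop : ∀ {m} → m ∈ avoiding p → J m × p ∉ₛ m
    prop m∈ = proj₂ (∈-filter⁻ (avoiding? p) {xs = allSubsets k} m∈)
    p∉ : p ∉ₛ U
    p∉ p∈ = let m , m∈ , p∈m = ∈-⋃⁻ (avoiding p) p∈ in proj₂ (prop m∈) p∈m
    cover : ∀ y → y ≢ p → y ∈ₛ U
    cover y y≢p = decidable-stable (y Sub.∈? U) λ y∉ →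
      ¬∃ (y , y≢p , λ m (Jm , y∈m) → decidable-stable (p Sub.∈? m) λ p∉m →
        y∉ (∈-⋃⁺ (∈-filter⁺ (avoiding? p) (∈-allSubsets m) (Jm , p∉m)) y∈m))

  members : Fin k → List (Subset k)
  members x = filter (λ m → J? m ×-dec (x Sub.∈? m)) (allSubsets k)

  ⟶-strict : ∀ {p q} → q ⟶ p → ¬ (p ⟶ q) → length (members q) < length (members p)
  ⟶-strict {p} {q} q⟶p ¬p⟶q with ¬∀⇒∃¬-subset (λ m → (J? m ×-dec (p Sub.∈? m)) →-dec (q Sub.∈? m)) ¬p⟶q
  ... | m , ¬h = unique-⊆-length
    (∉⇒All≢ (λ m∈ → q∉m (proj₂ (proj₂ (∈-filter⁻ (λ m → J? m ×-dec (q Sub.∈? m)) {xs = allSubsets k} m∈))))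
      ∷ Unique.filter⁺ _ (unique-allSubsets k)) into
    where
    Jp : J m × p ∈ₛ m
    Jp = decidable-stable (J? m ×-dec (p Sub.∈? m)) λ ¬Jp → ¬h λ Jp → contradiction Jp ¬Jp
    q∉m : q ∉ₛ m
    q∉m q∈ = ¬h λ _ → q∈
    into : ∀ {m′} → m′ ∈ m ∷ members q → m′ ∈ members p
    into (here refl) = ∈-filter⁺ (λ m → J? m ×-dec (p Sub.∈? m)) (∈-allSubsets m) Jp
    into {m′} (there m∈) =
      let h = proj₂ (∈-filter⁻ (λ m → J? m ×-dec (q Sub.∈? m)) {xs = allSubsets k} m∈) in
      ∈-filter⁺ (λ m → J? m ×-dec (p Sub.∈? m)) (∈-allSubsets m′) (proj₁ h , q⟶p m′ h)

  -- Passing from a point to one that dominates it shrinks the list of members containing the point,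
  -- strictly unless both points lie in the same members.
  twins : ∃[ p ] ∃[ q ] p ≢ q × p ⟶ q × q ⟶ p
  twins = search _ (Fin.fromℕ< 5≤k) ≤-refl
    where
    search : ∀ fuel p → length (members p) ≤ fuel → ∃[ p ] ∃[ q ] p ≢ q × p ⟶ q × q ⟶ p
    search fuel p le with dominating p
    ... | q , q≢p , q⟶p with p ⟶? q
    ... | yes p⟶q = p , q , q≢p ∘ sym , p⟶q , q⟶p
    search zero p le | q , q≢p , q⟶p | no ¬p⟶q = contradiction (<-≤-trans (⟶-strict q⟶p ¬p⟶q) le) λ ()
    search (suc fuel) p le | q , q≢p , q⟶p | no ¬p⟶q =
      search fuel q (ℕ.s≤s⁻¹ (<-≤-trans (⟶-strict q⟶p ¬p⟶q) le))

  singleton : ∀ {m a} → J m → (∃[ x ] x ∈ₛ m) → (∀ x → x ∈ₛ m → x ≡ a) → J ⁅ a ⁆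
  singleton {m} {a} Jm (x , x∈) only = subst J (Sub.⊆-antisym
    (λ {y} y∈ → subst (_∈ₛ ⁅ a ⁆) (sym (only y y∈)) (Sub.x∈⁅x⁆ a))
    (λ {y} y∈ → subst (_∈ₛ m) (trans (only x x∈) (sym (Sub.x∈⁅y⁆⇒x≡y a y∈))) x∈)) Jm

  J-from-singletons : (m : Subset k) → (∀ x → x ∈ₛ m → J ⁅ x ⁆) → J m
  J-from-singletons m h = subst J
    (Sub.⊆-antisym
      (λ x∈ → let p , p∈ , x∈p = ∈-⋃⁻ ms x∈
                  y , y∈ , e = ∈-map⁻ ⁅_⁆ p∈
              in subst (_∈ₛ m) (sym (Sub.x∈⁅y⁆⇒x≡y y (subst (_ ∈ₛ_) e x∈p))) (∈-toList⁻ m y∈))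
      (λ {x} x∈ → ∈-⋃⁺ (∈-map⁺ ⁅_⁆ (∈-toList⁺ x∈)) (Sub.x∈⁅x⁆ x)))
    (J-⋃ ms λ p∈ → let y , y∈ , e = ∈-map⁻ ⁅_⁆ p∈ in subst J (sym e) (h y (∈-toList⁻ m y∈)))
    where
    ms : List (Subset k)
    ms = map ⁅_⁆ (toList m)

  -- Adding to `m` the singletons of the other points outside it would give a member missing only
  -- `v`.
  not-almost-covered : ∀ {m v} → J m → v ∉ₛ m → ¬ (∀ x → x ≢ v → x ∈ₛ m ⊎ J ⁅ x ⁆)
  not-almost-covered {m} {v} Jm v∉ h = no-co-singleton v (m ∪ r) (J-∪ m r Jm Jr) v∉∪ all
    where
    r? : ∀ x → Dec (x ≢ v × x ∉ₛ m)
    r? x = ¬? (x Fin.≟ v) ×-dec ¬? (x Sub.∈? m)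
    r : Subset k
    r = comp r?
    Jr : J r
    Jr = J-from-singletons r λ x x∈ → let x≢v , x∉m = ∈-comp⁻ r? x∈ in
      [ (λ x∈m → contradiction x∈m x∉m) , id ]′ (h x x≢v)
    v∉∪ : v ∉ₛ m ∪ r
    v∉∪ v∈ = [ v∉ , (λ q → proj₁ (∈-comp⁻ r? q) refl) ]′ (Sub.x∈p∪q⁻ m r v∈)
    all : ∀ x → x ≢ v → x ∈ₛ m ∪ r
    all x x≢v with x Sub.∈? m
    ... | yes p = Sub.x∈p∪q⁺ (inj₁ p)
    ... | no ¬p = Sub.x∈p∪q⁺ (inj₂ (∈-comp⁺ r? (x≢v , ¬p)))

  -- The situation to be excluded: besides the twins there is a point `w` whose singleton is not a
  -- member. Whichever point dominates `w`, a member missing exactly one point arises.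
  module _ (p q : Fin k) (p≢q : p ≢ q) (p⟶q : p ⟶ q) (q⟶p : q ⟶ p)
           (w : Fin k) (w≢p : w ≢ p) (w≢q : w ≢ q) (¬Jw : ¬ J ⁅ w ⁆) where

    -- For `a` outside `p`, `q`, `w`, a member within `p`, `q`, `a` that contains a twin would
    -- contain `w`, so it is the singleton of `a`. A member within `p`, `q`, `w` is not the
    -- singleton of `w`, so it contains all three. Together these cover everything except a chosen
    -- `v`.
    dominated-by-twins : p ⟶ w → q ⟶ w → ⊥
    dominated-by-twins p⟶w q⟶w
      with fresh (p ∷ q ∷ w ∷ []) (≤-trans (s≤s (s≤s (s≤s (s≤s z≤n)))) 5≤k) | triple p q w p≢q (w≢p ∘ sym) (w≢q ∘ sym)
    ... | v , v∉ | m , Jm , (x , x∈) , only = not-almost-covered Jm v∉m cover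
      where
      single : ∀ a → a ≢ p → a ≢ q → a ≢ w → J ⁅ a ⁆
      single a a≢p a≢q a≢w with triple p q a p≢q (a≢p ∘ sym) (a≢q ∘ sym)
      ... | m , Jm , ne , only = singleton Jm ne λ x x∈ → case x x∈ (only x x∈)
        where
        w∉ : w ∉ₛ m
        w∉ w∈ with only w w∈
        ... | inj₁ e = w≢p e
        ... | inj₂ (inj₁ e) = w≢q e
        ... | inj₂ (inj₂ e) = a≢w (sym e)
        case : ∀ x → x ∈ₛ m → x ≡ p ⊎ x ≡ q ⊎ x ≡ a → x ≡ a
        case x x∈ (inj₁ refl) = contradiction (p⟶w m (Jm , x∈)) w∉
        case x x∈ (inj₂ (inj₁ refl)) = contradiction (q⟶w m (Jm , x∈)) w∉
        case x x∈ (inj₂ (inj₂ e)) = e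
      p∈m : p ∈ₛ m
      p∈m = decidable-stable (p Sub.∈? m) λ p∉ → ¬Jw (singleton Jm (x , x∈) λ y y∈ → case p∉ y y∈ (only y y∈))
        where
        case : p ∉ₛ m → ∀ y → y ∈ₛ m → y ≡ p ⊎ y ≡ q ⊎ y ≡ w → y ≡ w
        case p∉ y y∈ (inj₁ refl) = contradiction y∈ p∉
        case p∉ y y∈ (inj₂ (inj₁ refl)) = contradiction (q⟶p m (Jm , y∈)) p∉
        case p∉ y y∈ (inj₂ (inj₂ e)) = e
      v∉m : v ∉ₛ m
      v∉m v∈ with only v v∈
      ... | inj₁ e = v∉ (here e)
      ... | inj₂ (inj₁ e) = v∉ (there (here e))
      ... | inj₂ (inj₂ e) = v∉ (there (there (here e)))
      cover : ∀ y → y ≢ v → y ∈ₛ m ⊎ J ⁅ y ⁆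
      cover y y≢v with y Fin.≟ p | y Fin.≟ q | y Fin.≟ w
      ... | yes refl | _ | _ = inj₁ p∈m
      ... | no _ | yes refl | _ = inj₁ (p⟶q m (Jm , p∈m))
      ... | no _ | no _ | yes refl = inj₁ (p⟶w m (Jm , p∈m))
      ... | no a | no b | no c = inj₂ (single y a b c)

    -- A member within three points cannot contain `q` without room for `p`, nor `r` without room
    -- for `w`. This yields the singletons of all points outside `p`, `q`, `w`, `r`, a member
    -- containing `r` and `w`, and one containing `p` and `q`.
    dominated-elsewhere : ∀ r → r ≢ w → r ≢ p → r ≢ q → r ⟶ w → ⊥
    dominated-elsewhere r r≢w r≢p r≢q r⟶w
      -- A fifth point is left uncovered; `5 ≤ k` is used in full here.
      with fresh (p ∷ q ∷ w ∷ r ∷ []) 5≤k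
         | triple q w r (w≢q ∘ sym) (r≢q ∘ sym) (r≢w ∘ sym)
         | triple p q r p≢q (r≢p ∘ sym) (r≢q ∘ sym)
    ... | v , v∉ | m₁ , Jm₁ , (x₁ , x₁∈) , only₁ | m₂ , Jm₂ , (x₂ , x₂∈) , only₂ =
      not-almost-covered (J-∪ m₁ m₂ Jm₁ Jm₂) v∉m cover
      where
      q∉ : ∀ {m a b} → J m → a ≢ p → b ≢ p → (∀ x → x ∈ₛ m → x ≡ q ⊎ x ≡ a ⊎ x ≡ b) → q ∉ₛ m
      q∉ Jm a≢p b≢p only q∈ with only p (q⟶p _ (Jm , q∈))
      ... | inj₁ e = p≢q e
      ... | inj₂ (inj₁ e) = a≢p (sym e)
      ... | inj₂ (inj₂ e) = b≢p (sym e)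
      single : ∀ a → a ≢ p → a ≢ q → a ≢ w → a ≢ r → J ⁅ a ⁆
      single a a≢p a≢q a≢w a≢r with triple q r a (r≢q ∘ sym) (a≢q ∘ sym) (a≢r ∘ sym)
      ... | m , Jm , ne , only = singleton Jm ne λ x x∈ → case x x∈ (only x x∈)
        where
        case : ∀ x → x ∈ₛ m → x ≡ q ⊎ x ≡ r ⊎ x ≡ a → x ≡ a
        case x x∈ (inj₁ refl) = contradiction x∈ (q∉ Jm r≢p a≢p only)
        case x x∈ (inj₂ (inj₁ refl)) with only w (r⟶w m (Jm , x∈))
        ... | inj₁ e = contradiction e w≢q
        ... | inj₂ (inj₁ e) = contradiction (sym e) r≢w
        ... | inj₂ (inj₂ e) = contradiction (sym e) a≢w
        case x x∈ (inj₂ (inj₂ e)) = e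
      r∈m₁ : r ∈ₛ m₁
      r∈m₁ = decidable-stable (r Sub.∈? m₁) λ r∉ →
        ¬Jw (singleton Jm₁ (x₁ , x₁∈) λ y y∈ → case r∉ y y∈ (only₁ y y∈))
        where
        case : r ∉ₛ m₁ → ∀ y → y ∈ₛ m₁ → y ≡ q ⊎ y ≡ w ⊎ y ≡ r → y ≡ w
        case r∉ y y∈ (inj₁ refl) = contradiction y∈ (q∉ Jm₁ w≢p r≢p only₁)
        case r∉ y y∈ (inj₂ (inj₁ e)) = e
        case r∉ y y∈ (inj₂ (inj₂ refl)) = contradiction y∈ r∉
      p∈m₂ : p ∈ₛ m₂
      p∈m₂ = case x₂∈ (only₂ x₂ x₂∈)
        where
        case : ∀ {x} → x ∈ₛ m₂ → x ≡ p ⊎ x ≡ q ⊎ x ≡ r → p ∈ₛ m₂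
        case x∈ (inj₁ refl) = x∈
        case x∈ (inj₂ (inj₁ refl)) = q⟶p m₂ (Jm₂ , x∈)
        case x∈ (inj₂ (inj₂ refl)) with only₂ w (r⟶w m₂ (Jm₂ , x∈))
        ... | inj₁ e = contradiction e w≢p
        ... | inj₂ (inj₁ e) = contradiction e w≢q
        ... | inj₂ (inj₂ e) = contradiction (sym e) r≢w
      v∉m : v ∉ₛ m₁ ∪ m₂
      v∉m v∈ with Sub.x∈p∪q⁻ m₁ m₂ v∈
      ... | inj₁ v∈₁ with only₁ v v∈₁
      ... | inj₁ e = v∉ (there (here e))
      ... | inj₂ (inj₁ e) = v∉ (there (there (here e)))
      ... | inj₂ (inj₂ e) = v∉ (there (there (there (here e))))
      v∉m v∈ | inj₂ v∈₂ with only₂ v v∈₂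
      ... | inj₁ e = v∉ (here e)
      ... | inj₂ (inj₁ e) = v∉ (there (here e))
      ... | inj₂ (inj₂ e) = v∉ (there (there (there (here e))))
      cover : ∀ y → y ≢ v → y ∈ₛ m₁ ∪ m₂ ⊎ J ⁅ y ⁆
      cover y y≢v with y Fin.≟ p | y Fin.≟ q | y Fin.≟ w | y Fin.≟ r
      ... | yes refl | _ | _ | _ = inj₁ (Sub.x∈p∪q⁺ (inj₂ p∈m₂))
      ... | no _ | yes refl | _ | _ = inj₁ (Sub.x∈p∪q⁺ (inj₂ (p⟶q m₂ (Jm₂ , p∈m₂))))
      ... | no _ | no _ | yes refl | _ = inj₁ (Sub.x∈p∪q⁺ (inj₁ (r⟶w m₁ (Jm₁ , r∈m₁))))
      ... | no _ | no _ | no _ | yes refl = inj₁ (Sub.x∈p∪q⁺ (inj₁ r∈m₁))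
      ... | no a | no b | no c | no d = inj₂ (single y a b c d)

  -- The two points are twins. Once all other singletons are members, so are all unions of them; a
  -- missing singleton is refuted according to which point dominates it.
  all-but-two-singletons : ∃[ p ] ∃[ q ] p ≢ q × (∀ m → p ∉ₛ m → q ∉ₛ m → J m)
  all-but-two-singletons with twins
  ... | p , q , p≢q , p⟶q , q⟶p
    with Fin.any? (λ w → ¬? (w Fin.≟ p) ×-dec ¬? (w Fin.≟ q) ×-dec ¬? (J? ⁅ w ⁆))
  ... | no ¬∃ = p , q , p≢q , λ m p∉ q∉ → J-from-singletons m λ x x∈ →
    decidable-stable (J? ⁅ x ⁆) λ ¬Jx → ¬∃ (x , (λ { refl → p∉ x∈ }) , (λ { refl → q∉ x∈ }) , ¬Jx)
  ... | yes (w , w≢p , w≢q , ¬Jw) with dominating w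
  ... | r , r≢w , r⟶w with r Fin.≟ p | r Fin.≟ q
  ... | yes refl | _ = ⊥-elim (dominated-by-twins p q p≢q p⟶q q⟶p w w≢p w≢q ¬Jw r⟶w
    λ m (Jm , q∈) → r⟶w m (Jm , q⟶p m (Jm , q∈)))
  ... | no _ | yes refl = ⊥-elim (dominated-by-twins p q p≢q p⟶q q⟶p w w≢p w≢q ¬Jw
    (λ m (Jm , p∈) → r⟶w m (Jm , p⟶q m (Jm , p∈))) r⟶w)
  ... | no r≢p | no r≢q = ⊥-elim (dominated-elsewhere p q p≢q p⟶q q⟶p w w≢p w≢q ¬Jw r r≢w r≢p r≢q r⟶w)

-- The delta-system method

Agree : {n k : ℕ} → Subset k → Vec (Fin n) k → Vec (Fin n) k → Set
Agree p u v = ∀ i → i ∈ₛ p → lookup u i ≡ lookup v i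

agree? : {n k : ℕ} (p : Subset k) (u v : Vec (Fin n) k) → Dec (Agree p u v)
agree? p u v = Fin.all? λ i → (i Sub.∈? p) →-dec (lookup u i Fin.≟ lookup v i)

agree-sym : {n k : ℕ} {p : Subset k} (u v : Vec (Fin n) k) → Agree p u v → Agree p v u
agree-sym u v h i i∈ = sym (h i i∈)

agree-trans : {n k : ℕ} {p : Subset k} (u v w : Vec (Fin n) k) → Agree p u v → Agree p v w → Agree p u w
agree-trans u v w g h i i∈ = trans (g i i∈) (h i i∈)

restrict : {A : Set} {k : ℕ} (p : Subset k) → Vec A k → Vec A ∣ p ∣
restrict [] [] = []
restrict (true ∷ p) (x ∷ v) = x ∷ restrict p v
restrict (false ∷ p) (x ∷ v) = restrict p v

restrict-agree : {n k : ℕ} (p : Subset k) (u v : Vec (Fin n) k) → restrict p u ≡ restrict p v → Agree p u v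
restrict-agree (true ∷ p) (x ∷ u) (y ∷ v) e zero _ = Vec.∷-injectiveˡ e
restrict-agree (true ∷ p) (x ∷ u) (y ∷ v) e (suc i) (Vec.there i∈) = restrict-agree p u v (Vec.∷-injectiveʳ e) i i∈
restrict-agree (false ∷ p) (x ∷ u) (y ∷ v) e (suc i) (Vec.there i∈) = restrict-agree p u v e i i∈

-- The recursion of the decomposition: one homogeneous piece, and one recursive call for each of the
-- `suc m` undecided patterns.
pieces : ℕ → ℕ
pieces zero = 1
pieces (suc m) = 1 + suc m * pieces m

module DeltaSystem (n k z : ℕ) where

  Word : Set
  Word = Vec (Fin n) k

  Meets : Subset n → Subset k → Word → Set
  Meets Z p v = ∃[ i ] i ∉ₛ p × lookup v i ∈ₛ Z

  meets? : ∀ Z p v → Dec (Meets Z p v)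
  meets? Z p v = Fin.any? λ i → ¬? (i Sub.∈? p) ×-dec (lookup v i Sub.∈? Z)

  -- Kernels of sets, transferred to words: a pattern `p` is a set of coordinates and so refers to
  -- the same positions in all words, which makes patterns of different words comparable.
  Kernel : List Word → Subset k → Word → Set
  Kernel 𝓥 p v = ∀ Z → ∣ Z ∣ ≤ z → Any (λ w → Agree p v w × ¬ Meets Z p w) 𝓥

  kernel? : ∀ 𝓥 p v → Dec (Kernel 𝓥 p v)
  kernel? 𝓥 p v = all-subsets? λ Z → (∣ Z ∣ ≤? z) →-dec
    Any.any? (λ w → agree? p v w ×-dec ¬? (meets? Z p w)) 𝓥

  AllKernels : List Word → Subset k → Set
  AllKernels 𝓥 p = All (Kernel 𝓥 p) 𝓥

  allKernels? : ∀ 𝓥 p → Dec (AllKernels 𝓥 p)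
  allKernels? 𝓥 p = All.all? (kernel? 𝓥 p) 𝓥

  Blocked : List Word → Subset k → Word → Set
  Blocked 𝓥 p v = ∃[ Z ] ∣ Z ∣ ≤ z × (∀ {w} → w ∈ 𝓥 → Agree p v w → Meets Z p w)

  ¬kernel⇒blocked : ∀ 𝓥 p v → ¬ Kernel 𝓥 p v → Blocked 𝓥 p v
  ¬kernel⇒blocked 𝓥 p v ¬K
    with ¬∀⇒∃¬-subset (λ Z → (∣ Z ∣ ≤? z) →-dec Any.any? (λ w → agree? p v w ×-dec ¬? (meets? Z p w)) 𝓥) ¬K
  ... | Z , ¬h = Z , decidable-stable (∣ Z ∣ ≤? z) (λ ≰ → ¬h λ le → contradiction le ≰) , λ {w} w∈ ag →
    decidable-stable (meets? Z p w) λ ¬m → ¬h λ _ → lose w∈ (ag , ¬m)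

  -- Continue `v` along `p` to `w`, then `w` along `q` to `w′`. A coordinate of `w′` outside `q`
  -- avoids `Z` by the second choice; one in `q` but outside `p` is inherited from `w` and avoids
  -- `Z` by the first.
  kernels-∩ : ∀ {𝓥} p q → AllKernels 𝓥 p → AllKernels 𝓥 q → AllKernels 𝓥 (p ∩ q)
  kernels-∩ p q Kp Kq = All.map (λ {v} → inner {v}) Kp
    where
    inner : ∀ {v} → Kernel _ p v → Kernel _ (p ∩ q) v
    inner {v} Kv Z le with find (Kv Z le)
    ... | w , w∈ , ag , ¬m with find (All.lookup Kq w∈ Z le)
    ... | w′ , w′∈ , ag′ , ¬m′ = lose w′∈ (agree , avoid)
      where
      agree : Agree (p ∩ q) v w′
      agree i i∈ = let i∈p , i∈q = Sub.x∈p∩q⁻ p q i∈ in trans (ag i i∈p) (ag′ i i∈q)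
      avoid : ¬ Meets Z (p ∩ q) w′
      avoid (i , i∉ , hit) with i Sub.∈? q
      ... | no i∉q = ¬m′ (i , i∉q , hit)
      ... | yes i∈q = ¬m (i , (λ i∈p → i∉ (Sub.x∈p∩q⁺ (i∈p , i∈q))) , subst (_∈ₛ Z) (sym (ag′ i i∈q)) hit)

  -- Blocking is demanded for all nonempty subfamilies `S` that agree on `p`, which makes the
  -- property pass to sublists.
  Sparse : List Word → Subset k → Set
  Sparse 𝓥 p = ∀ S v → (∀ {w} → w ∈ S → w ∈ 𝓥) → v ∈ S → (∀ {w} → w ∈ S → Agree p v w) →
    ∃[ Z ] ∣ Z ∣ ≤ z × (∀ {w} → w ∈ S → Meets Z p w)

  sparse-⊆ : ∀ {𝓥 𝓦 p} → (∀ {w} → w ∈ 𝓦 → w ∈ 𝓥) → Sparse 𝓥 p → Sparse 𝓦 p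
  sparse-⊆ sub sp S v S⊆ = sp S v (sub ∘ S⊆)

  -- A subfamily containing `v` is blocked by the set that blocks `v` in the larger list `𝓥`; one
  -- without `v` lies in `𝓓`.
  sparse-∷ : ∀ {𝓥 𝓓 p v} → v ∈ 𝓥 → (∀ {w} → w ∈ 𝓓 → w ∈ 𝓥) → Blocked 𝓥 p v → Sparse 𝓓 p → Sparse (v ∷ 𝓓) p
  sparse-∷ {𝓥} {𝓓} {p} {v} v∈ sub (Z , le , block) sp S u S⊆ u∈ ag with Any.any? (v ≟ᵥ_) S
  ... | yes v∈S = Z , le , λ {w} w∈ → block (into (S⊆ w∈)) (agree-trans {p = p} v u w (agree-sym {p = p} u v (ag v∈S)) (ag w∈))
    where
    into : ∀ {w} → w ∈ v ∷ 𝓓 → w ∈ 𝓥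
    into (here refl) = v∈
    into (there q) = sub q
  ... | no v∉S = sp S u S⊆𝓓 u∈ ag
    where
    S⊆𝓓 : ∀ {w} → w ∈ S → w ∈ 𝓓
    S⊆𝓓 w∈ with S⊆ w∈
    ... | here refl = contradiction w∈ v∉S
    ... | there q = q

  record Split (σ : List (Subset k)) (𝓥 : List Word) : Set where
    field
      kept     : List Word
      rest     : Subset k → List Word
      kept⊆    : ∀ {v} → v ∈ kept → v ∈ 𝓥
      rest⊆    : ∀ {p v} → v ∈ rest p → v ∈ 𝓥
      unique-kept : Unique kept
      unique-rest : ∀ p → Unique (rest p)
      covers   : ∀ {v} → v ∈ 𝓥 → v ∈ kept ⊎ (∃[ p ] p ∈ σ × v ∈ rest p)
      kept-kernels : ∀ {p} → p ∈ σ → AllKernels kept p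
      rest-sparse : ∀ p → Sparse (rest p) p

  -- Words are peeled off one at a time, each filed under a pattern of `σ` that is not a kernel for
  -- it. A word peeled off early was blocked in a list containing all later ones, so it can be put
  -- in front of them by `sparse-∷`.
  split : ∀ σ m 𝓥 → length 𝓥 ≤ m → Unique 𝓥 → Split σ 𝓥
  split σ m 𝓥 le u with All.all? (λ p → allKernels? 𝓥 p) σ
  ... | yes h = record
    { kept = 𝓥 ; rest = λ _ → [] ; kept⊆ = id ; rest⊆ = λ () ; unique-kept = u
    ; unique-rest = λ _ → [] ; covers = inj₁ ; kept-kernels = All.lookup h
    ; rest-sparse = λ p S v S⊆ v∈ → contradiction (S⊆ v∈) λ () }
  ... | no ¬h with find (¬All⇒Any¬ (λ p → allKernels? 𝓥 p) σ ¬h)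
  ... | p₀ , p₀∈ , ¬Kp with find (¬All⇒Any¬ (kernel? 𝓥 p₀) 𝓥 ¬Kp)
  split σ zero (_ ∷ _) () u | no ¬h | p₀ , p₀∈ , ¬Kp | v₀ , v₀∈ , ¬K
  split σ (suc m) 𝓥 le u | no ¬h | p₀ , p₀∈ , ¬Kp | v₀ , v₀∈ , ¬K = record
    { kept = kept ; rest = rest′ ; kept⊆ = 𝓥′⊆ ∘ kept⊆ ; rest⊆ = λ {p} → rest′⊆ p
    ; unique-kept = unique-kept ; unique-rest = unique-rest′ ; covers = covers′
    ; kept-kernels = kept-kernels ; rest-sparse = rest′-sparse }
    where
    ≢v₀? : ∀ w → Dec (w ≢ v₀)
    ≢v₀? w = ¬? (w ≟ᵥ v₀)
    𝓥′ : List Word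
    𝓥′ = filter ≢v₀? 𝓥
    𝓥′⊆ : ∀ {v} → v ∈ 𝓥′ → v ∈ 𝓥
    𝓥′⊆ v∈ = proj₁ (∈-filter⁻ ≢v₀? {xs = 𝓥} v∈)
    open Split (split σ m 𝓥′
      (ℕ.s≤s⁻¹ (≤-trans (filter-length-< ≢v₀? v₀∈ (λ h → h refl)) le)) (Unique.filter⁺ ≢v₀? u))
    rest′ : Subset k → List Word
    rest′ p with p ≟ₛ p₀
    ... | yes _ = v₀ ∷ rest p
    ... | no _ = rest p
    rest′⊆ : ∀ p {v} → v ∈ rest′ p → v ∈ 𝓥
    rest′⊆ p v∈ with p ≟ₛ p₀
    rest′⊆ p (here refl) | yes _ = v₀∈
    rest′⊆ p (there v∈) | yes _ = 𝓥′⊆ (rest⊆ v∈)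
    ... | no _ = 𝓥′⊆ (rest⊆ v∈)
    unique-rest′ : ∀ p → Unique (rest′ p)
    unique-rest′ p with p ≟ₛ p₀
    ... | yes _ = ∉⇒All≢ (λ v₀∈rest → proj₂ (∈-filter⁻ ≢v₀? {xs = 𝓥} (rest⊆ v₀∈rest)) refl) ∷ unique-rest p
    ... | no _ = unique-rest p
    rest′-grows : ∀ p {v} → v ∈ rest p → v ∈ rest′ p
    rest′-grows p v∈ with p ≟ₛ p₀
    ... | yes _ = there v∈
    ... | no _ = v∈
    v₀∈rest′ : v₀ ∈ rest′ p₀
    v₀∈rest′ with p₀ ≟ₛ p₀
    ... | yes _ = here refl
    ... | no ≢ = contradiction refl ≢
    covers′ : ∀ {v} → v ∈ 𝓥 → v ∈ kept ⊎ (∃[ p ] p ∈ σ × v ∈ rest′ p)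
    covers′ {v} v∈ with v ≟ᵥ v₀
    ... | yes refl = inj₂ (p₀ , p₀∈ , v₀∈rest′)
    ... | no ≢ with covers (∈-filter⁺ ≢v₀? v∈ ≢)
    ... | inj₁ q = inj₁ q
    ... | inj₂ (p , p∈ , q) = inj₂ (p , p∈ , rest′-grows p q)
    rest′-sparse : ∀ p → Sparse (rest′ p) p
    rest′-sparse p with p ≟ₛ p₀
    ... | yes refl = sparse-∷ v₀∈ (𝓥′⊆ ∘ rest⊆) (¬kernel⇒blocked 𝓥 p₀ v₀ ¬K) (rest-sparse p₀)
    ... | no _ = rest-sparse p

  Homogeneous : List Word → Set
  Homogeneous 𝓟 = ∀ p → AllKernels 𝓟 p ⊎ Sparse 𝓟 p

  collect : {A : Set} {P : A → Word → Set} {Fine : Word → Set} {c : ℕ} (xs : List A) →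
    (∀ {x} → x ∈ xs → ∃[ bad ] length bad ≤ c × (∀ {v} → P x v → v ∈ bad ⊎ Fine v)) →
    ∃[ bad ] length bad ≤ length xs * c × (∀ {x v} → x ∈ xs → P x v → v ∈ bad ⊎ Fine v)
  collect [] h = [] , z≤n , λ ()
  collect {P = P} {Fine} (x ∷ xs) h
    with h (here refl) | collect {P = P} xs (h ∘ there)
  ... | b₁ , le₁ , c₁ | b₂ , le₂ , c₂ =
    b₁ ++ b₂ , ≤-trans (≤-reflexive (length-++ b₁)) (+-mono-≤ le₁ le₂) , covers
    where
    covers : ∀ {y v} → y ∈ x ∷ xs → P y v → v ∈ b₁ ++ b₂ ⊎ Fine v
    covers (here refl) Pv = [ inj₁ ∘ ∈-++⁺ˡ , inj₂ ]′ (c₁ Pv)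
    covers (there y∈) Pv = [ inj₁ ∘ ∈-++⁺ʳ b₁ , inj₂ ]′ (c₂ y∈ Pv)

  module Decompose (𝓥₀ : List Word) (Fine : Word → Set) (B : ℕ)
    (small-or-fine : ∀ 𝓟 → Unique 𝓟 → (∀ {v} → v ∈ 𝓟 → v ∈ 𝓥₀) → Homogeneous 𝓟 →
                     length 𝓟 ≤ B ⊎ (∀ {v} → v ∈ 𝓟 → Fine v)) where

    exceptions₁ : ∀ 𝓟 → Unique 𝓟 → (∀ {v} → v ∈ 𝓟 → v ∈ 𝓥₀) → Homogeneous 𝓟 →
      ∃[ bad ] length bad ≤ B × (∀ {v} → v ∈ 𝓟 → v ∈ bad ⊎ Fine v)
    exceptions₁ 𝓟 u sub hom with small-or-fine 𝓟 u sub hom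
    ... | inj₁ le = 𝓟 , le , inj₁
    ... | inj₂ fine = [] , z≤n , inj₂ ∘ fine

    -- `σ` lists the patterns not yet known to be sparse. The kept part is homogeneous; each
    -- `rest p` is sparse at `p`, so it is treated with `p` removed from `σ`.
    exceptions : ∀ m σ 𝓥 → length σ ≤ m → Unique 𝓥 → (∀ {v} → v ∈ 𝓥 → v ∈ 𝓥₀) →
      (∀ p → p ∈ σ ⊎ Sparse 𝓥 p) →
      ∃[ bad ] length bad ≤ pieces m * B × (∀ {v} → v ∈ 𝓥 → v ∈ bad ⊎ Fine v)
    exceptions zero [] 𝓥 le u sub cases = let bad , le , h = exceptions₁ 𝓥 u sub hom in
      bad , ≤-trans le (≤-reflexive (sym (*-identityˡ B))) , h
      where
      hom : Homogeneous 𝓥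
      hom p with cases p
      ... | inj₂ s = inj₂ s
    exceptions (suc m) σ 𝓥 le u sub cases
      with exceptions₁ kept unique-kept (sub ∘ kept⊆) hom
         | collect {P = λ p v → v ∈ rest p} σ part
      where
      open Split (split σ (length 𝓥) 𝓥 ≤-refl u)
      hom : Homogeneous kept
      hom p with cases p
      ... | inj₁ p∈ = inj₁ (kept-kernels p∈)
      ... | inj₂ s = inj₂ (sparse-⊆ kept⊆ s)
      part : ∀ {p} → p ∈ σ → ∃[ bad ] length bad ≤ pieces m * B × (∀ {v} → v ∈ rest p → v ∈ bad ⊎ Fine v)
      part {p} p∈ = exceptions m σ′ (rest p) le′ (unique-rest p) (sub ∘ rest⊆) cases′
        where
        ≢p? : ∀ q → Dec (q ≢ p)
        ≢p? q = ¬? (q ≟ₛ p)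
        σ′ : List (Subset k)
        σ′ = filter ≢p? σ
        le′ : length σ′ ≤ m
        le′ = ℕ.s≤s⁻¹ (≤-trans (filter-length-< ≢p? p∈ λ h → h refl) le)
        cases′ : ∀ q → q ∈ σ′ ⊎ Sparse (rest p) q
        cases′ q with q ≟ₛ p
        ... | yes refl = inj₂ (rest-sparse p)
        ... | no q≢p with cases q
        ... | inj₁ q∈ = inj₁ (∈-filter⁺ ≢p? q∈ q≢p)
        ... | inj₂ s = inj₂ (sparse-⊆ rest⊆ s)
    ... | b₁ , le₁ , h₁ | b₂ , le₂ , h₂ = b₁ ++ b₂ , size , covers′
      where
      open Split (split σ (length 𝓥) 𝓥 ≤-refl u)
      size : length (b₁ ++ b₂) ≤ pieces (suc m) * B
      size = begin
        length (b₁ ++ b₂) ≡⟨ length-++ b₁ ⟩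
        length b₁ + length b₂ ≤⟨ +-mono-≤ le₁ (≤-trans le₂ (*-monoˡ-≤ (pieces m * B) le)) ⟩
        B + suc m * (pieces m * B) ≡⟨ cong (B +_) (sym (*-assoc (suc m) (pieces m) B)) ⟩
        pieces (suc m) * B ∎
        where open ≤-Reasoning
      covers′ : ∀ {v} → v ∈ 𝓥 → v ∈ b₁ ++ b₂ ⊎ Fine v
      covers′ v∈ with covers v∈
      ... | inj₁ q = [ inj₁ ∘ ∈-++⁺ˡ , inj₂ ]′ (h₁ q)
      ... | inj₂ (p , p∈ , q) = [ inj₁ ∘ ∈-++⁺ʳ b₁ , inj₂ ]′ (h₂ p∈ q)

  -- There are at most `k * z` choices of a coordinate and a value in the blocking set; the
  -- successor keeps the powers positive.
  branching : ℕ
  branching = suc (k * z)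

  -- A blocking set offers at most z values for one of at most k further coordinates.
  sparse-fibre : ∀ {𝓟} (T : Subset k) → (∀ q → T ⊆ₛ q → q ≢ Subset.⊤ → Sparse 𝓟 q) →
    ∀ m q S → T ⊆ₛ q → k ≤ m + ∣ q ∣ → Unique S → (∀ {v} → v ∈ S → v ∈ 𝓟) →
    (∀ {u v} → u ∈ S → v ∈ S → Agree q u v) → length S ≤ branching ^ m
  sparse-fibre T sp zero q S T⊆ le u sub ag = at-most-one S u λ {v} {w} v∈ w∈ →
    word-ext λ i → ag v∈ w∈ i (subst (i ∈ₛ_) (sym (Sub.∣p∣≡n⇒p≡⊤ (≤-antisym (Sub.∣p∣≤n q) le))) Sub.∈⊤)
    where
    at-most-one : (xs : List Word) → Unique xs → (∀ {v w} → v ∈ xs → w ∈ xs → v ≡ w) → length xs ≤ 1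
    at-most-one [] _ _ = z≤n
    at-most-one (x ∷ []) _ _ = ≤-refl
    at-most-one (x ∷ y ∷ xs) ((x≢y ∷ _) ∷ _) h = contradiction (h (here refl) (there (here refl))) x≢y
  sparse-fibre T sp (suc m) q [] T⊆ le u sub ag = z≤n
  sparse-fibre {𝓟} T sp (suc m) q S@(v₀ ∷ _) T⊆ le u sub ag with q ≟ₛ Subset.⊤
  ... | yes refl = ≤-trans (sparse-fibre T sp zero q S T⊆ (≤-reflexive (sym (Sub.∣⊤∣≡n k))) u sub ag)
    (*-mono-≤ {1} {branching} (s≤s z≤n) (m^n>0 branching m))
  ... | no q≢⊤ with sp q T⊆ q≢⊤ S v₀ sub (here refl) (ag (here refl))
  ... | Z , Z≤ , hit = begin
    length S ≤⟨ length-cover g u covering small ⟩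
    length choices * branching ^ m ≤⟨ *-monoˡ-≤ (branching ^ m) choices≤ ⟩
    branching * branching ^ m ∎
    where
    open ≤-Reasoning
    choices : List (Fin k × Fin n)
    choices = cartesianProduct (allFin k) (toList Z)
    choices≤ : length choices ≤ branching
    choices≤ = begin
      length choices ≡⟨ length-cartesianProductWith _,_ (allFin k) (toList Z) ⟩
      length (allFin k) * length (toList Z) ≡⟨ cong₂ _*_ (length-allFin k) (length-toList Z) ⟩
      k * ∣ Z ∣ ≤⟨ *-monoʳ-≤ k Z≤ ⟩
      k * z ≤⟨ n≤1+n _ ⟩
      branching ∎
    g? : ∀ c v → Dec (proj₁ c ∉ₛ q × lookup v (proj₁ c) ≡ proj₂ c)
    g? (i , y) v = ¬? (i Sub.∈? q) ×-dec (lookup v i Fin.≟ y)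
    g : Fin k × Fin n → List Word
    g c = filter (g? c) S
    covering : ∀ {v} → v ∈ S → ∃[ c ] c ∈ choices × v ∈ g c
    covering {v} v∈ = let i , i∉ , i∈Z = hit v∈ in
      (i , lookup v i) , ∈-cartesianProduct⁺ (∈-allFin i) (∈-toList⁺ i∈Z) , ∈-filter⁺ (g? (i , lookup v i)) v∈ (i∉ , refl)
    small : ∀ {c} → c ∈ choices → length (g c) ≤ branching ^ m
    small {i , y} _ with g (i , y) in eq
    ... | [] = z≤n
    ... | w ∷ ws = subst (λ l → length l ≤ branching ^ m) eq
      (sparse-fibre T sp m (q ∪ ⁅ i ⁆) (g (i , y)) (Sub.p⊆p∪q ⁅ i ⁆ ∘ T⊆) bigger
        (Unique.filter⁺ (g? (i , y)) u) (sub ∘ proj₁ ∘ split-mem) agrees)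
      where
      split-mem : ∀ {v} → v ∈ g (i , y) → v ∈ S × (i ∉ₛ q × lookup v i ≡ y)
      split-mem = ∈-filter⁻ (g? (i , y)) {xs = S}
      i∉ : i ∉ₛ q
      i∉ = proj₁ (proj₂ (split-mem (subst (w ∈_) (sym eq) (here refl))))
      bigger : k ≤ m + ∣ q ∪ ⁅ i ⁆ ∣
      bigger = ≤-trans le (≤-trans (≤-reflexive (sym (+-suc m ∣ q ∣)))
        (+-monoʳ-≤ m (Sub.p⊂q⇒∣p∣<∣q∣ (Sub.p⊆p∪q ⁅ i ⁆ , i , Sub.x∈p∪q⁺ (inj₂ (Sub.x∈⁅x⁆ i)) , i∉))))
      agrees : ∀ {a b} → a ∈ g (i , y) → b ∈ g (i , y) → Agree (q ∪ ⁅ i ⁆) a b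
      agrees a∈ b∈ j j∈ with Sub.x∈p∪q⁻ q ⁅ i ⁆ j∈ | split-mem a∈ | split-mem b∈
      ... | inj₁ j∈q | a∈S , _ | b∈S , _ = ag a∈S b∈S j j∈q
      ... | inj₂ j∈i | _ , _ , ea | _ , _ , eb with refl ← Sub.x∈⁅y⁆⇒x≡y i j∈i = trans ea (sym eb)

  -- Only the coordinates in `T` are free; the others are then chosen successively from blocking
  -- sets of bounded size.
  sparse-length : ∀ {𝓟} (T : Subset k) → Unique 𝓟 → (∀ q → T ⊆ₛ q → q ≢ Subset.⊤ → Sparse 𝓟 q) →
    length 𝓟 ≤ n ^ ∣ T ∣ * branching ^ k
  sparse-length {𝓟} T u sp = subst (λ l → length 𝓟 ≤ l * branching ^ k) (length-allWords n ∣ T ∣)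
    (length-cover g u (λ {v} v∈ → restrict T v , ∈-allWords _ , ∈-filter⁺ (g? (restrict T v)) v∈ refl)
      λ {w} _ → sparse-fibre T sp k T (g w) id (m≤m+n k _) (Unique.filter⁺ (g? w) u) (proj₁ ∘ mem)
        λ {a} {b} a∈ b∈ → restrict-agree T a b (trans (proj₂ (mem a∈)) (sym (proj₂ (mem b∈)))))
    where
    g? : ∀ w v → Dec (restrict T v ≡ w)
    g? w v = restrict T v ≟ᵥ w
    g : Vec (Fin n) ∣ T ∣ → List Word
    g w = filter (g? w) 𝓟
    mem : ∀ {w v} → v ∈ g w → v ∈ 𝓟 × restrict T v ≡ w
    mem {w} = ∈-filter⁻ (g? w) {xs = 𝓟}

-- Kernels

set-≡ : {n : ℕ} (xs ys : List (Fin n)) → (∀ {x} → x ∈ xs → x ∈ ys) → (∀ {x} → x ∈ ys → x ∈ xs) → set xs ≡ set ys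
set-≡ xs ys f g = set-cong (∈-set⁺ ∘ f) (g ∘ ∈-set⁻ ys)

∈-⋂⁺ : {n : ℕ} {x : Fin n} (ps : List (Subset n)) → (∀ {p} → p ∈ ps → x ∈ₛ p) → x ∈ₛ Subset.⋂ ps
∈-⋂⁺ [] _ = Sub.∈⊤
∈-⋂⁺ (p ∷ ps) h = Sub.x∈p∩q⁺ (h (here refl) , ∈-⋂⁺ ps (h ∘ there))

∈-⋂⁻ : {n : ℕ} {x : Fin n} (ps : List (Subset n)) {p : Subset n} → x ∈ₛ Subset.⋂ ps → p ∈ ps → x ∈ₛ p
∈-⋂⁻ (q ∷ ps) x∈ (here refl) = proj₁ (Sub.x∈p∩q⁻ q (Subset.⋂ ps) x∈)
∈-⋂⁻ (q ∷ ps) x∈ (there p∈) = ∈-⋂⁻ ps (proj₂ (Sub.x∈p∩q⁻ q (Subset.⋂ ps) x∈)) p∈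

∁-involutive : {n : ℕ} (p : Subset n) → Subset.∁ (Subset.∁ p) ≡ p
∁-involutive p = Sub.⊆-antisym
  (λ x∈ → Sub.x∉∁p⇒x∈p (Sub.x∈∁p⇒x∉p x∈)) (λ x∈ → Sub.x∉p⇒x∈∁p (Sub.x∈p⇒x∉∁p x∈))

∁-∪ : {n : ℕ} (p q : Subset n) → Subset.∁ p ∩ Subset.∁ q ≡ Subset.∁ (p ∪ q)
∁-∪ p q = Sub.⊆-antisym
  (λ x∈ → let a , b = Sub.x∈p∩q⁻ (Subset.∁ p) (Subset.∁ q) x∈ in
    Sub.x∉p⇒x∈∁p λ x∈∪ → [ Sub.x∈∁p⇒x∉p a , Sub.x∈∁p⇒x∉p b ]′ (Sub.x∈p∪q⁻ p q x∈∪))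
  (λ x∈ → Sub.x∈p∩q⁺ (Sub.x∉p⇒x∈∁p (λ a → Sub.x∈∁p⇒x∉p x∈ (Sub.x∈p∪q⁺ (inj₁ a))) ,
                       Sub.x∉p⇒x∈∁p (λ b → Sub.x∈∁p⇒x∉p x∈ (Sub.x∈p∪q⁺ (inj₂ b)))))

-- `2 ^ k` is the number of patterns, and `suc (k * (s * k))` is `branching` for `z = s * k`.
exception-constant : ℕ → ℕ → ℕ
exception-constant s k = pieces (2 ^ k) * suc (k * (s * k)) ^ k

-- A kernel plays the role of the core of a large sunflower.
module Kernels (n d k : ℕ) (1≤d : 1 ≤ d) (5≤k : 5 ≤ k) (𝓕 : Family n) (admissible : Admissible (suc d) k 𝓕) where

  s : ℕ
  s = suc d

  -- The `s` sets of a star have at most `k` points each, so all their points together may be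
  -- prescribed as points to avoid.
  z : ℕ
  z = s * k

  ∣F∣≡k : ∀ {F} → F ∈ 𝓕 → ∣ F ∣ ≡ k
  ∣F∣≡k = All.lookup (proj₂ (proj₁ admissible))

  Extends : Subset n → Subset n → Subset n → Set
  Extends K Z F = K ⊆ₛ F × F ∩ Z ⊆ₛ K

  extends? : ∀ K Z F → Dec (Extends K Z F)
  extends? K Z F = (K Sub.⊆? F) ×-dec ((F ∩ Z) Sub.⊆? K)

  IsKernel : Subset n → Set
  IsKernel K = ∀ Z → ∣ Z ∣ ≤ z → Any (Extends K Z) 𝓕

  isKernel? : ∀ K → Dec (IsKernel K)
  isKernel? K = all-subsets? λ Z → (∣ Z ∣ ≤? z) →-dec Any.any? (extends? K Z) 𝓕

  ¬kernel⇒blocking : ∀ K → ¬ IsKernel K → ∃[ Z ] ∣ Z ∣ ≤ z × (∀ {F} → F ∈ 𝓕 → ¬ Extends K Z F)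
  ¬kernel⇒blocking K ¬K with ¬∀⇒∃¬-subset (λ Z → (∣ Z ∣ ≤? z) →-dec Any.any? (extends? K Z) 𝓕) ¬K
  ... | Z , ¬h = Z , decidable-stable (∣ Z ∣ ≤? z) (λ ≰ → ¬h λ le → contradiction le ≰) ,
    λ F∈ ext → ¬h λ _ → lose F∈ ext

  member-kernel : ∀ {F} → F ∈ 𝓕 → IsKernel F
  member-kernel {F} F∈ Z _ = lose F∈ (id , λ x∈ → proj₁ (Sub.x∈p∩q⁻ F Z x∈))

  kernel-size : ∀ {K} → IsKernel K → ∣ K ∣ ≤ k
  kernel-size {K} h with find (h Subset.⊥ (≤-trans (≤-reflexive (Sub.∣⊥∣≡0 n)) z≤n))
  ... | F , F∈ , K⊆F , _ = ≤-trans (Sub.p⊆q⇒∣p∣≤∣q∣ K⊆F) (≤-reflexive (∣F∣≡k F∈))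

  record Star (x : Fin n) (K : Fin s → Subset n) : Set where
    field
      kernels : ∀ i → IsKernel (K i)
      center  : ∀ i → x ∈ₛ K i
      meet    : ∀ {i j y} → i ≢ j → y ∈ₛ K i → y ∈ₛ K j → y ≡ x

  -- The members are distinct, since two equal ones would lie inside their intersection, a single
  -- point. Two different indices, available as `1 ≤ d`, confine the core to `x`.
  star-in-𝓕 : ∀ x S → Star x S → ¬ (∀ i → S i ∈ 𝓕)
  star-in-𝓕 x S star S∈ = proj₂ admissible (S , S∈ , (inj , λ i j i≢j → trans (S∩S i≢j) (sym core≡)) ,
    trans (cong ∣_∣ core≡) (Sub.∣⁅x⁆∣≡1 x))
    where
    open Star star
    core≡ : core S ≡ ⁅ x ⁆
    core≡ = Sub.⊆-antisym
      (λ {y} y∈ → subst (_∈ₛ ⁅ x ⁆) (sym (meet {zero} {suc (Fin.fromℕ< 1≤d)} (λ ())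
        (∈-⋂⁻ (List.tabulate S) y∈ (∈-tabulate⁺ {f = S} zero)) (∈-⋂⁻ (List.tabulate S) y∈ (∈-tabulate⁺ {f = S} (suc (Fin.fromℕ< 1≤d)))))) (Sub.x∈⁅x⁆ x))
      (λ {y} y∈ → ∈-⋂⁺ (List.tabulate S) λ p∈ → let i , e = ∈-tabulate⁻ {f = S} p∈ in
        subst₂ _∈ₛ_ (sym (Sub.x∈⁅y⁆⇒x≡y x y∈)) (sym e) (center i))
    S∩S : ∀ {i j} → i ≢ j → S i ∩ S j ≡ ⁅ x ⁆
    S∩S {i} {j} i≢j = Sub.⊆-antisym
      (λ {y} y∈ → let p , q = Sub.x∈p∩q⁻ (S i) (S j) y∈ in subst (_∈ₛ ⁅ x ⁆) (sym (meet i≢j p q)) (Sub.x∈⁅x⁆ x))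
      (λ {y} y∈ → subst (_∈ₛ S i ∩ S j) (sym (Sub.x∈⁅y⁆⇒x≡y x y∈)) (Sub.x∈p∩q⁺ (center i , center j)))
    inj : ∀ {i j} → S i ≡ S j → i ≡ j
    inj {i} {j} e = decidable-stable (i Fin.≟ j) λ i≢j → <⇒≱ (≤-trans (s≤s (s≤s z≤n)) 5≤k)
      (≤-trans (≤-reflexive (sym (∣F∣≡k (S∈ i)))) (≤-trans
        (Sub.p⊆q⇒∣p∣≤∣q∣ (λ {y} y∈ → subst (y ∈ₛ_) (S∩S i≢j) (Sub.x∈p∩q⁺ (y∈ , subst (y ∈ₛ_) e y∈))))
        (≤-reflexive (Sub.∣⁅x⁆∣≡1 x))))

  -- The kernels are replaced one by one by members of `𝓕`. `Z` consists of all points of the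
  -- current sets, including the one being replaced, so the new member meets the others only where
  -- the old one did.
  no-star : ∀ x K → ¬ Star x K
  no-star x K star = let S , star′ , S∈ = fill s ≤-refl in star-in-𝓕 x S star′ λ i → S∈ i (Fin.toℕ<n i)
    where
    fill : ∀ m → m ≤ s → ∃[ S ] Star x S × (∀ i → toℕ i < m → S i ∈ 𝓕)
    fill zero _ = K , star , λ _ ()
    fill (suc m) m<s with fill m (<⇒≤ m<s)
    ... | S , starS , S∈ with find (Star.kernels starS (Fin.fromℕ< m<s) Z Z≤)
      where
      points : List (Fin n)
      points = concatMap (λ i → toList (S i)) (allFin s)
      Z : Subset n
      Z = set points
      Z≤ : ∣ Z ∣ ≤ z
      Z≤ = ≤-trans (∣∣≤length (∈-set⁻ points)) (≤-trans (≤-reflexive (length-concatMap (λ i → toList (S i)) (allFin s)))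
        (≤-trans (∑-≤-const (allFin s) λ {i} _ → ≤-trans (≤-reflexive (length-toList (S i))) (kernel-size (Star.kernels starS i)))
          (≤-reflexive (cong (_* k) (length-allFin s)))))
    ... | F , F∈ , Si⊆F , F∩Z⊆ = S′ , record { kernels = kernels′ ; center = center′ ; meet = meet′ } , S′∈
      where
      open Star starS
      i : Fin s
      i = Fin.fromℕ< m<s
      S′ : Fin s → Subset n
      S′ j with j Fin.≟ i
      ... | yes _ = F
      ... | no _ = S j
      kernels′ : ∀ j → IsKernel (S′ j)
      kernels′ j with j Fin.≟ i
      ... | yes _ = member-kernel F∈
      ... | no _ = kernels j
      center′ : ∀ j → x ∈ₛ S′ j
      center′ j with j Fin.≟ i
      ... | yes _ = Si⊆F (center i)
      ... | no _ = center j
      F-meet : ∀ {j y} → j ≢ i → y ∈ₛ F → y ∈ₛ S j → y ≡ x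
      F-meet {j} j≢i y∈F y∈ = meet j≢i y∈ (F∩Z⊆ (Sub.x∈p∩q⁺ (y∈F ,
        ∈-set⁺ (∈-concatMap-intro (λ i → toList (S i)) (∈-allFin j) (∈-toList⁺ y∈)))))
      meet′ : ∀ {a b y} → a ≢ b → y ∈ₛ S′ a → y ∈ₛ S′ b → y ≡ x
      meet′ {a} {b} a≢b y∈a y∈b with a Fin.≟ i | b Fin.≟ i
      ... | yes refl | yes refl = contradiction refl a≢b
      ... | yes _ | no b≢i = F-meet b≢i y∈a y∈b
      ... | no a≢i | yes _ = F-meet a≢i y∈b y∈a
      ... | no _ | no _ = meet a≢b y∈a y∈b
      S′∈ : ∀ j → toℕ j < suc m → S′ j ∈ 𝓕
      S′∈ j j<1+m with j Fin.≟ i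
      ... | yes _ = F∈
      ... | no j≢i = S∈ j (≤∧≢⇒< (ℕ.s≤s⁻¹ j<1+m) λ e → j≢i (Fin.toℕ-injective (trans e (sym (Fin.toℕ-fromℕ< m<s)))))

  -- The sets of a star need not be distinct: `s` copies of the same one-point kernel form one.
  no-singleton-kernel : ∀ x → ¬ IsKernel (set (x ∷ []))
  no-singleton-kernel x h = no-star x (λ _ → set (x ∷ [])) record
    { kernels = λ _ → h ; center = λ _ → ∈-set⁺ (here refl)
    ; meet = λ { _ y∈ _ → case (∈-set⁻ (x ∷ []) y∈) } }
    where
    case : ∀ {y} → y ∈ x ∷ [] → y ≡ x
    case (here e) = e

  pair : Fin n → Fin n → Subset n
  pair a b = set (a ∷ b ∷ [])

  triple : Fin n → Fin n → Fin n → Subset n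
  triple a b x = set (a ∷ b ∷ x ∷ [])

  pair-sym : ∀ a b → pair a b ≡ pair b a
  pair-sym a b = set-≡ (a ∷ b ∷ []) (b ∷ a ∷ []) flip flip
    where
    flip : ∀ {a b x} → x ∈ a ∷ b ∷ [] → x ∈ b ∷ a ∷ []
    flip (here e) = there (here e)
    flip (there (here e)) = here e

  triple-sym : ∀ a b x → triple a b x ≡ triple b a x
  triple-sym a b x = set-≡ (a ∷ b ∷ x ∷ []) (b ∷ a ∷ x ∷ []) flip flip
    where
    flip : ∀ {a b y} → y ∈ a ∷ b ∷ x ∷ [] → y ∈ b ∷ a ∷ x ∷ []
    flip (here e) = there (here e)
    flip (there (here e)) = here e
    flip (there (there e)) = there (there e)

  -- The kernel pairs bound the degrees, through stars centered at an end of the edges; the kernel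
  -- triples bound the matchings, through stars centered at `x`.
  link : Fin n → DecGraph n
  link x = record
    { Edge = λ a b → a ≢ b × a ≢ x × b ≢ x × IsKernel (pair a b) × IsKernel (triple a b x)
    ; edge? = λ a b → ¬? (a Fin.≟ b) ×-dec ¬? (a Fin.≟ x) ×-dec ¬? (b Fin.≟ x) ×-dec
        isKernel? (pair a b) ×-dec isKernel? (triple a b x)
    ; symm = λ {a} {b} (a≢b , a≢x , b≢x , p , t) →
        a≢b ∘ sym , b≢x , a≢x , subst IsKernel (pair-sym a b) p , subst IsKernel (triple-sym a b x) t
    ; irrefl = λ (a≢a , _) → a≢a refl }

  pair-meet : ∀ {a b b′ y} → b ≢ b′ → y ∈ₛ pair a b → y ∈ₛ pair a b′ → y ≡ a
  pair-meet {a} {b} {b′} b≢ p q = case (∈-set⁻ (a ∷ b ∷ []) p) (∈-set⁻ (a ∷ b′ ∷ []) q)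
    where
    case : ∀ {y} → y ∈ a ∷ b ∷ [] → y ∈ a ∷ b′ ∷ [] → y ≡ a
    case (here e) _ = e
    case (there (here _)) (here e) = e
    case (there (here refl)) (there (here e)) = contradiction e b≢

  link-degree : ∀ x a → DecGraph.degree (link x) a ≤ d
  link-degree x a = ≮⇒≥ λ lt →
    let b , b∈ , b-inj = select (unique-neighbours a) lt in
    no-star a (λ i → pair a (b i)) record
      { kernels = λ i → let _ , _ , _ , p , _ = ∈-neighbours⁻ (b∈ i) in p
      ; center = λ _ → ∈-set⁺ (here refl)
      ; meet = λ i≢j → pair-meet (i≢j ∘ b-inj) }
    where open DecGraph (link x)

  triple-meet : ∀ {M : Vec (Fin n) n} {a b x y} → (∀ t → lookup M (lookup M t) ≡ t) → a ≢ b →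
    a Fin.< lookup M a → b Fin.< lookup M b →
    y ∈ₛ triple a (lookup M a) x → y ∈ₛ triple b (lookup M b) x → y ≡ x
  triple-meet {M} {a} {b} {x} inv a≢b la lb p q =
    case (∈-set⁻ (a ∷ lookup M a ∷ x ∷ []) p) (∈-set⁻ (b ∷ lookup M b ∷ x ∷ []) q)
    where
    case : ∀ {y} → y ∈ a ∷ lookup M a ∷ x ∷ [] → y ∈ b ∷ lookup M b ∷ x ∷ [] → y ≡ x
    case (there (there (here e))) _ = e
    case _ (there (there (here e))) = e
    case (here refl) (here e) = contradiction e a≢b
    case (here refl) (there (here refl)) = contradiction (subst (lookup M b Fin.<_) (inv b) la) (<-asym lb)
    case (there (here refl)) (here refl) = contradiction (subst (lookup M a Fin.<_) (inv a) lb) (<-asym la)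
    case (there (here refl)) (there (here e)) =
      contradiction (trans (sym (inv a)) (trans (cong (lookup M) e) (inv b))) a≢b

  -- Disjoint edges {aᵢ, bᵢ} of the link of x give the star {aᵢ, bᵢ, x}.
  link-matching : ∀ x M → DecGraph.IsMatching (link x) M → cov M ≤ 2 * d
  link-matching x M (inv , edge) = ≤-trans (≤-reflexive (cov-even M inv)) (*-monoʳ-≤ 2 (≮⇒≥ λ lt →
    let a , a∈ , a-inj = select (unique-lower M) lt
        low : ∀ i → a i Fin.< lookup M (a i)
        low i = ∈-lower⁻ M (a∈ i)
    in no-star x (λ i → triple (a i) (lookup M (a i)) x) record
      { kernels = λ i → let _ , _ , _ , _ , t = edge (a i) (λ q → Fin.<-irrefl (sym q) (low i)) in t
      ; center = λ _ → ∈-set⁺ (there (there (here refl)))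
      ; meet = λ {i} {j} i≢j → triple-meet {M = M} inv (i≢j ∘ a-inj) (low i) (low j) }))

  link-two-cliques : ∀ x → length (DecGraph.arcs (link x)) ≤ (2 * d) * s ×
    ((2 * d) * s ≤ length (DecGraph.arcs (link x)) → TwoCliques (link x) s)
  link-two-cliques x = two-cliques d (link x) 1≤d (link-degree x) (link-matching x)

  open DeltaSystem n k z

  inj? : (v : Word) → Dec (Inj v)
  inj? v = Fin.all? λ i → Fin.all? λ j → (lookup v i Fin.≟ lookup v j) →-dec (i Fin.≟ j)

  represents? : (v : Word) → Dec (Inj v × range v ∈ 𝓕)
  represents? v = inj? v ×-dec Any.any? (range v ≟ₛ_) 𝓕

  𝓥₀ : List Word
  𝓥₀ = filter represents? (allWords n k)

  ∈-𝓥₀⁻ : ∀ {v} → v ∈ 𝓥₀ → Inj v × range v ∈ 𝓕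
  ∈-𝓥₀⁻ v∈ = proj₂ (∈-filter⁻ represents? {xs = allWords n k} v∈)

  Fine : Word → Set
  Fine v = ∃[ i ] ∃[ j ] i ≢ j × IsKernel (pair (lookup v i) (lookup v j)) ×
    (∀ l → IsKernel (triple (lookup v i) (lookup v j) (lookup v l)))

  -- A point of `range w` that lies in `Z` must sit at a coordinate in `p`, and there `w` agrees
  -- with `v`.
  word-kernel : ∀ {𝓟 p} v {K} → (∀ {v} → v ∈ 𝓟 → v ∈ 𝓥₀) → Kernel 𝓟 p v →
    (∀ i → i ∈ₛ p → lookup v i ∈ₛ K) → (∀ {x} → x ∈ₛ K → ∃[ i ] i ∈ₛ p × lookup v i ≡ x) → IsKernel K
  word-kernel {p = p} v {K} sub h into onto Z Z≤ with find (h Z Z≤)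
  ... | w , w∈ , ag , ¬meets = lose (proj₂ (∈-𝓥₀⁻ (sub w∈))) (K⊆ , ⊆K)
    where
    K⊆ : K ⊆ₛ range w
    K⊆ x∈ with i , i∈ , refl ← onto x∈ = subst (_∈ₛ range w) (sym (ag i i∈)) (∈-range⁺ w i)
    ⊆K : range w ∩ Z ⊆ₛ K
    ⊆K x∈ with Sub.x∈p∩q⁻ (range w) Z x∈
    ... | x∈w , x∈Z with ∈-range⁻ w x∈w
    ... | i , refl with i Sub.∈? p
    ... | yes i∈ = subst (_∈ₛ K) (ag i i∈) (into i i∈)
    ... | no i∉ = contradiction (i , i∉ , x∈Z) ¬meets

  word-kernel-set : ∀ {𝓟} v (is : List (Fin k)) → (∀ {v} → v ∈ 𝓟 → v ∈ 𝓥₀) → Kernel 𝓟 (set is) v →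
    IsKernel (set (map (lookup v) is))
  word-kernel-set v is sub h = word-kernel v sub h (λ i i∈ → ∈-set⁺ (∈-map⁺ (lookup v) (∈-set⁻ is i∈)))
    λ x∈ → let i , i∈ , e = ∈-map⁻ (lookup v) (∈-set⁻ (map (lookup v) is) x∈) in i , ∈-set⁺ i∈ , sym e

  B : ℕ
  B = n ^ (k ∸ 3) * branching ^ k

  covered-by-kernel? : ∀ 𝓟 T → Dec (∣ T ∣ ≡ k ∸ 3 → ∃[ p ] T ⊆ₛ p × p ≢ Subset.⊤ × AllKernels 𝓟 p)
  covered-by-kernel? 𝓟 T = (∣ T ∣ ℕ.≟ k ∸ 3) →-dec
    Sub.anySubset? λ p → (T Sub.⊆? p) ×-dec ¬? (p ≟ₛ Subset.⊤) ×-dec allKernels? 𝓟 p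

  -- `Co` satisfies the hypotheses of `UnionClosed`: kernel patterns are closed under intersection,
  -- a one-coordinate kernel pattern would give a one-point kernel, and the complement of any three
  -- coordinates has size `k - 3`. For the resulting two coordinates, every pattern containing both
  -- is a kernel.
  all-fine : ∀ 𝓟 {v₀} → v₀ ∈ 𝓟 → (∀ {v} → v ∈ 𝓟 → v ∈ 𝓥₀) →
    (∀ T → ∣ T ∣ ≡ k ∸ 3 → ∃[ p ] T ⊆ₛ p × p ≢ Subset.⊤ × AllKernels 𝓟 p) → ∀ {v} → v ∈ 𝓟 → Fine v
  all-fine 𝓟 {v₀} v₀∈ sub cover {v} v∈ = conclude two
    where
    Co : Subset k → Set
    Co c = AllKernels 𝓟 (Subset.∁ c)
    Co-∁ : ∀ p → AllKernels 𝓟 p → Co (Subset.∁ p)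
    Co-∁ p = subst (AllKernels 𝓟) (sym (∁-involutive p))
    Co-⊥ : Co Subset.⊥
    Co-⊥ = All.tabulate λ w∈ Z _ → lose w∈ ((λ _ _ → refl) , λ (i , i∉ , _) → i∉ (Sub.x∉p⇒x∈∁p Sub.∉⊥))
    Co-∪ : ∀ p q → Co p → Co q → Co (p ∪ q)
    Co-∪ p q Cop Coq = subst (AllKernels 𝓟) (∁-∪ p q) (kernels-∩ (Subset.∁ p) (Subset.∁ q) Cop Coq)
    no-co-singleton : ∀ x p → Co p → x ∉ₛ p → ¬ (∀ y → y ≢ x → y ∈ₛ p)
    no-co-singleton x p Cop x∉ all = no-singleton-kernel (lookup v₀ x)
      (word-kernel-set v₀ (x ∷ []) sub (subst (λ q → Kernel 𝓟 q v₀) (sym e) (All.lookup Cop v₀∈)))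
      where
      e : set (x ∷ []) ≡ Subset.∁ p
      e = set-cong (λ { (here refl) → Sub.x∉p⇒x∈∁p x∉ })
        λ {y} y∈ → here (decidable-stable (y Fin.≟ x) λ y≢x → Sub.x∈∁p⇒x∉p y∈ (all y y≢x))
    small-member : ∀ a b c → a ≢ b → a ≢ c → b ≢ c →
      ∃[ m ] Co m × (∃[ x ] x ∈ₛ m) × (∀ x → x ∈ₛ m → x ≡ a ⊎ x ≡ b ⊎ x ≡ c)
    small-member a b c a≢b a≢c b≢c with cover (Subset.∁ (set (a ∷ b ∷ c ∷ [])))
      (trans (Sub.∣∁p∣≡n∸∣p∣ (set (a ∷ b ∷ c ∷ []))) (cong (k ∸_) (∣set∣ ((a≢b ∷ a≢c ∷ []) ∷ (b≢c ∷ []) ∷ [] ∷ []))))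
    ... | p , T⊆p , p≢⊤ , h = Subset.∁ p , Co-∁ p h , nonempty , only
      where
      nonempty : ∃[ x ] x ∈ₛ Subset.∁ p
      nonempty = decidable-stable (Sub.nonempty? (Subset.∁ p)) λ empty →
        p≢⊤ (Sub.⊆-antisym Sub.⊆⊤ λ {x} _ → decidable-stable (x Sub.∈? p) λ x∉ → empty (x , Sub.x∉p⇒x∈∁p x∉))
      case : ∀ {x} → x ∈ a ∷ b ∷ c ∷ [] → x ≡ a ⊎ x ≡ b ⊎ x ≡ c
      case (here e) = inj₁ e
      case (there (here e)) = inj₂ (inj₁ e)
      case (there (there (here e))) = inj₂ (inj₂ e)
      only : ∀ x → x ∈ₛ Subset.∁ p → x ≡ a ⊎ x ≡ b ⊎ x ≡ c
      only x x∈ = case (∈-set⁻ (a ∷ b ∷ c ∷ []) (Sub.x∉∁p⇒x∈p λ x∈T → Sub.x∈∁p⇒x∉p x∈ (T⊆p x∈T)))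
    two : ∃[ p ] ∃[ q ] p ≢ q × (∀ m → p ∉ₛ m → q ∉ₛ m → Co m)
    two = UnionClosed.all-but-two-singletons 5≤k Co (λ c → allKernels? 𝓟 (Subset.∁ c))
      Co-⊥ Co-∪ no-co-singleton small-member
    conclude : ∃[ p ] ∃[ q ] p ≢ q × (∀ m → p ∉ₛ m → q ∉ₛ m → Co m) → Fine v
    conclude (p , q , p≢q , h) = p , q , p≢q ,
      word-kernel-set v (p ∷ q ∷ []) sub (kernel (p ∷ q ∷ []) (here refl) (there (here refl))) ,
      λ l → word-kernel-set v (p ∷ q ∷ l ∷ []) sub (kernel (p ∷ q ∷ l ∷ []) (here refl) (there (here refl)))
      where
      kernel : ∀ is → p ∈ is → q ∈ is → Kernel 𝓟 (set is) v
      kernel is p∈ q∈ = subst (λ π → Kernel 𝓟 π v) (∁-involutive (set is))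
        (All.lookup (h (Subset.∁ (set is)) (Sub.x∈p⇒x∉∁p (∈-set⁺ p∈)) (Sub.x∈p⇒x∉∁p (∈-set⁺ q∈))) v∈)

  -- If a `T` of size `k - 3` lies in no proper kernel pattern, homogeneity makes every proper
  -- pattern containing `T` sparse, and the words are determined by `T` up to a bounded factor.
  small-or-fine : ∀ 𝓟 → Unique 𝓟 → (∀ {v} → v ∈ 𝓟 → v ∈ 𝓥₀) → Homogeneous 𝓟 →
    length 𝓟 ≤ B ⊎ (∀ {v} → v ∈ 𝓟 → Fine v)
  small-or-fine 𝓟 u sub hom with all-subsets? (covered-by-kernel? 𝓟)
  ... | yes cover = inj₂ λ v∈ → all-fine 𝓟 v∈ sub cover v∈
  ... | no ¬cover with ¬∀⇒∃¬-subset (covered-by-kernel? 𝓟) ¬cover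
  ... | T , ¬h = inj₁ (subst (λ t → length 𝓟 ≤ n ^ t * branching ^ k) ∣T∣≡ (sparse-length T u sparse))
    where
    ∣T∣≡ : ∣ T ∣ ≡ k ∸ 3
    ∣T∣≡ = decidable-stable (∣ T ∣ ℕ.≟ k ∸ 3) λ ≢ → ¬h λ e → contradiction e ≢
    sparse : ∀ q → T ⊆ₛ q → q ≢ Subset.⊤ → Sparse 𝓟 q
    sparse q T⊆ q≢⊤ with hom q
    ... | inj₁ K = contradiction (λ _ → q , (λ {x} → T⊆ {x}) , q≢⊤ , K) ¬h
    ... | inj₂ sp = sp

  FineSet : Subset n → Set
  FineSet F = ∃[ a ] ∃[ b ] a ≢ b × a ∈ₛ F × b ∈ₛ F × IsKernel (pair a b) × (∀ {x} → x ∈ₛ F → IsKernel (triple a b x))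

  exceptional-sets : ∃[ bad ] length bad ≤ exception-constant s k * n ^ (k ∸ 3) ×
    (∀ {F} → F ∈ 𝓕 → F ∈ bad ⊎ FineSet F)
  exceptional-sets = conclude (Decompose.exceptions 𝓥₀ Fine B small-or-fine (length (allSubsets k)) (allSubsets k) 𝓥₀ ≤-refl
    (Unique.filter⁺ represents? (unique-allWords n k)) id (λ p → inj₁ (∈-allSubsets p)))
    where
    conclude : ∃[ bad ] length bad ≤ pieces (length (allSubsets k)) * B × (∀ {v} → v ∈ 𝓥₀ → v ∈ bad ⊎ Fine v) →
      ∃[ bad ] length bad ≤ exception-constant s k * n ^ (k ∸ 3) × (∀ {F} → F ∈ 𝓕 → F ∈ bad ⊎ FineSet F)
    conclude (bad , le , h) = map range bad , size , cover
      where
      size : length (map range bad) ≤ exception-constant s k * n ^ (k ∸ 3)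
      size = begin
        length (map range bad) ≡⟨ length-map range bad ⟩
        length bad ≤⟨ le ⟩
        pieces (length (allSubsets k)) * (n ^ (k ∸ 3) * branching ^ k)
          ≡⟨ cong₂ (λ a b → pieces a * b) (length-words (outside ∷ inside ∷ []) k) (*-comm (n ^ (k ∸ 3)) (branching ^ k)) ⟩
        pieces (2 ^ k) * (branching ^ k * n ^ (k ∸ 3)) ≡⟨ sym (*-assoc (pieces (2 ^ k)) (branching ^ k) (n ^ (k ∸ 3))) ⟩
        exception-constant s k * n ^ (k ∸ 3) ∎
        where open ≤-Reasoning
      cover : ∀ {F} → F ∈ 𝓕 → F ∈ map range bad ⊎ FineSet F
      cover {F} F∈ with enumerate F (∣F∣≡k F∈)
      ... | v , inj , refl with h (∈-filter⁺ represents? (∈-allWords v) (inj , F∈))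
      ... | inj₁ v∈ = inj₁ (∈-map⁺ range v∈)
      ... | inj₂ (i , j , i≢j , p , t) = inj₂ (lookup v i , lookup v j , i≢j ∘ inj i j , ∈-range⁺ v i , ∈-range⁺ v j , p , t′)
        where
        t′ : ∀ {x} → x ∈ₛ range v → IsKernel (triple (lookup v i) (lookup v j) x)
        t′ x∈ with l , refl ← ∈-range⁻ v x∈ = t l

-- Counting edges and words

∑-deficit : {A : Set} {P : A → Set} (P? : ∀ x → Dec (P x)) (xs : List A) (f : A → ℕ) (c : ℕ) →
  (∀ {x} → x ∈ xs → f x ≤ c) → (∀ {x} → P x → f x < c) →
  ∑ xs f + length (filter P? xs) ≤ length xs * c
∑-deficit P? [] f c h lt = z≤n
∑-deficit P? (x ∷ xs) f c h lt with P? x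
... | yes Px = begin
  f x + ∑ xs f + suc l ≡⟨ +-suc (f x + ∑ xs f) l ⟩
  suc (f x + ∑ xs f + l) ≡⟨ cong suc (+-assoc (f x) (∑ xs f) l) ⟩
  suc (f x) + (∑ xs f + l) ≤⟨ +-mono-≤ (lt Px) (∑-deficit P? xs f c (h ∘ there) lt) ⟩
  c + length xs * c ∎
  where
  open ≤-Reasoning
  l : ℕ
  l = length (filter P? xs)
... | no _ = begin
  f x + ∑ xs f + l ≡⟨ +-assoc (f x) (∑ xs f) l ⟩
  f x + (∑ xs f + l) ≤⟨ +-mono-≤ (h (here refl)) (∑-deficit P? xs f c (h ∘ there) lt) ⟩
  c + length xs * c ∎
  where
  open ≤-Reasoning
  l : ℕ
  l = length (filter P? xs)

ordered? : {n : ℕ} (e : Fin n × Fin n) → Dec (proj₁ e Fin.< proj₂ e)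
ordered? (a , b) = a Fin.<? b

edges : {n : ℕ} → DecGraph n → List (Fin n × Fin n)
edges G = filter ordered? (DecGraph.arcs G)

module _ {n : ℕ} (G : DecGraph n) where
  open DecGraph G

  ∈-edges⁺ : ∀ {a b} → a Fin.< b → Edge a b → (a , b) ∈ edges G
  ∈-edges⁺ lt e = ∈-filter⁺ ordered? (∈-arcs⁺ e) lt

  ∈-edges⁻ : ∀ {a b} → (a , b) ∈ edges G → a Fin.< b × Edge a b
  ∈-edges⁻ e∈ = let p , q = ∈-filter⁻ ordered? {xs = arcs} e∈ in q , ∈-arcs⁻ p

  unique-edges : Unique (edges G)
  unique-edges = Unique.filter⁺ ordered? unique-arcs

  arcs≡2*edges : length arcs ≡ 2 * length (edges G)
  arcs≡2*edges = trans (≤-antisym (unique-⊆-length unique-arcs (λ {e} → to e))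
      (unique-⊆-length (Unique.++⁺ unique-edges (Unique.map⁺ swap-injective unique-edges) disjoint) from))
    (trans (length-++ (edges G)) (cong (length (edges G) +_)
      (trans (length-map swap (edges G)) (sym (+-identityʳ (length (edges G)))))))
    where
    swap-injective : ∀ {e f : Fin n × Fin n} → swap e ≡ swap f → e ≡ f
    swap-injective refl = refl
    to : ∀ e → e ∈ arcs → e ∈ edges G ++ map swap (edges G)
    to (a , b) e∈ with Fin.<-cmp a b
    ... | tri< lt _ _ = ∈-++⁺ˡ (∈-edges⁺ lt (∈-arcs⁻ e∈))
    ... | tri≈ _ refl _ = contradiction (∈-arcs⁻ e∈) irrefl
    ... | tri> _ _ gt = ∈-++⁺ʳ (edges G) (∈-map⁺ swap (∈-edges⁺ gt (symm (∈-arcs⁻ e∈))))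
    disjoint : ∀ {e} → ¬ (e ∈ edges G × e ∈ map swap (edges G))
    disjoint (p , q) with ∈-map⁻ swap q
    ... | _ , q′ , refl = <-asym (proj₁ (∈-edges⁻ p)) (proj₁ (∈-edges⁻ q′))
    from : ∀ {e} → e ∈ edges G ++ map swap (edges G) → e ∈ arcs
    from e∈ with ∈-++⁻ (edges G) e∈
    ... | inj₁ p = ∈-arcs⁺ (proj₂ (∈-edges⁻ p))
    ... | inj₂ q with ∈-map⁻ swap q
    ... | _ , q′ , refl = ∈-arcs⁺ (symm (proj₂ (∈-edges⁻ q′)))

cliques : {n : ℕ} → Subset n → Subset n → DecGraph n
cliques K L = record
  { Edge = λ a b → a ≢ b × ((a ∈ₛ K × b ∈ₛ K) ⊎ (a ∈ₛ L × b ∈ₛ L))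
  ; edge? = λ a b → ¬? (a Fin.≟ b) ×-dec
      (((a Sub.∈? K) ×-dec (b Sub.∈? K)) ⊎-dec ((a Sub.∈? L) ×-dec (b Sub.∈? L)))
  ; symm = λ { (≢ , inj₁ (p , q)) → ≢ ∘ sym , inj₁ (q , p) ; (≢ , inj₂ (p , q)) → ≢ ∘ sym , inj₂ (q , p) }
  ; irrefl = λ (≢ , _) → ≢ refl }

cliques-edges : {n d : ℕ} (K L : Subset n) → ∣ K ∣ ≡ suc d → ∣ L ∣ ≡ suc d → (∀ {x} → x ∈ₛ K → x ∉ₛ L) →
  d * suc d ≤ length (edges (cliques K L))
cliques-edges {n} {d} K L ∣K∣ ∣L∣ disj = *-cancelˡ-≤ 2 (begin
  2 * (d * suc d) ≡⟨ cong (2 *_) (*-comm d (suc d)) ⟩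
  2 * (suc d * d) ≡⟨ cong (suc d * d +_) (+-identityʳ (suc d * d)) ⟩
  suc d * d + suc d * d ≤⟨ +-mono-≤ (big K ∣K∣) (big L ∣L∣) ⟩
  length (pairs K) + length (pairs L) ≡⟨ sym (length-++ (pairs K)) ⟩
  length (pairs K ++ pairs L) ≤⟨ unique-⊆-length (Unique.++⁺ (unique-pairs K) (unique-pairs L)
    (λ (p , q) → disj (proj₁ (∈-pairs⁻ K p)) (proj₁ (∈-pairs⁻ L q)))) (λ {e} → into e) ⟩
  length arcs ≡⟨ arcs≡2*edges (cliques K L) ⟩
  2 * length (edges (cliques K L)) ∎)
  where
  open ≤-Reasoning
  open DecGraph (cliques K L)
  row : Subset n → Fin n → List (Fin n × Fin n)
  row K a = map (a ,_) (delete a (toList K))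
  pairs : Subset n → List (Fin n × Fin n)
  pairs K = concatMap (row K) (toList K)
  ∈-pairs⁻ : ∀ K {e} → e ∈ pairs K → proj₁ e ∈ₛ K × proj₂ e ∈ₛ K × proj₁ e ≢ proj₂ e
  ∈-pairs⁻ K e∈ with ∈-concatMap-elim (row K) (toList K) e∈
  ... | a , a∈ , e∈′ with ∈-map⁻ (a ,_) e∈′
  ... | b , b∈ , refl = let b∈K , b≢a = ∈-delete⁻ a (toList K) b∈ in ∈-toList⁻ K a∈ , ∈-toList⁻ K b∈K , b≢a ∘ sym
  unique-pairs : ∀ K → Unique (pairs K)
  unique-pairs K = unique-concatMap (unique-toList K)
    (λ {a} _ → Unique.map⁺ (proj₂ ∘ ,-injective) (unique-delete a (unique-toList K)))
    λ {a} {b} _ _ p q → let _ , _ , e = ∈-map⁻ (a ,_) p ; _ , _ , e′ = ∈-map⁻ (b ,_) q in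
      proj₁ (,-injective (trans (sym e) e′))
  big : ∀ K → ∣ K ∣ ≡ suc d → suc d * d ≤ length (pairs K)
  big K ∣K∣ = begin
    suc d * d ≡⟨ cong (_* d) (sym (trans (length-toList K) ∣K∣)) ⟩
    length (toList K) * d ≡⟨ sym (∑-const (toList K) d) ⟩
    ∑ (toList K) (λ _ → d) ≤⟨ ∑-mono (toList K) (λ {a} _ → ℕ.s≤s⁻¹ (begin
      suc d ≡⟨ sym (trans (length-toList K) ∣K∣) ⟩
      length (toList K) ≤⟨ length-delete-≥ a (unique-toList K) ⟩
      suc (length (delete a (toList K))) ≡⟨ cong suc (sym (length-map (a ,_) (delete a (toList K)))) ⟩
      suc (length (row K a)) ∎)) ⟩
    ∑ (toList K) (length ∘ row K) ≡⟨ sym (length-concatMap (row K) (toList K)) ⟩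
    length (pairs K) ∎
  into : ∀ e → e ∈ pairs K ++ pairs L → e ∈ arcs
  into (a , b) e∈ with ∈-++⁻ (pairs K) e∈
  ... | inj₁ p = let x , y , ≢ = ∈-pairs⁻ K p in ∈-arcs⁺ (≢ , inj₁ (x , y))
  ... | inj₂ p = let x , y , ≢ = ∈-pairs⁻ L p in ∈-arcs⁺ (≢ , inj₂ (x , y))

disjoint-subsets : {n : ℕ} (s : ℕ) → s + s ≤ n →
  Σ[ K ∈ Subset n ] Σ[ L ∈ Subset n ] ∣ K ∣ ≡ s × ∣ L ∣ ≡ s × (∀ {x} → x ∈ₛ K → x ∉ₛ L)
disjoint-subsets {n} s le = set ks , set ls , size ks uk (length-tab f) , size ls ul (length-tab g) , disj
  where
  f g : Fin s → Fin n
  f i = inject≤ (i Fin.↑ˡ s) le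
  g i = inject≤ (s Fin.↑ʳ i) le
  length-tab : (h : Fin s → Fin n) → length (List.tabulate h) ≡ s
  length-tab h = length-tabulate h
  ks ls : List (Fin n)
  ks = List.tabulate f
  ls = List.tabulate g
  uk : Unique ks
  uk = Unique.tabulate⁺ λ e → Fin.↑ˡ-injective s _ _ (Fin.inject≤-injective le le _ _ e)
  ul : Unique ls
  ul = Unique.tabulate⁺ λ e → Fin.↑ʳ-injective s _ _ (Fin.inject≤-injective le le _ _ e)
  size : ∀ xs → Unique xs → length xs ≡ s → ∣ set xs ∣ ≡ s
  size xs u e = trans (∣set∣ u) e
  disj : ∀ {x} → x ∈ₛ set ks → x ∉ₛ set ls
  disj x∈ x∈′ with ∈-tabulate⁻ {f = f} (∈-set⁻ ks x∈) | ∈-tabulate⁻ {f = g} (∈-set⁻ ls x∈′)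
  ... | i , refl | i′ , e = <⇒≢ (<-≤-trans (Fin.toℕ<n i) (m≤m+n s (toℕ i′))) (begin
    toℕ i ≡⟨ sym (Fin.toℕ-↑ˡ i s) ⟩
    toℕ (i Fin.↑ˡ s) ≡⟨ cong toℕ (Fin.inject≤-injective le le (i Fin.↑ˡ s) (s Fin.↑ʳ i′) e) ⟩
    toℕ (s Fin.↑ʳ i′) ≡⟨ Fin.toℕ-↑ʳ s i′ ⟩
    s + toℕ i′ ∎)
    where open ≡-Reasoning

-- A word with two equal letters arises from a word of length `m` by inserting a copy of one of its
-- letters; this leaves only `O(n ^ m)` such words of length `suc m`.
repeating : (n m : ℕ) → List (Vec (Fin n) (suc m))
repeating n m = concatMap (λ c → map (λ u → insertAt u (proj₁ c) (lookup u (proj₂ c))) (allWords n m))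
  (cartesianProduct (allFin (suc m)) (allFin m))

length-repeating : (n m : ℕ) → length (repeating n m) ≡ suc m * m * n ^ m
length-repeating n m = begin
  length (repeating n m) ≡⟨ length-concatMap g cs ⟩
  ∑ cs (length ∘ g) ≡⟨ ∑-≡-const cs ⟩
  length cs * n ^ m ≡⟨ cong (_* n ^ m) (trans (length-cartesianProductWith _,_ (allFin (suc m)) (allFin m))
    (cong₂ _*_ (length-allFin (suc m)) (length-allFin m))) ⟩
  suc m * m * n ^ m ∎
  where
  open ≡-Reasoning
  cs : List (Fin (suc m) × Fin m)
  cs = cartesianProduct (allFin (suc m)) (allFin m)
  g : Fin (suc m) × Fin m → List (Vec (Fin n) (suc m))
  g c = map (λ u → insertAt u (proj₁ c) (lookup u (proj₂ c))) (allWords n m)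
  ∑-≡-const : ∀ cs → ∑ cs (length ∘ g) ≡ length cs * n ^ m
  ∑-≡-const [] = refl
  ∑-≡-const (c ∷ cs) = cong₂ _+_ (trans (length-map _ (allWords n m)) (length-allWords n m)) (∑-≡-const cs)

not-repeating⇒inj : {n m : ℕ} (v : Vec (Fin n) (suc m)) → v ∉ repeating n m → Inj v
not-repeating⇒inj {n} {m} v v∉ i i′ e = decidable-stable (i Fin.≟ i′) λ i≢i′ →
  v∉ (∈-concatMap-intro (λ c → map (λ u → insertAt u (proj₁ c) (lookup u (proj₂ c))) (allWords n m))
    (∈-cartesianProduct⁺ (∈-allFin i) (∈-allFin (Fin.punchOut i≢i′)))
    (subst (_∈ map (λ u → insertAt u i (lookup u (Fin.punchOut i≢i′))) (allWords n m))
      (trans (cong (insertAt (removeAt v i) i) (trans (Vec.removeAt-punchOut v i≢i′) (sym e))) (Vec.insertAt-removeAt v i))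
      (∈-map⁺ (λ u → insertAt u i (lookup u (Fin.punchOut i≢i′))) (∈-allWords (removeAt v i)))))

-- Enumerate `E`, then choose the point of `W`, its position, and the remaining `m` letters.
meeting-bound : {n m : ℕ} (W : Subset n) {Es : List (Subset n)} → Unique Es →
  (∀ {E} → E ∈ Es → ∣ E ∣ ≡ suc m × ∃[ x ] x ∈ₛ E × x ∈ₛ W) →
  length Es ≤ ∣ W ∣ * (suc m * n ^ m)
meeting-bound {n} {m} W {Es} u h = begin
  length Es ≤⟨ length-cover g u covering (λ {c} _ → ≤-reflexive (trans (length-map _ (allWords n m)) (length-allWords n m))) ⟩
  length cs * n ^ m ≡⟨ cong (_* n ^ m) (trans (length-cartesianProductWith _,_ (toList W) (allFin (suc m)))
    (cong₂ _*_ (length-toList W) (length-allFin (suc m)))) ⟩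
  ∣ W ∣ * suc m * n ^ m ≡⟨ *-assoc ∣ W ∣ (suc m) (n ^ m) ⟩
  ∣ W ∣ * (suc m * n ^ m) ∎
  where
  open ≤-Reasoning
  cs : List (Fin n × Fin (suc m))
  cs = cartesianProduct (toList W) (allFin (suc m))
  g : Fin n × Fin (suc m) → List (Subset n)
  g (w , i) = map (λ u → range (insertAt u i w)) (allWords n m)
  covering : ∀ {E} → E ∈ Es → ∃[ c ] c ∈ cs × E ∈ g c
  covering {E} E∈ with h E∈
  ... | ∣E∣ , x , x∈E , x∈W with enumerate E ∣E∣
  ... | v , _ , refl with ∈-range⁻ v x∈E
  ... | i , refl = (lookup v i , i) , ∈-cartesianProduct⁺ (∈-toList⁺ x∈W) (∈-allFin i) ,
    subst (λ w → range w ∈ g (lookup v i , i)) (Vec.insertAt-removeAt v i)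
      (∈-map⁺ (λ u → range (insertAt u i (lookup v i))) (∈-allWords (removeAt v i)))

-- The two-clique family

inhabited : {n : ℕ} {p : Subset n} → 1 ≤ ∣ p ∣ → ∃[ x ] x ∈ₛ p
inhabited {n} {p} 1≤ = decidable-stable (Sub.nonempty? p) λ empty →
  <⇒≢ 1≤ (sym (trans (cong ∣_∣ (Sub.Empty-unique empty)) (Sub.∣⊥∣≡0 n)))

∣∣≥2 : {n : ℕ} {p : Subset n} {x y : Fin n} → x ≢ y → x ∈ₛ p → y ∈ₛ p → 2 ≤ ∣ p ∣
∣∣≥2 x≢y x∈ y∈ = length≤∣∣ ((x≢y ∷ []) ∷ [] ∷ []) λ { (here refl) → x∈ ; (there (here refl)) → y∈ }

second : {n : ℕ} {p : Subset n} {x : Fin n} → x ∈ₛ p → ∣ p ∣ ≢ 1 → ∃[ y ] y ≢ x × y ∈ₛ p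
second {p = p} {x} x∈ ≢1 = decidable-stable (Fin.any? λ y → ¬? (y Fin.≟ x) ×-dec (y Sub.∈? p)) λ ¬∃ →
  ≢1 (trans (cong ∣_∣ (Sub.⊆-antisym
    (λ {y} y∈ → subst (_∈ₛ ⁅ x ⁆) (decidable-stable (x Fin.≟ y) λ x≢y → ¬∃ (y , x≢y ∘ sym , y∈)) (Sub.x∈⁅x⁆ x))
    (λ {y} y∈ → subst (_∈ₛ p) (sym (Sub.x∈⁅y⁆⇒x≡y x y∈)) x∈))) (Sub.∣⁅x⁆∣≡1 x))

only-element : {n : ℕ} {p : Subset n} → ∣ p ∣ ≡ 1 → ∃[ x ] x ∈ₛ p × (∀ {y} → y ∈ₛ p → y ≡ x)
only-element {p = p} e with inhabited {p = p} (≤-reflexive (sym e))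
... | x , x∈ = x , x∈ , λ {y} y∈ → decidable-stable (y Fin.≟ x) λ y≢x →
  <⇒≢ (∣∣≥2 y≢x y∈ x∈) (sym e)

InFamily : {n : ℕ} (k : ℕ) (K L F : Subset n) → Set
InFamily k K L F = ∣ F ∣ ≡ k × 2 ≤ ∣ F ∩ (K ∪ L) ∣ × ∣ F ∩ K ∣ ≢ 1 × ∣ F ∩ L ∣ ≢ 1

inFamily? : {n : ℕ} (k : ℕ) (K L F : Subset n) → Dec (InFamily k K L F)
inFamily? k K L F = (∣ F ∣ ℕ.≟ k) ×-dec (2 ≤? ∣ F ∩ (K ∪ L) ∣) ×-dec
  ¬? (∣ F ∩ K ∣ ℕ.≟ 1) ×-dec ¬? (∣ F ∩ L ∣ ℕ.≟ 1)

family : {n : ℕ} (k : ℕ) (K L : Subset n) → Family n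
family {n} k K L = filter (inFamily? k K L) (allSubsets n)

∈-family⁺ : {n k : ℕ} {K L F : Subset n} → InFamily k K L F → F ∈ family k K L
∈-family⁺ {k = k} {K} {L} {F} = ∈-filter⁺ (inFamily? k K L) (∈-allSubsets F)

∈-family⁻ : {n k : ℕ} {K L F : Subset n} → F ∈ family k K L → InFamily k K L F
∈-family⁻ {n} {k} {K} {L} F∈ = proj₂ (∈-filter⁻ (inFamily? k K L) {xs = allSubsets n} F∈)

unique-family : {n : ℕ} (k : ℕ) (K L : Subset n) → Unique (family k K L)
unique-family k K L = Unique.filter⁺ (inFamily? k K L) (unique-allSubsets _)

edge-in-family : {n k : ℕ} {K L F : Subset n} {a b : Fin n} → (∀ {x} → x ∈ₛ K → x ∉ₛ L) → ∣ F ∣ ≡ k →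
  a ≢ b → (a ∈ₛ K × b ∈ₛ K) ⊎ (a ∈ₛ L × b ∈ₛ L) → a ∈ₛ F → b ∈ₛ F →
  (∀ {y} → y ∈ₛ F → y ∈ₛ K ∪ L → y ≡ a ⊎ y ≡ b) → InFamily k K L F
edge-in-family {K = K} {L} {F} {a} {b} disj ∣F∣ a≢b ab a∈ b∈ only =
  ∣F∣ , ∣∣≥2 a≢b (Sub.x∈p∩q⁺ (a∈ , a∈∪ ab)) (Sub.x∈p∩q⁺ (b∈ , b∈∪ ab)) , K≢1 ab , L≢1 ab
  where
  a∈∪ : (a ∈ₛ K × b ∈ₛ K) ⊎ (a ∈ₛ L × b ∈ₛ L) → a ∈ₛ K ∪ L
  a∈∪ (inj₁ (p , _)) = Sub.x∈p∪q⁺ (inj₁ p)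
  a∈∪ (inj₂ (p , _)) = Sub.x∈p∪q⁺ (inj₂ p)
  b∈∪ : (a ∈ₛ K × b ∈ₛ K) ⊎ (a ∈ₛ L × b ∈ₛ L) → b ∈ₛ K ∪ L
  b∈∪ (inj₁ (_ , p)) = Sub.x∈p∪q⁺ (inj₁ p)
  b∈∪ (inj₂ (_ , p)) = Sub.x∈p∪q⁺ (inj₂ p)
  two : ∀ {P} → a ∈ₛ P → b ∈ₛ P → ∣ F ∩ P ∣ ≢ 1
  two p q e = <⇒≢ (∣∣≥2 a≢b (Sub.x∈p∩q⁺ (a∈ , p)) (Sub.x∈p∩q⁺ (b∈ , q))) (sym e)
  K≢1 : (a ∈ₛ K × b ∈ₛ K) ⊎ (a ∈ₛ L × b ∈ₛ L) → ∣ F ∩ K ∣ ≢ 1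
  K≢1 (inj₁ (p , q)) = two p q
  K≢1 (inj₂ (p , q)) e with inhabited {p = F ∩ K} (≤-reflexive (sym e))
  ... | y , y∈ with Sub.x∈p∩q⁻ F K y∈
  ... | y∈F , y∈K with only y∈F (Sub.x∈p∪q⁺ (inj₁ y∈K))
  ... | inj₁ refl = disj y∈K p
  ... | inj₂ refl = disj y∈K q
  L≢1 : (a ∈ₛ K × b ∈ₛ K) ⊎ (a ∈ₛ L × b ∈ₛ L) → ∣ F ∩ L ∣ ≢ 1
  L≢1 (inj₂ (p , q)) = two p q
  L≢1 (inj₁ (p , q)) e with inhabited {p = F ∩ L} (≤-reflexive (sym e))
  ... | y , y∈ with Sub.x∈p∩q⁻ F L y∈
  ... | y∈F , y∈L with only y∈F (Sub.x∈p∪q⁺ (inj₂ y∈L))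
  ... | inj₁ refl = disj p y∈L
  ... | inj₂ refl = disj q y∈L

odd-≢-double : ∀ s a → s % 2 ≡ 1 → 2 * a ≢ s
odd-≢-double s a odd refl = contradiction (trans (sym odd) (trans (cong (_% 2) (*-comm 2 a)) (m*n%n≡0 a 2))) λ ()

module _ {n : ℕ} (s k : ℕ) (odd : s % 2 ≡ 1) (K L : Subset n) (∣K∣ : ∣ K ∣ ≡ s) (∣L∣ : ∣ L ∣ ≡ s) where

  module _ (S : Fin s → Subset n) (S∈ : ∀ i → InFamily k K L (S i)) (x : Fin n) (x∈ : ∀ i → x ∈ₛ S i)
           (meet : ∀ {i j y} → i ≢ j → y ∈ₛ S i → y ∈ₛ S j → y ≡ x) where

    -- If `x` were in `P`, each petal would contain a second vertex of `P`. These would be `s`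
    -- different vertices among the `s - 1` other than `x`.
    center-outside : (P : Subset n) → ∣ P ∣ ≡ s → (∀ i → ∣ S i ∩ P ∣ ≢ 1) → x ∉ₛ P
    center-outside P ∣P∣ ≢1 x∈P = <⇒≱ (length-delete-< (∈-toList⁺ x∈P)) (begin
      length (toList P) ≡⟨ trans (length-toList P) (trans ∣P∣ (sym (length-allFin s))) ⟩
      length (allFin s) ≤⟨ injection-length (proj₁ ∘ y) (Unique.allFin⁺ s)
        (λ {i} {j} _ _ e → decidable-stable (i Fin.≟ j) λ i≢j →
          proj₁ (proj₂ (y i)) (meet i≢j (in-S i) (subst (_∈ₛ S j) (sym e) (in-S j))))
        (λ {i} _ → ∈-delete⁺ (∈-toList⁺ (proj₂ (Sub.x∈p∩q⁻ (S i) P (proj₂ (proj₂ (y i)))))) (proj₁ (proj₂ (y i)))) ⟩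
      length (delete x (toList P)) ∎)
      where
      open ≤-Reasoning
      y : ∀ i → ∃[ y ] y ≢ x × y ∈ₛ S i ∩ P
      y i = second (Sub.x∈p∩q⁺ (x∈ i , x∈P)) (≢1 i)
      in-S : ∀ i → proj₁ (y i) ∈ₛ S i
      in-S i = proj₁ (Sub.x∈p∩q⁻ (S i) P (proj₂ (proj₂ (y i))))

    -- Without the center, the petals meet `P` in disjoint sets of at least two vertices. Equality
    -- would make `s` even.
    few-petals : (P : Subset n) → ∣ P ∣ ≡ s → x ∉ₛ P → (is : List (Fin s)) → Unique is →
      (∀ {i} → i ∈ is → 2 ≤ ∣ S i ∩ P ∣) → 2 * length is < s
    few-petals P ∣P∣ x∉ is u two = ≤∧≢⇒< (begin
      2 * length is ≡⟨ *-comm 2 (length is) ⟩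
      length is * 2 ≡⟨ sym (∑-const is 2) ⟩
      ∑ is (λ _ → 2) ≤⟨ ∑-mono is (λ {i} i∈ → ≤-trans (two i∈) (≤-reflexive (sym (length-toList (S i ∩ P))))) ⟩
      ∑ is (length ∘ part) ≡⟨ sym (length-concatMap part is) ⟩
      length (concatMap part is) ≤⟨ unique-⊆-length
        (unique-concatMap u (λ {i} _ → unique-toList (S i ∩ P)) disjoint)
        (λ y∈ → let i , _ , y∈i = ∈-concatMap-elim part is y∈ in
          ∈-toList⁺ (proj₂ (Sub.x∈p∩q⁻ (S i) P (∈-toList⁻ (S i ∩ P) y∈i)))) ⟩
      length (toList P) ≡⟨ trans (length-toList P) ∣P∣ ⟩
      s ∎) (odd-≢-double s (length is) odd)
      where
      open ≤-Reasoning
      part : Fin s → List (Fin n)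
      part i = toList (S i ∩ P)
      disjoint : ∀ {i j y} → i ∈ is → j ∈ is → y ∈ part i → y ∈ part j → i ≡ j
      disjoint {i} {j} _ _ p q = decidable-stable (i Fin.≟ j) λ i≢j →
        let yi , yP = Sub.x∈p∩q⁻ (S i) P (∈-toList⁻ (S i ∩ P) p)
            yj , _ = Sub.x∈p∩q⁻ (S j) P (∈-toList⁻ (S j ∩ P) q)
        in x∉ (subst (_∈ₛ P) (meet i≢j yi yj) yP)

    -- A center outside both cliques would need two vertices of one clique in each petal.
    no-family-star : ⊥
    no-family-star = <-irrefl refl (begin-strict
      2 * s ≡⟨ cong (2 *_) (sym (trans (sym (length-++ A)) (≤-antisym
        (subst (length (A ++ A′) ≤_) (length-allFin s) (unique-⊆-length unique-A++A′ (λ {i} _ → ∈-allFin i)))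
        (subst (_≤ length (A ++ A′)) (length-allFin s) (unique-⊆-length (Unique.allFin⁺ s) (λ {i} _ → split i)))))) ⟩
      2 * (length A + length A′) ≡⟨ *-distribˡ-+ 2 (length A) (length A′) ⟩
      2 * length A + 2 * length A′ <⟨ +-mono-< (few-petals K ∣K∣ x∉K A (Unique.filter⁺ inK? (Unique.allFin⁺ s)) A⁻)
                                                (few-petals L ∣L∣ x∉L A′ (Unique.filter⁺ (¬? ∘ inK?) (Unique.allFin⁺ s)) A′⁻) ⟩
      s + s ≡⟨ cong (s +_) (sym (+-identityʳ s)) ⟩
      2 * s ∎)
      where
      open ≤-Reasoning
      x∉K : x ∉ₛ K
      x∉K = center-outside K ∣K∣ λ i → let _ , _ , p , _ = S∈ i in p
      x∉L : x ∉ₛ L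
      x∉L = center-outside L ∣L∣ λ i → let _ , _ , _ , p = S∈ i in p
      inK? : ∀ i → Dec (2 ≤ ∣ S i ∩ K ∣)
      inK? i = 2 ≤? ∣ S i ∩ K ∣
      A A′ : List (Fin s)
      A = filter inK? (allFin s)
      A′ = filter (¬? ∘ inK?) (allFin s)
      A⁻ : ∀ {i} → i ∈ A → 2 ≤ ∣ S i ∩ K ∣
      A⁻ i∈ = proj₂ (∈-filter⁻ inK? {xs = allFin s} i∈)
      two : ∀ {P y i} → ∣ S i ∩ P ∣ ≢ 1 → y ∈ₛ S i → y ∈ₛ P → 2 ≤ ∣ S i ∩ P ∣
      two ≢1 yi yP = let y′ , y′≢y , y′∈ = second (Sub.x∈p∩q⁺ (yi , yP)) ≢1 in ∣∣≥2 y′≢y y′∈ (Sub.x∈p∩q⁺ (yi , yP))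
      A′⁻ : ∀ {i} → i ∈ A′ → 2 ≤ ∣ S i ∩ L ∣
      A′⁻ {i} i∈ with S∈ i | proj₂ (∈-filter⁻ (¬? ∘ inK?) {xs = allFin s} i∈)
      ... | _ , 2≤ , K≢1 , L≢1 | ¬2≤ with inhabited {p = S i ∩ (K ∪ L)} (<⇒≤ 2≤)
      ... | y , y∈ with Sub.x∈p∩q⁻ (S i) (K ∪ L) y∈
      ... | yi , yKL with Sub.x∈p∪q⁻ K L yKL
      ... | inj₁ yK = contradiction (two {i = i} K≢1 yi yK) ¬2≤
      ... | inj₂ yL = two {i = i} L≢1 yi yL
      split : ∀ i → i ∈ A ++ A′
      split i with inK? i
      ... | yes p = ∈-++⁺ˡ (∈-filter⁺ inK? (∈-allFin i) p)
      ... | no ¬p = ∈-++⁺ʳ A (∈-filter⁺ (¬? ∘ inK?) (∈-allFin i) ¬p)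
      unique-A++A′ : Unique (A ++ A′)
      unique-A++A′ = Unique.++⁺ (Unique.filter⁺ inK? (Unique.allFin⁺ s)) (Unique.filter⁺ (¬? ∘ inK?) (Unique.allFin⁺ s))
        λ (p , q) → proj₂ (∈-filter⁻ (¬? ∘ inK?) {xs = allFin s} q) (A⁻ p)

  family-admissible : Admissible s k (family k K L)
  family-admissible = (unique-family k K L , All.tabulate λ F∈ → proj₁ (∈-family⁻ F∈)) , no-sunflower
    where
    no-sunflower : ¬ ContainsSunflower s 1 (family k K L)
    no-sunflower (S , S∈ , (_ , ∩-core) , ∣core∣) with only-element {p = core S} ∣core∣
    ... | x , x∈ , only = no-family-star S (λ i → ∈-family⁻ (S∈ i)) x
      (λ i → ∈-⋂⁻ (List.tabulate S) x∈ (∈-tabulate⁺ {f = S} i))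
      λ {i} {j} i≢j p q → only (subst (_ ∈ₛ_) (∩-core i j i≢j) (Sub.x∈p∩q⁺ (p , q)))

-- The size of the two-clique family from below

join : {n : ℕ} → Subset n × (Fin n × Fin n) → Subset n
join (E , a , b) = set (a ∷ b ∷ toList E)

∣join∣ : {n : ℕ} {E : Subset n} {a b : Fin n} → a ≢ b → a ∉ₛ E → b ∉ₛ E → ∣ join (E , a , b) ∣ ≡ 2 + ∣ E ∣
∣join∣ {E = E} {a} {b} a≢b a∉ b∉ = trans
  (∣set∣ (∉⇒All≢ (λ { (here e) → a≢b e ; (there p) → a∉ (∈-toList⁻ E p) })
    ∷ ∉⇒All≢ (b∉ ∘ ∈-toList⁻ E) ∷ unique-toList E))
  (cong (2 +_) (length-toList E))

join⁻ : {n : ℕ} (E : Subset n) {a b y : Fin n} → y ∈ₛ join (E , a , b) → y ≡ a ⊎ y ≡ b ⊎ y ∈ₛ E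
join⁻ E {a} {b} y∈ with ∈-set⁻ (a ∷ b ∷ toList E) y∈
... | here e = inj₁ e
... | there (here e) = inj₂ (inj₁ e)
... | there (there p) = inj₂ (inj₂ (∈-toList⁻ E p))

subsetsOfSize : (n m : ℕ) → List (Subset n)
subsetsOfSize n m = filter (λ E → ∣ E ∣ ℕ.≟ m) (allSubsets n)

∈-subsetsOfSize⁻ : {n m : ℕ} {E : Subset n} → E ∈ subsetsOfSize n m → ∣ E ∣ ≡ m
∈-subsetsOfSize⁻ {n} {m} E∈ = proj₂ (∈-filter⁻ (λ E → ∣ E ∣ ℕ.≟ m) {xs = allSubsets n} E∈)

unique-subsetsOfSize : (n m : ℕ) → Unique (subsetsOfSize n m)
unique-subsetsOfSize n m = Unique.filter⁺ (λ E → ∣ E ∣ ℕ.≟ m) (unique-allSubsets n)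

-- It suffices to count the sets `E ∪ {a, b}` with an edge `a b` of the cliques and `E` disjoint
-- from both cliques. The sets `E` that meet a clique have one free point less, which makes them an
-- error term.
module FamilySize {n d m : ℕ} (K L : Subset n) (∣K∣ : ∣ K ∣ ≡ suc d) (∣L∣ : ∣ L ∣ ≡ suc d)
  (disj : ∀ {x} → x ∈ₛ K → x ∉ₛ L) where

  W : Subset n
  W = K ∪ L

  meets? : ∀ E → Dec (∃[ x ] x ∈ₛ E × x ∈ₛ W)
  meets? E = Fin.any? λ x → (x Sub.∈? E) ×-dec (x Sub.∈? W)

  meeting avoiding : List (Subset n)
  meeting = filter meets? (subsetsOfSize n (suc m))
  avoiding = filter (¬? ∘ meets?) (subsetsOfSize n (suc m))

  avoiding⁻ : ∀ {E} → E ∈ avoiding → ∣ E ∣ ≡ suc m × (∀ {x} → x ∈ₛ E → x ∉ₛ W)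
  avoiding⁻ E∈ = let p , q = ∈-filter⁻ (¬? ∘ meets?) {xs = subsetsOfSize n (suc m)} E∈ in
    ∈-subsetsOfSize⁻ p , λ x∈ x∈W → q (_ , x∈ , x∈W)

  G : DecGraph n
  G = cliques K L

  ends : ∀ {a b} → (a , b) ∈ edges G → a Fin.< b × a ≢ b × ((a ∈ₛ K × b ∈ₛ K) ⊎ (a ∈ₛ L × b ∈ₛ L)) × a ∈ₛ W × b ∈ₛ W
  ends e∈ with ∈-edges⁻ G e∈
  ... | lt , a≢b , inj₁ (p , q) = lt , a≢b , inj₁ (p , q) , Sub.x∈p∪q⁺ (inj₁ p) , Sub.x∈p∪q⁺ (inj₁ q)
  ... | lt , a≢b , inj₂ (p , q) = lt , a≢b , inj₂ (p , q) , Sub.x∈p∪q⁺ (inj₂ p) , Sub.x∈p∪q⁺ (inj₂ q)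

  -- The part of the joined set outside the cliques is `E`, the part inside is the edge, and `a < b`
  -- fixes its orientation.
  join-injective : ∀ {E E′ e e′} → E ∈ avoiding → E′ ∈ avoiding → e ∈ edges G → e′ ∈ edges G →
    join (E , e) ≡ join (E′ , e′) → (E , e) ≡ (E′ , e′)
  join-injective {E} {E′} {a , b} {a′ , b′} E∈ E′∈ e∈ e′∈ eq with ends e∈ | ends e′∈
  ... | lt , a≢b , _ , a∈ , b∈ | lt′ , a′≢b′ , _ , a′∈ , b′∈ =
    cong₂ _,_ (Sub.⊆-antisym (sub {E} {E′} E∈ a′∈ b′∈ eq) (sub {E′} {E} E′∈ a∈ b∈ (sym eq)))
      (match (letter {E} {E′} E′∈ eq a∈ (∈-set⁺ (here refl))) (letter {E} {E′} E′∈ eq b∈ (∈-set⁺ (there (here refl)))))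
    where
    sub : ∀ {E E′ a b a′ b′} → E ∈ avoiding → a′ ∈ₛ W → b′ ∈ₛ W →
      join (E , a , b) ≡ join (E′ , a′ , b′) → E ⊆ₛ E′
    sub {E} {E′} E∈ a′∈ b′∈ eq y∈ with join⁻ E′ (subst (_ ∈ₛ_) eq (∈-set⁺ (there (there (∈-toList⁺ y∈)))))
    ... | inj₁ refl = contradiction a′∈ (proj₂ (avoiding⁻ E∈) y∈)
    ... | inj₂ (inj₁ refl) = contradiction b′∈ (proj₂ (avoiding⁻ E∈) y∈)
    ... | inj₂ (inj₂ p) = p
    letter : ∀ {E E′ a b a′ b′ y} → E′ ∈ avoiding → join (E , a , b) ≡ join (E′ , a′ , b′) →
      y ∈ₛ W → y ∈ₛ join (E , a , b) → y ≡ a′ ⊎ y ≡ b′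
    letter {E} {E′} E′∈ eq yW y∈ with join⁻ E′ (subst (_ ∈ₛ_) eq y∈)
    ... | inj₁ e = inj₁ e
    ... | inj₂ (inj₁ e) = inj₂ e
    ... | inj₂ (inj₂ p) = contradiction yW (proj₂ (avoiding⁻ E′∈) p)
    match : a ≡ a′ ⊎ a ≡ b′ → b ≡ a′ ⊎ b ≡ b′ → (a , b) ≡ (a′ , b′)
    match (inj₁ refl) (inj₁ refl) = contradiction refl a≢b
    match (inj₁ refl) (inj₂ refl) = refl
    match (inj₂ refl) (inj₁ refl) = contradiction lt (<-asym lt′)
    match (inj₂ refl) (inj₂ refl) = contradiction refl a≢b

  avoiding-bound : length avoiding * (d * suc d) ≤ length (family (3 + m) K L)
  avoiding-bound = begin
    length avoiding * (d * suc d) ≤⟨ *-monoʳ-≤ (length avoiding) (cliques-edges K L ∣K∣ ∣L∣ disj) ⟩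
    length avoiding * length (edges G) ≡⟨ sym (length-cartesianProductWith _,_ avoiding (edges G)) ⟩
    length (cartesianProduct avoiding (edges G)) ≤⟨ injection-length join
      (Unique.cartesianProduct⁺ (Unique.filter⁺ (¬? ∘ meets?) (unique-subsetsOfSize n (suc m))) (unique-edges G))
      (λ {x} {y} x∈ y∈ → inj x y x∈ y∈) (λ {x} → into x) ⟩
    length (family (3 + m) K L) ∎
    where
    open ≤-Reasoning
    inj : ∀ x y → x ∈ cartesianProduct avoiding (edges G) → y ∈ cartesianProduct avoiding (edges G) → join x ≡ join y → x ≡ y
    inj (E , e) (E′ , e′) x∈ y∈ = let E∈ , e∈ = ∈-cartesianProduct⁻ avoiding (edges G) x∈
                                      E′∈ , e′∈ = ∈-cartesianProduct⁻ avoiding (edges G) y∈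
                                  in join-injective E∈ E′∈ e∈ e′∈
    into : ∀ x → x ∈ cartesianProduct avoiding (edges G) → join x ∈ family (3 + m) K L
    into (E , a , b) x∈ with ∈-cartesianProduct⁻ avoiding (edges G) x∈
    ... | E∈ , e∈ with avoiding⁻ E∈ | ends e∈
    ... | ∣E∣ , E∩W | _ , a≢b , ab , aW , bW = ∈-family⁺ (edge-in-family disj
      (trans (∣join∣ a≢b (λ a∈ → E∩W a∈ aW) (λ b∈ → E∩W b∈ bW)) (cong (2 +_) ∣E∣)) a≢b ab
      (∈-set⁺ (here refl)) (∈-set⁺ (there (here refl))) only)
      where
      only : ∀ {y} → y ∈ₛ join (E , a , b) → y ∈ₛ W → y ≡ a ⊎ y ≡ b
      only y∈ yW with join⁻ E y∈
      ... | inj₁ e = inj₁ e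
      ... | inj₂ (inj₁ e) = inj₂ e
      ... | inj₂ (inj₂ p) = contradiction yW (E∩W p)

  ∣W∣≤ : ∣ W ∣ ≤ suc d + suc d
  ∣W∣≤ = begin
    ∣ W ∣ ≤⟨ ∣∣≤length (λ {x} x∈ → [ (λ p → ∈-++⁺ˡ (∈-toList⁺ p)) , (λ q → ∈-++⁺ʳ (toList K) (∈-toList⁺ q)) ]′
      (Sub.x∈p∪q⁻ K L x∈)) ⟩
    length (toList K ++ toList L) ≡⟨ length-++ (toList K) ⟩
    length (toList K) + length (toList L) ≡⟨ cong₂ _+_ (trans (length-toList K) ∣K∣) (trans (length-toList L) ∣L∣) ⟩
    suc d + suc d ∎
    where open ≤-Reasoning

  family-size : length (subsetsOfSize n (suc m)) * (d * suc d) ≤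
    length (family (3 + m) K L) + (suc d + suc d) * (suc m * n ^ m) * (d * suc d)
  family-size = begin
    length Es * e ≤⟨ *-monoˡ-≤ e (≤-trans (unique-⊆-length {ys = avoiding ++ meeting} (unique-subsetsOfSize n (suc m)) (λ {E} → split E))
      (≤-reflexive (length-++ avoiding))) ⟩
    (length avoiding + length meeting) * e ≡⟨ *-distribʳ-+ e (length avoiding) (length meeting) ⟩
    length avoiding * e + length meeting * e ≤⟨ +-mono-≤ avoiding-bound (*-monoˡ-≤ e
      (≤-trans (meeting-bound W (Unique.filter⁺ meets? (unique-subsetsOfSize n (suc m))) meeting⁻)
        (*-monoˡ-≤ (suc m * n ^ m) ∣W∣≤))) ⟩
    length (family (3 + m) K L) + (suc d + suc d) * (suc m * n ^ m) * e ∎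
    where
    open ≤-Reasoning
    Es : List (Subset n)
    Es = subsetsOfSize n (suc m)
    e : ℕ
    e = d * suc d
    split : ∀ E → E ∈ Es → E ∈ avoiding ++ meeting
    split E E∈ with meets? E
    ... | yes p = ∈-++⁺ʳ avoiding (∈-filter⁺ meets? E∈ p)
    ... | no ¬p = ∈-++⁺ˡ (∈-filter⁺ (¬? ∘ meets?) E∈ ¬p)
    meeting⁻ : ∀ {E} → E ∈ meeting → ∣ E ∣ ≡ suc m × ∃[ x ] x ∈ₛ E × x ∈ₛ W
    meeting⁻ E∈ = let p , q = ∈-filter⁻ meets? {xs = Es} E∈ in ∈-subsetsOfSize⁻ p , q

-- A link shared by almost all points

-- The first summand comes from the exceptional members of `𝓕`, the second from the `(k - 2)`-sets
-- meeting the two cliques, each counted with all `(s - 1) s` edges.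
bad-constant : ℕ → ℕ → ℕ
bad-constant s k = exception-constant s k + (s + s) * (k ∸ 2) * (ℕ.pred s * s)

abstract
  -- The first summand counts words with a repeated letter; `(k ∸ 2) ^ (k ∸ 2)` is the number of
  -- words over one deficient set.
  word-constant : ℕ → ℕ → ℕ
  word-constant s k = (k ∸ 2) * (k ∸ 3) + bad-constant s k * (k ∸ 2) ^ (k ∸ 2)

  word-constant-≡ : ∀ s k → word-constant s k ≡ (k ∸ 2) * (k ∸ 3) + bad-constant s k * (k ∸ 2) ^ (k ∸ 2)
  word-constant-≡ s k = refl

module Counting (n d j : ℕ) (1≤d : 1 ≤ d) (odd : suc d % 2 ≡ 1) (𝓕 : Family n)
  (extremal : Extremal (suc d) (5 + j) 𝓕) (2s≤n : suc d + suc d ≤ n) where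

  -- Here `m` is `k - 3`, so the sets in `Es` have `k - 2` points, and `e` is the largest possible
  -- number `s (s - 1)` of edges of a link.
  k m e : ℕ
  k = 5 + j
  m = 2 + j
  e = d * suc d

  open Kernels n d k 1≤d (m≤m+n 5 j) 𝓕 (proj₁ extremal)

  Es : List (Subset n)
  Es = subsetsOfSize n (suc m)

  Joinable : Subset n → Fin n × Fin n → Set
  Joinable E (a , b) = a Fin.< b × a ∉ₛ E × b ∉ₛ E × IsKernel (pair a b) × (∀ x → x ∈ₛ E → IsKernel (triple a b x))

  joinable? : ∀ E p → Dec (Joinable E p)
  joinable? E (a , b) = (a Fin.<? b) ×-dec ¬? (a Sub.∈? E) ×-dec ¬? (b Sub.∈? E) ×-dec
    isKernel? (pair a b) ×-dec Fin.all? (λ x → (x Sub.∈? E) →-dec isKernel? (triple a b x))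

  pairs : List (Fin n × Fin n)
  pairs = cartesianProduct (allFin n) (allFin n)

  Γ : Subset n → List (Fin n × Fin n)
  Γ E = filter (joinable? E) pairs

  ∈-Γ⁺ : ∀ {E a b} → Joinable E (a , b) → (a , b) ∈ Γ E
  ∈-Γ⁺ {E} {a} {b} = ∈-filter⁺ (joinable? E) (∈-cartesianProduct⁺ (∈-allFin a) (∈-allFin b))

  ∈-Γ⁻ : ∀ {E p} → p ∈ Γ E → Joinable E p
  ∈-Γ⁻ {E} p∈ = proj₂ (∈-filter⁻ (joinable? E) {xs = pairs} p∈)

  unique-Γ : ∀ E → Unique (Γ E)
  unique-Γ E = Unique.filter⁺ (joinable? E) (Unique.cartesianProduct⁺ (Unique.allFin⁺ n) (Unique.allFin⁺ n))

  Γ⊆link : ∀ {E x p} → x ∈ₛ E → p ∈ Γ E → p ∈ edges (link x)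
  Γ⊆link {E} {x} {a , b} x∈ p∈ = let lt , a∉ , b∉ , p , t = ∈-Γ⁻ p∈ in
    ∈-edges⁺ (link x) lt ((λ { refl → Fin.<-irrefl refl lt }) , (λ { refl → a∉ x∈ }) , (λ { refl → b∉ x∈ }) , p , t x x∈)

  link-edges≤ : ∀ x → length (edges (link x)) ≤ e
  link-edges≤ x = *-cancelˡ-≤ 2 (begin
    2 * length (edges (link x)) ≡⟨ sym (arcs≡2*edges (link x)) ⟩
    length (DecGraph.arcs (link x)) ≤⟨ proj₁ (link-two-cliques x) ⟩
    (2 * d) * suc d ≡⟨ *-assoc 2 d (suc d) ⟩
    2 * e ∎)
    where open ≤-Reasoning

  Γ≤ : ∀ {E} → E ∈ Es → length (Γ E) ≤ e
  Γ≤ {E} E∈ = let x , x∈ = inhabited {p = E} (≤-trans (s≤s z≤n) (≤-reflexive (sym (∈-subsetsOfSize⁻ {n} {suc m} E∈)))) in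
    ≤-trans (unique-⊆-length (unique-Γ E) (Γ⊆link x∈)) (link-edges≤ x)

  fine⇒joined : ∀ {F} → F ∈ 𝓕 → FineSet F → ∃[ E ] E ∈ Es × F ∈ map (λ p → join (E , p)) (Γ E)
  fine⇒joined {F} F∈ (a , b , a≢b , a∈ , b∈ , p , t) = orient (Fin.<-cmp a b)
    where
    joined : ∀ a b → a Fin.< b → a ∈ₛ F → b ∈ₛ F → IsKernel (pair a b) → (∀ {x} → x ∈ₛ F → IsKernel (triple a b x)) →
      ∃[ E ] E ∈ Es × F ∈ map (λ p → join (E , p)) (Γ E)
    joined a b lt a∈ b∈ p t = E , ∈-filter⁺ (λ E → ∣ E ∣ ℕ.≟ suc m) (∈-allSubsets E) ∣E∣ ,
      subst (_∈ map (λ p → join (E , p)) (Γ E)) F≡ (∈-map⁺ (λ p → join (E , p)) (∈-Γ⁺ (lt , a∉ , b∉ , p , λ x x∈ → t (proj₁ (∈-comp⁻ E? x∈)))))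
      where
      E? : ∀ x → Dec (x ∈ₛ F × x ≢ a × x ≢ b)
      E? x = (x Sub.∈? F) ×-dec ¬? (x Fin.≟ a) ×-dec ¬? (x Fin.≟ b)
      E : Subset n
      E = comp E?
      a∉ : a ∉ₛ E
      a∉ a∈E = proj₁ (proj₂ (∈-comp⁻ E? a∈E)) refl
      b∉ : b ∉ₛ E
      b∉ b∈E = proj₂ (proj₂ (∈-comp⁻ E? b∈E)) refl
      from : ∀ {y} → y ≡ a ⊎ y ≡ b ⊎ y ∈ₛ E → y ∈ₛ F
      from (inj₁ refl) = a∈
      from (inj₂ (inj₁ refl)) = b∈
      from (inj₂ (inj₂ y∈)) = proj₁ (∈-comp⁻ E? y∈)
      to : ∀ {y} → y ∈ₛ F → y ∈ₛ join (E , a , b)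
      to {y} y∈ with y Fin.≟ a | y Fin.≟ b
      ... | yes e | _ = ∈-set⁺ (here e)
      ... | no _ | yes e = ∈-set⁺ (there (here e))
      ... | no y≢a | no y≢b = ∈-set⁺ (there (there (∈-toList⁺ (∈-comp⁺ E? (y∈ , y≢a , y≢b)))))
      F≡ : join (E , a , b) ≡ F
      F≡ = Sub.⊆-antisym (λ y∈ → from (join⁻ E y∈)) to
      ∣E∣ : ∣ E ∣ ≡ suc m
      ∣E∣ = suc-injective (suc-injective (trans (sym (∣join∣ (λ { refl → Fin.<-irrefl refl lt }) a∉ b∉))
        (trans (cong ∣_∣ F≡) (∣F∣≡k F∈))))
    orient : _ → ∃[ E ] E ∈ Es × F ∈ map (λ p → join (E , p)) (Γ E)
    orient (tri< lt _ _) = joined a b lt a∈ b∈ p t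
    orient (tri≈ _ a≡b _) = contradiction a≡b a≢b
    orient (tri> _ _ gt) = joined b a gt b∈ a∈ (subst IsKernel (pair-sym a b) p) λ {x} x∈ → subst IsKernel (triple-sym a b x) (t x∈)

  𝓕-upper : length 𝓕 ≤ exception-constant s k * n ^ m + ∑ Es (length ∘ Γ)
  𝓕-upper = bound exceptional-sets
    where
    open ≤-Reasoning
    joins : Subset n → List (Subset n)
    joins E = map (λ p → join (E , p)) (Γ E)
    bound : _ → length 𝓕 ≤ exception-constant s k * n ^ m + ∑ Es (length ∘ Γ)
    bound (bad , le , split) = begin
      length 𝓕 ≤⟨ unique-⊆-length (proj₁ (proj₁ (proj₁ extremal))) (λ {F} F∈ →
        [ ∈-++⁺ˡ , (λ fine → let E , E∈ , F∈E = fine⇒joined F∈ fine in ∈-++⁺ʳ bad (∈-concatMap-intro joins E∈ F∈E)) ]′ (split F∈)) ⟩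
      length (bad ++ concatMap joins Es) ≡⟨ length-++ bad ⟩
      length bad + length (concatMap joins Es) ≤⟨ +-mono-≤ le (≤-trans (≤-reflexive (length-concatMap joins Es))
        (∑-mono Es λ {E} _ → ≤-reflexive (length-map (λ p → join (E , p)) (Γ E)))) ⟩
      exception-constant s k * n ^ m + ∑ Es (length ∘ Γ) ∎

  deficient? : ∀ E → Dec (length (Γ E) < e)
  deficient? E = length (Γ E) <? e

  deficient : List (Subset n)
  deficient = filter deficient? Es

  -- The allowance `length Es * e` exceeds the two-clique family by at most `O(n ^ m)`; extremality
  -- puts that family below `𝓕`, and `𝓕-upper` puts `𝓕` below the sum of the `Γ E` plus `O(n ^ m)`.
  -- Each deficient set wastes at least one unit of the allowance.
  deficient-bound : length deficient ≤ bad-constant s k * n ^ m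
  deficient-bound = bound (disjoint-subsets s 2s≤n)
    where
    open ≤-Reasoning
    bound : _ → length deficient ≤ bad-constant s k * n ^ m
    bound (K , L , ∣K∣ , ∣L∣ , disj) = +-cancelˡ-≤ (∑ Es (length ∘ Γ)) (length deficient) (bad-constant s k * n ^ m) (begin
      ∑ Es (length ∘ Γ) + length deficient ≤⟨ ∑-deficit deficient? Es (length ∘ Γ) e Γ≤ id ⟩
      length Es * e ≤⟨ FamilySize.family-size K L ∣K∣ ∣L∣ disj ⟩
      length (family k K L) + (s + s) * (suc m * n ^ m) * e
        ≤⟨ +-monoˡ-≤ _ (≤-trans (proj₂ extremal (family k K L) (family-admissible s k odd K L ∣K∣ ∣L∣)) 𝓕-upper) ⟩
      exception-constant s k * n ^ m + Σ + (s + s) * (suc m * n ^ m) * e ≡⟨ cong (_+ (s + s) * (suc m * n ^ m) * e) (+-comm (exception-constant s k * n ^ m) Σ) ⟩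
      Σ + exception-constant s k * n ^ m + (s + s) * (suc m * n ^ m) * e ≡⟨ +-assoc Σ _ _ ⟩
      Σ + (exception-constant s k * n ^ m + (s + s) * (suc m * n ^ m) * e) ≡⟨ cong (λ t → Σ + (exception-constant s k * n ^ m + t)) (rearrange (s + s) (suc m) (n ^ m) e) ⟩
      Σ + (exception-constant s k * n ^ m + (s + s) * suc m * e * n ^ m) ≡⟨ cong (Σ +_) (sym (*-distribʳ-+ (n ^ m) (exception-constant s k) ((s + s) * suc m * e))) ⟩
      Σ + bad-constant s k * n ^ m ∎)
      where
      Σ : ℕ
      Σ = ∑ Es (length ∘ Γ)
      rearrange : ∀ a b c d → a * (b * c) * d ≡ a * b * d * c
      rearrange a b c d = trans (cong (_* d) (sym (*-assoc a b c)))
        (trans (*-assoc (a * b) c d) (trans (cong (a * b *_) (*-comm c d)) (sym (*-assoc (a * b) d c))))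

  bad-words : List (Vec (Fin n) (suc m))
  bad-words = repeating n m ++ concatMap (λ E → words (toList E) (suc m)) deficient

  bad-words-bound : length bad-words ≤ word-constant s k * n ^ m
  bad-words-bound = begin
    length bad-words ≡⟨ length-++ (repeating n m) ⟩
    length (repeating n m) + length (concatMap W deficient) ≡⟨ cong₂ _+_ (length-repeating n m) (length-concatMap W deficient) ⟩
    suc m * m * n ^ m + ∑ deficient (length ∘ W) ≤⟨ +-monoʳ-≤ (suc m * m * n ^ m) (∑-≤-const deficient λ {E} E∈ →
      ≤-reflexive (trans (length-words (toList E) (suc m)) (cong (_^ suc m) (trans (length-toList E)
        (∈-subsetsOfSize⁻ {n} {suc m} (proj₁ (∈-filter⁻ deficient? {xs = Es} E∈))))))) ⟩
    suc m * m * n ^ m + length deficient * suc m ^ suc m ≤⟨ +-monoʳ-≤ (suc m * m * n ^ m) (*-monoˡ-≤ (suc m ^ suc m) deficient-bound) ⟩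
    suc m * m * n ^ m + bad-constant s k * n ^ m * suc m ^ suc m ≡⟨ cong (suc m * m * n ^ m +_) (trans (*-assoc (bad-constant s k) (n ^ m) (suc m ^ suc m))
      (trans (cong (bad-constant s k *_) (*-comm (n ^ m) (suc m ^ suc m))) (sym (*-assoc (bad-constant s k) (suc m ^ suc m) (n ^ m))))) ⟩
    suc m * m * n ^ m + bad-constant s k * suc m ^ suc m * n ^ m ≡⟨ sym (*-distribʳ-+ (n ^ m) (suc m * m) (bad-constant s k * suc m ^ suc m)) ⟩
    (suc m * m + bad-constant s k * suc m ^ suc m) * n ^ m ≡⟨ cong (_* n ^ m) (sym (word-constant-≡ s k)) ⟩
    word-constant s k * n ^ m ∎
    where
    open ≤-Reasoning
    W : Subset n → List (Vec (Fin n) (suc m))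
    W E = words (toList E) (suc m)

  good-word⇒full : ∀ v → v ∉ bad-words → e ≤ length (Γ (range v))
  good-word⇒full v v∉ = ≮⇒≥ λ lt → v∉ (∈-++⁺ʳ (repeating n m) (∈-concatMap-intro (λ E → words (toList E) (suc m))
    (∈-filter⁺ deficient? (∈-filter⁺ (λ E → ∣ E ∣ ℕ.≟ suc m) (∈-allSubsets (range v))
      (∣range∣ v (not-repeating⇒inj v (v∉ ∘ ∈-++⁺ˡ)))) lt)
    (∈-words v λ i → ∈-toList⁺ (∈-range⁺ v i))))

  -- `Γ` of the range lies in the link of every letter, none of which has more than `e` edges.
  -- Having `e` elements itself, it coincides with each of these links.
  good-word-links : ∀ v → v ∉ bad-words → ∀ i i′ {p} → p ∈ edges (link (lookup v i)) → p ∈ edges (link (lookup v i′))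
  good-word-links v v∉ i i′ p∈ = Γ⊆link (∈-range⁺ v i′) (⊆-reverse (≡-dec Fin._≟_ Fin._≟_) (unique-Γ (range v))
    (Γ⊆link (∈-range⁺ v i)) (≤-trans (link-edges≤ (lookup v i)) (good-word⇒full v v∉)) p∈)

  all-bad? : ∀ x y → Dec (All (λ u → (x ∷ y ∷ u) ∈ bad-words) (allWords n (suc j)))
  all-bad? x y = All.all? (λ u → Any.any? ((x ∷ y ∷ u) ≟ᵥ_) bad-words) (allWords n (suc j))

  -- A point `y` outside this list starts some good word together with `x`, and therefore shares its
  -- link.
  strangers : Fin n → List (Fin n)
  strangers x = filter (all-bad? x) (allFin n)

  ¬stranger⇒good-word : ∀ {x y} → y ∉ strangers x → ∃[ u ] (x ∷ y ∷ u) ∉ bad-words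
  ¬stranger⇒good-word {x} {y} y∉ = let u , _ , h = find (¬All⇒Any¬ (λ u → Any.any? ((x ∷ y ∷ u) ≟ᵥ_) bad-words) (allWords n (suc j))
                                         λ all → y∉ (∈-filter⁺ (all-bad? x) (∈-allFin y) all)) in u , h

  -- A point and one of its strangers make all `n ^ (m - 1)` words beginning with them bad, while
  -- only `O(n ^ m)` words are bad. Hence the average number of strangers is bounded.
  pigeonhole : ∑ (allFin n) (length ∘ strangers) * n ^ suc j ≤ word-constant s k * n ^ m
  pigeonhole = begin
    ∑ (allFin n) (length ∘ strangers) * n ^ suc j ≡⟨ cong₂ _*_
      (trans (∑-cong (allFin n) λ x → sym (length-map (x ,_) (strangers x))) (sym (length-concatMap row (allFin n)))) (sym (length-allWords n (suc j))) ⟩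
    length (concatMap row (allFin n)) * length (allWords n (suc j))
      ≡⟨ sym (length-cartesianProductWith extend (concatMap row (allFin n)) (allWords n (suc j))) ⟩
    length (cartesianProductWith extend (concatMap row (allFin n)) (allWords n (suc j))) ≤⟨ unique-⊆-length
      (Unique.cartesianProductWith⁺ extend (λ { refl → refl , refl })
        (unique-concatMap (Unique.allFin⁺ n)
          (λ {x} _ → Unique.map⁺ (proj₂ ∘ ,-injective) (Unique.filter⁺ (all-bad? x) (Unique.allFin⁺ n)))
          λ {x} {y} _ _ p q → let _ , _ , a = ∈-map⁻ (x ,_) p ; _ , _ , b = ∈-map⁻ (y ,_) q in
            proj₁ (,-injective (trans (sym a) b)))
        (unique-allWords n (suc j)))
      (λ {v} → into v) ⟩
    length bad-words ≤⟨ bad-words-bound ⟩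
    word-constant s k * n ^ m ∎
    where
    open ≤-Reasoning
    row : Fin n → List (Fin n × Fin n)
    row x = map (x ,_) (strangers x)
    extend : Fin n × Fin n → Vec (Fin n) (suc j) → Vec (Fin n) (suc m)
    extend (x , y) u = x ∷ y ∷ u
    into : ∀ v → v ∈ cartesianProductWith extend (concatMap row (allFin n)) (allWords n (suc j)) → v ∈ bad-words
    into v v∈ with ∈-cartesianProductWith⁻ extend (concatMap row (allFin n)) (allWords n (suc j)) v∈
    ... | (x , y) , u , xy∈ , u∈ , refl with ∈-concatMap-elim row (allFin n) xy∈
    ... | x′ , _ , xy∈′ with ∈-map⁻ (x′ ,_) xy∈′
    ... | _ , y∈ , refl = All.lookup (proj₂ (∈-filter⁻ (all-bad? x) {xs = allFin n} y∈)) u∈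

  few-strangers : ∃[ x ] length (strangers x) ≤ word-constant s k
  few-strangers = decidable-stable (Fin.any? λ x → length (strangers x) ≤? word-constant s k) λ ¬∃ →
    <-irrefl refl (begin-strict
      word-constant s k * n ^ m ≡⟨ sym (*-assoc (word-constant s k) n (n ^ suc j)) ⟩
      word-constant s k * n * n ^ suc j <⟨ *-monoˡ-< (n ^ suc j) {{m^n≢0 n (suc j)}} (begin-strict
        word-constant s k * n ≡⟨ *-comm (word-constant s k) n ⟩
        n * word-constant s k <⟨ *-monoʳ-< n (n<1+n (word-constant s k)) ⟩
        n * suc (word-constant s k) ≡⟨ cong (_* suc (word-constant s k)) (sym (length-allFin n)) ⟩
        length (allFin n) * suc (word-constant s k) ≡⟨ sym (∑-const (allFin n) (suc (word-constant s k))) ⟩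
        ∑ (allFin n) (λ _ → suc (word-constant s k)) ≤⟨ ∑-mono (allFin n) (λ {x} _ → ≰⇒> λ le → ¬∃ (x , le)) ⟩
        ∑ (allFin n) (length ∘ strangers) ∎) ⟩
      ∑ (allFin n) (length ∘ strangers) * n ^ suc j ≤⟨ pigeonhole ⟩
      word-constant s k * n ^ m ∎)
    where
    open ≤-Reasoning
    instance
      n≢0 : ℕ.NonZero n
      n≢0 = ℕ.>-nonZero (≤-trans (s≤s z≤n) 2s≤n)

  edge-transfer : ∀ {x y} → (∀ {p} → p ∈ edges (link x) → p ∈ edges (link y)) →
    ∀ {a b} → DecGraph.Edge (link x) a b → DecGraph.Edge (link y) a b
  edge-transfer {x} {y} h {a} {b} ab with Fin.<-cmp a b
  ... | tri< lt _ _ = proj₂ (∈-edges⁻ (link y) (h (∈-edges⁺ (link x) lt ab)))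
  ... | tri≈ _ refl _ = contradiction ab (DecGraph.irrefl (link x))
  ... | tri> _ _ gt = DecGraph.symm (link y) (proj₂ (∈-edges⁻ (link y) (h (∈-edges⁺ (link x) gt (DecGraph.symm (link x) ab)))))

  common-link : word-constant s k < n → ∃[ x ] ∃[ Y ] length Y ≤ word-constant s k × TwoCliques (link x) s ×
    (∀ {y} → y ∉ Y → ∀ {a b} → DecGraph.Edge (link x) a b → DecGraph.Edge (link y) a b)
  common-link lt = finish few-strangers
    where
    finish : _ → ∃[ x ] ∃[ Y ] length Y ≤ word-constant s k × TwoCliques (link x) s ×
      (∀ {y} → y ∉ Y → ∀ {a b} → DecGraph.Edge (link x) a b → DecGraph.Edge (link y) a b)
    finish (x , le) = x , strangers x , le , proj₂ (link-two-cliques x) full ,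
      λ y∉ → edge-transfer (let u , u∉ = ¬stranger⇒good-word y∉ in good-word-links _ u∉ zero (suc zero))
      where
      -- One good word beginning with `x` suffices for the link of `x` to be full; a non-stranger
      -- `y` exists because there are more points than strangers.
      full : (2 * d) * suc d ≤ length (DecGraph.arcs (link x))
      full = let y , y∉ = fresh (strangers x) (≤-<-trans le lt)
                 u , u∉ = ¬stranger⇒good-word y∉
        in begin
        (2 * d) * suc d ≡⟨ *-assoc 2 d (suc d) ⟩
        2 * e ≤⟨ *-monoʳ-≤ 2 (≤-trans (good-word⇒full (x ∷ y ∷ u) u∉)
          (unique-⊆-length (unique-Γ (range (x ∷ y ∷ u))) (Γ⊆link (∈-range⁺ (x ∷ y ∷ u) zero)))) ⟩
        2 * length (edges (link x)) ≡⟨ sym (arcs≡2*edges (link x)) ⟩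
        length (DecGraph.arcs (link x)) ∎
        where open ≤-Reasoning

-- Uniqueness of the extremal family

complement : {n : ℕ} → List (Fin n) → List (Fin n)
complement {n} A = filter (λ y → ¬? (y ∈ₗ? A)) (allFin n)

∈-complement⁻ : {n : ℕ} (A : List (Fin n)) {y : Fin n} → y ∈ complement A → y ∉ A
∈-complement⁻ {n} A y∈ = proj₂ (∈-filter⁻ (λ y → ¬? (y ∈ₗ? A)) {xs = allFin n} y∈)

unique-complement : {n : ℕ} (A : List (Fin n)) → Unique (complement A)
unique-complement {n} A = Unique.filter⁺ _ (Unique.allFin⁺ n)

length-complement : {n : ℕ} (A : List (Fin n)) → n ≤ length A + length (complement A)
length-complement {n} A = begin
  n ≡⟨ sym (length-allFin n) ⟩
  length (allFin n) ≤⟨ unique-⊆-length (Unique.allFin⁺ n) (λ {y} _ → split y) ⟩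
  length (A ++ complement A) ≡⟨ length-++ A ⟩
  length A + length (complement A) ∎
  where
  open ≤-Reasoning
  split : ∀ y → y ∈ A ++ complement A
  split y with y ∈ₗ? A
  ... | yes p = ∈-++⁺ˡ p
  ... | no ¬p = ∈-++⁺ʳ A (∈-filter⁺ (λ y → ¬? (y ∈ₗ? A)) (∈-allFin y) ¬p)

CliqueStructure : {n : ℕ} (s k : ℕ) (𝓕 : Family n) → Set
CliqueStructure {n} s k 𝓕 = Σ[ K ∈ Subset n ] Σ[ L ∈ Subset n ] ∣ K ∣ ≡ s × ∣ L ∣ ≡ s ×
  (∀ {x} → x ∈ₛ K → x ∉ₛ L) × (∀ F → F ∈ 𝓕 ⇔ InFamily k K L F)

-- In `many`, `3 + (s * k + (s + s))` bounds the points to be avoided in `Lost`, `suc j` counts the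
-- fixed fillers, and the last summand leaves more than `c ^ k` choices for one further point.
module Uniqueness (n d j : ℕ) (1≤d : 1 ≤ d) (odd : suc d % 2 ≡ 1) (𝓕 : Family n)
  (extremal : Extremal (suc d) (5 + j) 𝓕) (2s≤n : suc d + suc d ≤ n)
  (many : 3 + (suc d * (5 + j) + (suc d + suc d)) + suc j + suc (word-constant (suc d) (5 + j) ^ (5 + j)) ≤ n) where

  k c : ℕ
  k = 5 + j
  c = word-constant (suc d) k

  open Kernels n d k 1≤d (m≤m+n 5 j) 𝓕 (proj₁ extremal)

  module _ (o : Fin n) (Y : List (Fin n)) (Y≤ : length Y ≤ c) (cl : TwoCliques (link o) s)
    (transfer : ∀ {y} → y ∉ Y → ∀ {a b} → DecGraph.Edge (link o) a b → DecGraph.Edge (link y) a b) where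

    open TwoCliques cl
    open DecGraph (link o) using (Edge)

    -- If `x` were the only common point, `F` and the pairs of `x` with the `s - 1` other vertices
    -- of the clique would form a star.
    meets-clique : ∀ {F} (P : Subset n) → ∣ P ∣ ≡ s → (∀ {x y} → x ∈ₛ P → y ∈ₛ P → x ≢ y → Edge x y) →
      F ∈ 𝓕 → ∣ F ∩ P ∣ ≢ 1
    meets-clique {F} P ∣P∣ complete F∈ ∣F∩P∣ = contradict (only-element {p = F ∩ P} ∣F∩P∣)
      where
      contradict : ¬ (∃[ x ] x ∈ₛ F ∩ P × (∀ {y} → y ∈ₛ F ∩ P → y ≡ x))
      contradict (x , x∈ , only) = no-star x S record { kernels = kernels ; center = center ; meet = λ {i} {j} → meet i j }
        where
        x∈F : x ∈ₛ F
        x∈F = proj₁ (Sub.x∈p∩q⁻ F P x∈)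
        x∈P : x ∈ₛ P
        x∈P = proj₂ (Sub.x∈p∩q⁻ F P x∈)
        others : Σ[ b ∈ (Fin d → Fin n) ] (∀ i → b i ∈ delete x (toList P)) × (∀ {i j} → b i ≡ b j → i ≡ j)
        others = select (unique-delete x (unique-toList P)) (ℕ.s≤s⁻¹ (≤-trans
          (≤-reflexive (sym (trans (length-toList P) ∣P∣))) (length-delete-≥ x (unique-toList P))))
        b : Fin d → Fin n
        b = proj₁ others
        b∈P : ∀ i → b i ∈ₛ P
        b∈P i = ∈-toList⁻ P (proj₁ (∈-delete⁻ x (toList P) (proj₁ (proj₂ others) i)))
        b≢x : ∀ i → b i ≢ x
        b≢x i = proj₂ (∈-delete⁻ x (toList P) (proj₁ (proj₂ others) i))
        S : Fin s → Subset n
        S zero = F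
        S (suc i) = pair x (b i)
        kernels : ∀ i → IsKernel (S i)
        kernels zero = member-kernel F∈
        kernels (suc i) = let _ , _ , _ , p , _ = complete x∈P (b∈P i) (b≢x i ∘ sym) in p
        center : ∀ i → x ∈ₛ S i
        center zero = x∈F
        center (suc i) = ∈-set⁺ (here refl)
        F-meet : ∀ i {y} → y ∈ₛ F → y ∈ₛ pair x (b i) → y ≡ x
        F-meet i y∈F y∈ with ∈-set⁻ (x ∷ b i ∷ []) y∈
        ... | here e = e
        ... | there (here refl) = only (Sub.x∈p∩q⁺ (y∈F , b∈P i))
        meet : ∀ i j {y} → i ≢ j → y ∈ₛ S i → y ∈ₛ S j → y ≡ x
        meet zero zero i≢j _ _ = contradiction refl i≢j
        meet zero (suc j) _ p q = F-meet j p q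
        meet (suc i) zero _ p q = F-meet i q p
        meet (suc i) (suc j) i≢j p q = pair-meet (λ e → i≢j (cong suc (proj₂ (proj₂ others) e))) p q

    M : Vec (Fin n) n
    M = proj₁ matching

    inv : ∀ t → lookup M (lookup M t) ≡ t
    inv = proj₁ (proj₁ (proj₂ matching))

    -- One end of each of `d` disjoint edges of the common link. Together with `F`, the triples they
    -- form with a point of `F` have the right number for a star.
    ends : Σ[ a ∈ (Fin d → Fin n) ] (∀ i → a i ∈ lower M) × (∀ {i j} → a i ≡ a j → i ≡ j)
    ends = select (unique-lower M) (*-cancelˡ-≤ 2 (≤-reflexive (trans (sym (proj₂ (proj₂ matching))) (cov-even M inv))))

    a b : Fin d → Fin n
    a = proj₁ ends
    b i = lookup M (a i)

    a<b : ∀ i → a i Fin.< b i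
    a<b i = ∈-lower⁻ M (proj₁ (proj₂ ends) i)

    ab-edge : ∀ i → Edge (a i) (b i)
    ab-edge i = proj₂ (proj₁ (proj₂ matching)) (a i) λ e → Fin.<-irrefl (sym e) (a<b i)

    W : Subset n
    W = K₁ ∪ K₂

    a∈W : ∀ i → a i ∈ₛ W
    a∈W i = Sub.x∈p∪q⁺ ([ (λ p → inj₁ (proj₁ p)) , (λ p → inj₂ (proj₁ p)) ]′ (edge⁻ (ab-edge i)))

    b∈W : ∀ i → b i ∈ₛ W
    b∈W i = Sub.x∈p∪q⁺ ([ (λ p → inj₁ (proj₂ p)) , (λ p → inj₂ (proj₂ p)) ]′ (edge⁻ (ab-edge i)))

    -- Otherwise F and the triples {aᵢ, bᵢ, x} would form a star.
    non-kernel : ∀ {F x} → F ∈ 𝓕 → (∀ {y} → y ∈ₛ F → y ∉ₛ W) → x ∈ₛ F → ∃[ i ] ¬ IsKernel (triple (a i) (b i) x)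
    non-kernel {F} {x} F∈ F∩W x∈ = Fin.¬∀⟶∃¬ d _ (λ i → isKernel? (triple (a i) (b i) x)) λ all →
      no-star x S record { kernels = kernels all ; center = center ; meet = λ {i} {j} → meet i j }
      where
      S : Fin s → Subset n
      S zero = F
      S (suc i) = triple (a i) (b i) x
      kernels : (∀ i → IsKernel (triple (a i) (b i) x)) → ∀ i → IsKernel (S i)
      kernels all zero = member-kernel F∈
      kernels all (suc i) = all i
      center : ∀ i → x ∈ₛ S i
      center zero = x∈
      center (suc i) = ∈-set⁺ (there (there (here refl)))
      F-meet : ∀ i {y} → y ∈ₛ F → y ∈ₛ triple (a i) (b i) x → y ≡ x
      F-meet i y∈F y∈ with ∈-set⁻ (a i ∷ b i ∷ x ∷ []) y∈
      ... | here refl = contradiction (a∈W i) (F∩W y∈F)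
      ... | there (here refl) = contradiction (b∈W i) (F∩W y∈F)
      ... | there (there (here e)) = e
      meet : ∀ i j {y} → i ≢ j → y ∈ₛ S i → y ∈ₛ S j → y ≡ x
      meet zero zero i≢j _ _ = contradiction refl i≢j
      meet zero (suc j) _ p q = F-meet j p q
      meet (suc i) zero _ p q = F-meet i q p
      meet (suc i) (suc j) i≢j p q =
        triple-meet {M = M} inv (λ e → i≢j (cong suc (proj₂ (proj₂ ends) e))) (a<b i) (a<b j) p q

    -- A set touching a clique has a second point in that clique, and then satisfies all conditions
    -- of the two-clique family.
    misses-W : ∀ {F} → F ∈ 𝓕 → ¬ InFamily k K₁ K₂ F → ∀ {y} → y ∈ₛ F → y ∉ₛ W
    misses-W {F} F∈ ¬in {y} y∈ y∈W = ¬in (∣F∣≡k F∈ , two (Sub.x∈p∪q⁻ K₁ K₂ y∈W) , K₁≢1 , K₂≢1)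
      where
      K₁≢1 : ∣ F ∩ K₁ ∣ ≢ 1
      K₁≢1 = meets-clique K₁ ∣K₁∣ edge⁺₁ F∈
      K₂≢1 : ∣ F ∩ K₂ ∣ ≢ 1
      K₂≢1 = meets-clique K₂ ∣K₂∣ edge⁺₂ F∈
      enlarge : ∀ {P} → P ⊆ₛ W → ∣ F ∩ P ∣ ≢ 1 → y ∈ₛ P → 2 ≤ ∣ F ∩ W ∣
      enlarge {P} P⊆ ≢1 y∈P = let y′ , y′≢y , y′∈ = second (Sub.x∈p∩q⁺ (y∈ , y∈P)) ≢1
                                  y′∈F , y′∈P = Sub.x∈p∩q⁻ F P y′∈
        in ∣∣≥2 y′≢y (Sub.x∈p∩q⁺ (y′∈F , P⊆ y′∈P)) (Sub.x∈p∩q⁺ (y∈ , P⊆ y∈P))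
      two : y ∈ₛ K₁ ⊎ y ∈ₛ K₂ → 2 ≤ ∣ F ∩ W ∣
      two (inj₁ p) = enlarge (Sub.p⊆p∪q K₂) K₁≢1 p
      two (inj₂ p) = enlarge (Sub.q⊆p∪q K₁ K₂) K₂≢1 p

    -- A point outside `Y` inherits the edges of the common link, so all its triples with the
    -- matching edges are kernels, against `non-kernel`.
    within-Y : ∀ {F} → F ∈ 𝓕 → ¬ InFamily k K₁ K₂ F → ∀ {x} → x ∈ₛ F → x ∈ Y
    within-Y F∈ ¬in {x} x∈ = decidable-stable (x ∈ₗ? Y) λ x∉ →
      let i , ¬K = non-kernel F∈ (misses-W F∈ ¬in) x∈
          _ , _ , _ , _ , K = transfer x∉ (ab-edge i)
      in ¬K K

    inside-part : List (Subset n)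
    inside-part = filter (inFamily? k K₁ K₂) 𝓕

    few-outside : length 𝓕 ≤ length inside-part + c ^ k
    few-outside = begin
      length 𝓕 ≤⟨ unique-⊆-length (proj₁ (proj₁ (proj₁ extremal))) (λ {F} → split F) ⟩
      length (inside-part ++ map range (words Y k)) ≡⟨ length-++ inside-part ⟩
      length inside-part + length (map range (words Y k)) ≡⟨ cong (length inside-part +_) (trans (length-map range (words Y k)) (length-words Y k)) ⟩
      length inside-part + length Y ^ k ≤⟨ +-monoʳ-≤ (length inside-part) (^-monoˡ-≤ k Y≤) ⟩
      length inside-part + c ^ k ∎
      where
      open ≤-Reasoning
      split : ∀ F → F ∈ 𝓕 → F ∈ inside-part ++ map range (words Y k)
      split F F∈ with inFamily? k K₁ K₂ F
      ... | yes p = ∈-++⁺ˡ (∈-filter⁺ (inFamily? k K₁ K₂) F∈ p)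
      ... | no ¬p = ∈-++⁺ʳ inside-part (as-word (enumerate F (∣F∣≡k F∈)))
        where
        as-word : Σ[ v ∈ Vec (Fin n) k ] Inj v × range v ≡ F → F ∈ map range (words Y k)
        as-word (v , _ , e) = subst (_∈ map range (words Y k)) e (∈-map⁺ range (∈-words v λ i →
          within-Y F∈ ¬p (subst (lookup v i ∈ₛ_) e (∈-range⁺ v i))))

    family-smaller : length (family k K₁ K₂) ≤ length 𝓕
    family-smaller = proj₂ extremal (family k K₁ K₂) (family-admissible s k odd K₁ K₂ ∣K₁∣ ∣K₂∣)

    -- The members of the two-clique family absent from `𝓕` cannot outnumber the members of `𝓕`
    -- outside it, since `𝓕` is extremal; and those are ranges of words over `Y`.
    few-lost : (L : List (Subset n)) → Unique L → (∀ {F} → F ∈ L → InFamily k K₁ K₂ F × F ∉ 𝓕) → length L ≤ c ^ k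
    few-lost L u h = +-cancelˡ-≤ (length inside-part) (length L) (c ^ k) (begin
      length inside-part + length L ≡⟨ sym (length-++ inside-part) ⟩
      length (inside-part ++ L) ≤⟨ unique-⊆-length
        (Unique.++⁺ (Unique.filter⁺ (inFamily? k K₁ K₂) (proj₁ (proj₁ (proj₁ extremal)))) u
          λ (p , q) → proj₂ (h q) (proj₁ (inside⁻ p)))
        (λ F∈ → ∈-family⁺ ([ proj₂ ∘ inside⁻ , proj₁ ∘ h ]′ (∈-++⁻ inside-part F∈))) ⟩
      length (family k K₁ K₂) ≤⟨ family-smaller ⟩
      length 𝓕 ≤⟨ few-outside ⟩
      length inside-part + c ^ k ∎)
      where
      open ≤-Reasoning
      inside⁻ : ∀ {F} → F ∈ inside-part → F ∈ 𝓕 × InFamily k K₁ K₂ F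
      inside⁻ = ∈-filter⁻ (inFamily? k K₁ K₂) {xs = 𝓕}

    -- A blocked triple {aᵢ, bᵢ, x} keeps about n sets of the two-clique family out of 𝓕.
    module Lost (x : Fin n) (x∉W : x ∉ₛ W) (i : Fin d) (Z : Subset n) (Z≤ : ∣ Z ∣ ≤ z)
      (blocked : ∀ {F} → F ∈ 𝓕 → ¬ Extends (triple (a i) (b i) x) Z F) where

      A : List (Fin n)
      A = a i ∷ b i ∷ x ∷ toList Z ++ toList K₁ ++ toList K₂

      length-A : length A ≤ 3 + (z + (s + s))
      length-A = +-monoʳ-≤ 3 (begin
        length (toList Z ++ toList K₁ ++ toList K₂) ≡⟨ trans (length-++ (toList Z)) (cong (length (toList Z) +_) (length-++ (toList K₁))) ⟩
        length (toList Z) + (length (toList K₁) + length (toList K₂)) ≡⟨ cong₂ _+_ (length-toList Z)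
          (cong₂ _+_ (trans (length-toList K₁) ∣K₁∣) (trans (length-toList K₂) ∣K₂∣)) ⟩
        ∣ Z ∣ + (s + s) ≤⟨ +-monoˡ-≤ (s + s) Z≤ ⟩
        z + (s + s) ∎)
        where open ≤-Reasoning

      W⊆A : ∀ {y} → y ∈ₛ W → y ∈ A
      W⊆A y∈ = there (there (there (∈-++⁺ʳ (toList Z) ([ (λ p → ∈-++⁺ˡ (∈-toList⁺ p)) ,
        (λ p → ∈-++⁺ʳ (toList K₁) (∈-toList⁺ p)) ]′ (Sub.x∈p∪q⁻ K₁ K₂ y∈)))))

      Z⊆A : ∀ {y} → y ∈ₛ Z → y ∈ A
      Z⊆A y∈ = there (there (there (∈-++⁺ˡ (∈-toList⁺ y∈))))

      room : suc j ≤ length (complement A)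
      room = +-cancelˡ-≤ (length A) (suc j) (length (complement A)) (begin
        length A + suc j ≤⟨ +-monoˡ-≤ (suc j) length-A ⟩
        3 + (z + (s + s)) + suc j ≤⟨ m≤m+n _ (suc (c ^ k)) ⟩
        3 + (z + (s + s)) + suc j + suc (c ^ k) ≤⟨ many ⟩
        n ≤⟨ length-complement A ⟩
        length A + length (complement A) ∎)
        where open ≤-Reasoning

      fillers : Σ[ f ∈ (Fin (suc j) → Fin n) ] (∀ i → f i ∈ complement A) × (∀ {i j} → f i ≡ f j → i ≡ j)
      fillers = select (unique-complement A) room

      R : List (Fin n)
      R = List.tabulate (proj₁ fillers)

      R∉A : ∀ {y} → y ∈ R → y ∉ A
      R∉A y∈ = let t , e = ∈-tabulate⁻ {f = proj₁ fillers} y∈ in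
        subst (_∉ A) (sym e) (∈-complement⁻ A (proj₁ (proj₂ fillers) t))

      last : List (Fin n)
      last = complement (A ++ R)

      last∉A : ∀ {r} → r ∈ last → r ∉ A
      last∉A r∈ r∈A = ∈-complement⁻ (A ++ R) r∈ (∈-++⁺ˡ r∈A)

      last∉R : ∀ {r} → r ∈ last → r ∉ R
      last∉R r∈ r∈R = ∈-complement⁻ (A ++ R) r∈ (∈-++⁺ʳ A r∈R)

      -- Apart from the blocked triple, all letters avoid `Z` and both cliques, so the set meets the
      -- cliques only in the edge and `Z` only within the triple. `R` stays fixed; varying `r` alone
      -- already gives `n - O(1)` sets.
      letters : Fin n → List (Fin n)
      letters r = r ∷ a i ∷ b i ∷ x ∷ R

      lost : List (Subset n)
      lost = map (λ r → set (letters r)) last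

      unique-letters : ∀ {r} → r ∈ last → Unique (letters r)
      unique-letters r∈ =
        ∉⇒All≢ (λ { (here e) → last∉A r∈ (here e) ; (there (here e)) → last∉A r∈ (there (here e))
                   ; (there (there (here e))) → last∉A r∈ (there (there (here e))) ; (there (there (there p))) → last∉R r∈ p })
        ∷ ∉⇒All≢ (λ { (here e) → proj₁ (ab-edge i) e ; (there (here refl)) → x∉W (a∈W i) ; (there (there p)) → R∉A p (here refl) })
        ∷ ∉⇒All≢ (λ { (here refl) → x∉W (b∈W i) ; (there p) → R∉A p (there (here refl)) })
        ∷ ∉⇒All≢ (λ p → R∉A p (there (there (here refl))))
        ∷ Unique.tabulate⁺ (proj₂ (proj₂ fillers))

      unique-lost : Unique lost
      unique-lost = unique-map (unique-complement (A ++ R)) λ {r} {r′} r∈ _ e →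
        case r∈ (∈-set⁻ (letters r′) (subst (r ∈ₛ_) e (∈-set⁺ (here refl))))
        where
        case : ∀ {r r′} → r ∈ last → r ∈ letters r′ → r ≡ r′
        case r∈ (here e) = e
        case r∈ (there (here e)) = contradiction (here e) (last∉A r∈)
        case r∈ (there (there (here e))) = contradiction (there (here e)) (last∉A r∈)
        case r∈ (there (there (there (here e)))) = contradiction (there (there (here e))) (last∉A r∈)
        case r∈ (there (there (there (there p)))) = contradiction p (last∉R r∈)

      module _ {r : Fin n} (r∈ : r ∈ last) where

        lost-size : ∣ set (letters r) ∣ ≡ k
        -- The four named letters and the `suc j` fillers make `5 + j = k`.
        lost-size = trans (∣set∣ (unique-letters r∈)) (cong (4 +_) (length-tabulate (proj₁ fillers)))

        lost-∩W : ∀ {y} → y ∈ letters r → y ∈ₛ W → y ≡ a i ⊎ y ≡ b i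
        lost-∩W (here refl) y∈W = contradiction (W⊆A y∈W) (last∉A r∈)
        lost-∩W (there (here e)) _ = inj₁ e
        lost-∩W (there (there (here e))) _ = inj₂ e
        lost-∩W (there (there (there (here refl)))) y∈W = contradiction y∈W x∉W
        lost-∩W (there (there (there (there p)))) y∈W = contradiction (W⊆A y∈W) (R∉A p)

        lost-∩Z : ∀ {y} → y ∈ letters r → y ∈ₛ Z → y ∈ₛ triple (a i) (b i) x
        lost-∩Z (here refl) y∈Z = contradiction (Z⊆A y∈Z) (last∉A r∈)
        lost-∩Z (there (here e)) _ = ∈-set⁺ (here e)
        lost-∩Z (there (there (here e))) _ = ∈-set⁺ (there (here e))
        lost-∩Z (there (there (there (here e)))) _ = ∈-set⁺ (there (there (here e)))
        lost-∩Z (there (there (there (there p)))) y∈Z = contradiction (Z⊆A y∈Z) (R∉A p)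

        triple-⊆-lost : ∀ {y} → y ∈ a i ∷ b i ∷ x ∷ [] → y ∈ letters r
        triple-⊆-lost (here e) = there (here e)
        triple-⊆-lost (there (here e)) = there (there (here e))
        triple-⊆-lost (there (there (here e))) = there (there (there (here e)))

        lost-in-family : InFamily k K₁ K₂ (set (letters r))
        lost-in-family = edge-in-family {K = K₁} {L = K₂} {F = set (letters r)} disj lost-size
          (proj₁ (ab-edge i)) (edge⁻ (ab-edge i))
          (∈-set⁺ (there (here refl))) (∈-set⁺ (there (there (here refl)))) (λ y∈ → lost-∩W (∈-set⁻ (letters r) y∈))

        lost∉𝓕 : set (letters r) ∉ 𝓕
        lost∉𝓕 F∈𝓕 = blocked F∈𝓕 ((λ y∈ → ∈-set⁺ (triple-⊆-lost (∈-set⁻ (a i ∷ b i ∷ x ∷ []) y∈))) ,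
          λ y∈ → let y∈F , y∈Z = Sub.x∈p∩q⁻ (set (letters r)) Z y∈ in lost-∩Z (∈-set⁻ (letters r) y∈F) y∈Z)

      lost⁻ : ∀ {F} → F ∈ lost → InFamily k K₁ K₂ F × F ∉ 𝓕
      lost⁻ F∈ = let r , r∈ , e = ∈-map⁻ (λ r → set (letters r)) F∈ in
        subst (λ F → InFamily k K₁ K₂ F × F ∉ 𝓕) (sym e) (lost-in-family r∈ , lost∉𝓕 r∈)

      length-lost : suc (c ^ k) ≤ length lost
      length-lost = +-cancelˡ-≤ (3 + (z + (s + s)) + suc j) (suc (c ^ k)) (length lost) (begin
        3 + (z + (s + s)) + suc j + suc (c ^ k) ≤⟨ many ⟩
        n ≤⟨ length-complement (A ++ R) ⟩
        length (A ++ R) + length last ≡⟨ cong₂ _+_ (trans (length-++ A) (cong (length A +_) (length-tabulate (proj₁ fillers))))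
          (sym (length-map (λ r → set (letters r)) last)) ⟩
        length A + suc j + length lost ≤⟨ +-monoˡ-≤ (length lost) (+-monoˡ-≤ (suc j) length-A) ⟩
        3 + (z + (s + s)) + suc j + length lost ∎)
        where open ≤-Reasoning

      impossible : ⊥
      impossible = <⇒≱ length-lost (few-lost lost unique-lost lost⁻)

    inside-family : ∀ {F} → F ∈ 𝓕 → InFamily k K₁ K₂ F
    inside-family {F} F∈ = decidable-stable (inFamily? k K₁ K₂ F) λ ¬in →
      let x , x∈ = inhabited {p = F} (≤-trans (s≤s z≤n) (≤-reflexive (sym (∣F∣≡k F∈))))
          i , ¬K = non-kernel F∈ (misses-W F∈ ¬in) x∈
          Z , Z≤ , blocked = ¬kernel⇒blocking (triple (a i) (b i) x) ¬K
      in Lost.impossible x (misses-W F∈ ¬in x∈) i Z Z≤ blocked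

    -- `𝓕` lies inside the two-clique family and, being extremal, is at least as large, so the
    -- inclusion reverses.
    ∈𝓕⇔inFamily : ∀ F → F ∈ 𝓕 ⇔ InFamily k K₁ K₂ F
    ∈𝓕⇔inFamily F = mk⇔ inside-family λ F-in →
      ⊆-reverse _≟ₛ_ (proj₁ (proj₁ (proj₁ extremal))) (λ F∈ → ∈-family⁺ (inside-family F∈)) family-smaller (∈-family⁺ F-in)

  structure : c < n → CliqueStructure s k 𝓕
  structure c<n = let o , Y , Y≤ , cl , transfer = Counting.common-link n d j 1≤d odd 𝓕 extremal 2s≤n c<n in
    TwoCliques.K₁ cl , TwoCliques.K₂ cl , TwoCliques.∣K₁∣ cl , TwoCliques.∣K₂∣ cl ,
    (λ {x} → TwoCliques.disj cl {x}) , ∈𝓕⇔inFamily o Y Y≤ cl transfer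

-- Three demands are added up: room for two disjoint `s`-sets, more points than strangers, and
-- `many`. For `k = 5 + j`, the term `k ∸ 4` is `suc j`.
threshold : ℕ → ℕ → ℕ
threshold s k = s + s + (word-constant s k + (3 + (s * k + (s + s)) + (k ∸ 4) + suc (word-constant s k ^ k)))

-- From clique vertex sets back to graphs

completeGraph : {n : ℕ} → Subset n → Graph n
completeGraph K = record
  { V = K
  ; Adj = λ x y → x ∈ₛ K × y ∈ₛ K × x ≢ y
  ; Adj-sym = λ (x∈ , y∈ , x≢y) → y∈ , x∈ , x≢y ∘ sym
  ; Adj-irrefl = λ (_ , _ , x≢x) → x≢x refl
  ; Adj⇒∈V = proj₁ }

complete-isClique : {n s : ℕ} {K : Subset n} → ∣ K ∣ ≡ s → IsClique s (completeGraph K)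
complete-isClique ∣K∣ = ∣K∣ , λ {_} {_} x∈ y∈ x≢y → x∈ , y∈ , x≢y

extremal-structure : ∀ s k n → 1 < s → s % 2 ≡ 1 → 5 ≤ k → threshold s k ≤ n →
  (𝓕 : Family n) → Extremal s k 𝓕 → CliqueStructure s k 𝓕
extremal-structure (suc d) k n (s≤s 1≤d) odd 5≤k n₀≤n 𝓕 extremal with m≤n⇒∃[o]m+o≡n 5≤k
... | j , refl = Uniqueness.structure n d j 1≤d odd 𝓕 extremal
    (≤-trans (m≤m+n (s + s) (c + t)) n₀≤n) (≤-trans (m≤n+m t c) c+t≤n)
    (≤-trans (≤-trans (≤-reflexive (+-comm 1 c)) (+-monoʳ-≤ c (s≤s z≤n))) c+t≤n)
  where
  s c t : ℕ
  s = suc d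
  c = word-constant s (5 + j)
  t = 3 + (s * (5 + j) + (s + s)) + suc j + suc (c ^ (5 + j))
  c+t≤n : c + t ≤ n
  c+t≤n = ≤-trans (m≤n+m (c + t) (s + s)) n₀≤n

theorem1p1 :
    Σ[ n₀ ∈ (ℕ → ℕ → ℕ) ]
      (∀ (s k n : ℕ) → 1 < s → s % 2 ≡ 1 → 5 ≤ k → n₀ s k ≤ n →
       (𝓕 : Family n) → Extremal s k 𝓕 →
       Σ[ G ∈ Graph n ] Σ[ K₁ ∈ Graph n ] Σ[ K₂ ∈ Graph n ]
         (G ≡ K₁ ⊔ K₂ × Disjoint K₁ K₂ × IsClique s K₁ × IsClique s K₂ ×
          (∀ (F : Subset n) →
             F ∈ 𝓕 ⇔
             (∣ F ∣ ≡ k × 2 ≤ ∣ F ∩ V G ∣ ×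
              ∣ F ∩ V K₁ ∣ ≢ 1 × ∣ F ∩ V K₂ ∣ ≢ 1))))
theorem1p1 = threshold , λ s k n 1<s odd 5≤k n₀≤n 𝓕 extremal →
  let K , L , ∣K∣ , ∣L∣ , disj , mem = extremal-structure s k n 1<s odd 5≤k n₀≤n 𝓕 extremal in
  completeGraph K ⊔ completeGraph L , completeGraph K , completeGraph L , refl ,
  (λ (x , x∈) → let p , q = Sub.x∈p∩q⁻ K L x∈ in disj p q) ,
  complete-isClique ∣K∣ , complete-isClique ∣L∣ , mem
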